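{- (i) Let $S\equiv\pm\{1, 3, 4, 5, 7, 18, 21, 22, 23, 24, 25, 27\}\pmod{56}$ and $T\equiv\pm\{1, 2, 3, 7, 11, 17, 20, 21, 24, 25, 26, 27\}\pmod{56}$. Then $p(S,n)=p(T,n-1)$ for all $n\geq 1$. (ii) Let $S\equiv\pm\{2, 3, 7, 9, 10, 12, 13, 15, 16, 19, 21, 25\}\pmod{56}$ and $T\equiv\pm\{3, 4, 5, 6, 7, 9, 16, 19, 21, 22, 23, 25\}\pmod{56}$. Then $p(S,n)=p(T,n)$ for all integers $n\ge0$ with $n\neq 2$. (iii) Let $S\equiv\pm\{2, 3, 5, 7, 8, 13, 15, 20, 21, 22, 23, 25\}\pmod{56}$ and $T\equiv\pm\{1, 5, 7, 8, 10, 12, 13, 15, 18, 21, 23, 27\}\pmod{56}$. Then $p(S,n)=p(T,n)$ for all integers $n\ge0$ with $n\neq 1$. (iv) Let $S\equiv\pm\{1, 7, 8, 9, 10, 12, 13, 15, 18, 19, 21, 27\}\pmod{56}$ and $T\equiv\pm\{1, 6, 7, 8, 9, 11, 17, 19, 20, 21, 26, 27\}\pmod{56}$. Then $p(S,n)=p(T,n-1)$ for all $n\geq 1$. (v) Let $S\equiv\pm\{4, 5, 6, 7, 9, 11, 16, 17, 19, 21, 22, 23\}\pmod{56}$ and $T\equiv\pm\{1, 5, 7, 11, 12, 16, 17, 18, 21, 23, 26, 27\}\pmod{56}$. Then $p(S,n)=p(T,n-4)$ for all $n\geq 4$. (vi) Let $S\equiv\pm\{4, 6, 7, 9, 10, 11,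 13, 15, 17, 19, 21, 24\}\pmod{56}$ and $T\equiv\pm\{2, 3, 7, 11, 13, 15, 17, 20, 21, 24, 25, 26\}\pmod{56}$. Then $p(S,n)=p(T,n-4)$ for all $n\geq 4$.
   Context: For a set $S$ of positive integers and an integer $n\ge 0$, $p(S,n)$ denotes the number of partitions of $n$ into parts belonging to $S$ (so $p(S,0)=1$). The notation $S\equiv\pm\{r_1,\dots,r_k\}\pmod M$ means that $S$ is the set of all positive integers $n$ such that $n\equiv r_i$ or $n\equiv -r_i\pmod M$ for some $i$. -}

module Defs where

open import Data.Nat using (ℕ; zero; suc; _+_; _∸_; _≤_; _≡ᵇ_)
open import Data.Nat.DivMod using (_%_)
open import Data.Bool using (Bool; true; false; _∧_; _∨_; if_then_else_)
open import Data.List using (List; []; _∷_; map; concatMap; filter; length; upTo)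
open import Data.Bool.ListAction using (any; all)
open import Relation.Binary.PropositionalEquality using (_≡_)

inRes : ℕ → List ℕ → ℕ → Bool
inRes M rs zero = false
inRes M rs (suc m) = any (λ r → ((suc m) % suc (M ∸ 1) ≡ᵇ r % suc (M ∸ 1))
                              ∨ ((suc m) % suc (M ∸ 1) ≡ᵇ (M ∸ (r % suc (M ∸ 1))) % suc (M ∸ 1))) rs

-- All partitions of n into positive parts each ≤ k, listed as non-increasing
-- lists of parts (each partition appears exactly once).
-- fuel argument f ≥ n ensures structural recursion.
partsFuel : ℕ → ℕ → ℕ → List (List ℕ)
partsFuel f k zero = [] ∷ []
partsFuel zero k (suc n) = []
partsFuel (suc f) k (suc n) =
  concatMap (λ j → map (λ π → suc j ∷ π) (partsFuel f (suc j) (suc n ∸ suc j)))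
            (filter (λ j → suc j Data.Nat.≤? k) (filter (λ j → suc j Data.Nat.≤? suc n) (upTo (suc n))))
  where import Data.Nat

partitions : ℕ → List (List ℕ)
partitions n = partsFuel n n n

p : (ℕ → Bool) → ℕ → ℕ
p S n = length (filter (λ π → all S π Data.Bool.≟ true) (partitions n))
  where import Data.Bool

S56 : List ℕ → ℕ → Bool
S56 rs = inRes 56 rs

-- Write [a;M] for the product of (1 - q^n) over all n > 0 with n ≡ ±a mod M, and [-a;M] for the
-- product of (1 + q^n). Up to exchanging S and T, each claim has the form q^i/[S] = q^j/[T] + q^k with
-- explicit i, j, k. The odd classes of S mod 56 merge into classes ±t₁, ±t₂, ±t₃, ±β mod 28 and those
-- of T into ±t₁, ±t₂, ±t₃, ±α.
-- Let Π = [t₁;28][t₂;28][t₃;28] and Π⁻ = [-t₁;28][-t₂;28][-t₃;28]. A fundamental four-theta formula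
-- of Jacobi, one of whose theta factors degenerates, turns both Π[α;28] ± Π⁻[-α;28] and
-- Π[β;28] ± Π⁻[-β;28] into single products; so does a two-theta formula for
-- [α;28][-β;28] ± [-α;28][β;28]. Eliminating Π⁻ from the first two leaves Π times the third as a
-- combination of two products, and dividing everything out gives the claim.
-- The theta formulas follow from the triple product identity and the substitution m = u + v,
-- n = u - v or n = u - v + 1 in double sums over ℤ². The ring used is ℤ[[q]]/(q^K) for large K:
-- there q is nilpotent, so all sums and products are finite.

module Submission where

open import Defs
open import Algebra.Bundles using (CommutativeRing)
open import Data.Bool.Base using (Bool; true; false; if_then_else_; _∨_)
import Data.Bool.Properties as Bool
open import Data.Bool.ListAction using (all; any)
open import Data.Integer.Base as ℤ using (ℤ; +_; -[1+_]; ∣_∣; _⊖_)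
import Data.Integer.Properties as ℤ
import Data.Integer.Solver as ℤS
open import Data.List.Base using (List; []; _∷_; [_]; _++_; _∷ʳ_; map; concatMap; filter; length; upTo)
import Data.List.Properties as List
open import Data.List.Relation.Unary.All using (All; []; _∷_; all?)
open import Data.List.Sort.InsertionSort.Base using () renaming (insert to insertBy; sort to sortBy)
open import Data.Nat.Base as ℕ using (ℕ; zero; suc; _≡ᵇ_; _≥_; _∸_)
open import Data.Nat.DivMod using (_%_; [m+kn]%n≡m%n)
open import Data.Nat.ListAction using (sum)
open import Data.Nat.ListAction.Properties using (sum-++)
import Data.Nat.Properties as ℕ
import Data.Nat.Solver as ℕS
open import Data.Product using (_×_; _,_; ∃-syntax)
open import Data.Sum as Sum using (_⊎_; inj₁; inj₂)
open import Level using (0ℓ)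
open import Relation.Binary.Definitions using (tri<; tri≈; tri>)
open import Relation.Binary.PropositionalEquality as ≡ using (_≡_; _≢_; _≗_)
open import Relation.Nullary using (yes; no; does; contradiction)
open import Relation.Nullary.Decidable using (True; toWitness)

-- Bilateral sums

-- Three obstacles shape the development. Truncation makes q nilpotent, so neither quotients of
-- theta arguments nor negative powers of q are available: the theta formulas are stated in terms of
-- the quotients (X = Y g instead of X / Y), and a power of q common to all terms of a claim is
-- removed only when coefficients are read off. The degenerate theta factor is f(1, q^28); with it
-- comes a 2, which has no inverse over ℤ and has to be cancelled instead. Finally, the four-theta
-- formula with a plus sign takes four residues with sum 28, the one with a minus sign four residues
-- of which the largest and the smallest add up to the sum of the other two. A class ±r mod 28 may
-- be represented by r or by 28 - r, and this freedom is used to meet the conditions: thus 17 stands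
-- for 11 in (i). In a four-theta difference the smallest of the four residues becomes an exponent
-- of q, in the two-theta difference β does; these are the exponents i, j, k of the claims, all
-- others being 0.

i+j-j≡i : ∀ i j → (i ℤ.+ j) ℤ.- j ≡ i
i+j-j≡i = solve 2 (λ i j → (i :+ j) :- j := i) ≡.refl
  where open ℤS.+-*-Solver

i+suc[k]≡suc[i]+k : ∀ i k → i ℤ.+ + suc k ≡ ℤ.suc i ℤ.+ + k
i+suc[k]≡suc[i]+k i k = solve 2 (λ i k → i :+ (con (+ 1) :+ k) := (con (+ 1) :+ i) :+ k) ≡.refl i (+ k)
  where open ℤS.+-*-Solver

shift-outside : ∀ {B} h n → ∣ h ∣ ℕ.+ B ℕ.< ∣ n ∣ → B ℕ.< ∣ n ℤ.+ h ∣
shift-outside {B} h n lt = ℕ.+-cancelʳ-< ∣ h ∣ B _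
  (ℕ.<-≤-trans (≡.subst (ℕ._< ∣ n ∣) (ℕ.+-comm ∣ h ∣ B) lt)
    (≡.subst (λ z → ∣ z ∣ ℕ.≤ ∣ n ℤ.+ h ∣ ℕ.+ ∣ h ∣) (i+j-j≡i n h) (ℤ.∣i-j∣≤∣i∣+∣j∣ (n ℤ.+ h) h)))

i+[j-i]≡j : ∀ i j → i ℤ.+ (j ℤ.- i) ≡ j
i+[j-i]≡j = solve 2 (λ i j → i :+ (j :- i) := j) ≡.refl
  where open ℤS.+-*-Solver

[u+v]-[u-v] : ∀ u v → v ℤ.+ v ≡ (u ℤ.+ v) ℤ.- (u ℤ.- v)
[u+v]-[u-v] = solve 2 (λ u v → v :+ v := (u :+ v) :- (u :- v)) ≡.refl
  where open ℤS.+-*-Solver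

[u+v]-suc[u-v] : ∀ u v → v ℤ.+ ℤ.pred v ≡ (u ℤ.+ v) ℤ.- ℤ.suc (u ℤ.- v)
[u+v]-suc[u-v] = solve 2 (λ u v → v :+ (con (ℤ.- (+ 1)) :+ v) := (u :+ v) :- (con (+ 1) :+ (u :- v))) ≡.refl
  where open ℤS.+-*-Solver

2u-[v+u] : ∀ u v → u ℤ.- v ≡ (u ℤ.+ u) ℤ.- (v ℤ.+ u)
2u-[v+u] = solve 2 (λ u v → u :- v := (u :+ u) :- (v :+ u)) ≡.refl
  where open ℤS.+-*-Solver

suc[2u]-[v+u] : ∀ u v → ℤ.suc (u ℤ.- v) ≡ ℤ.suc (u ℤ.+ u) ℤ.- (v ℤ.+ u)
suc[2u]-[v+u] = solve 2 (λ u v → con (+ 1) :+ (u :- v) := (con (+ 1) :+ (u :+ u)) :- (v :+ u)) ≡.refl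
  where open ℤS.+-*-Solver

double : ∀ {K} v → K ℕ.< ∣ v ∣ → K ℕ.+ K ℕ.< ∣ v ℤ.+ v ∣
double (+ n)    lt = ℕ.+-mono-< lt lt
double -[1+ n ] lt = ℕ.<-≤-trans (ℕ.+-mono-< lt lt) (ℕ.≤-reflexive (≡.cong suc (ℕ.+-suc n n)))

-- The number v + (v - 1) is m - n for m = u + v and n = u - v + 1. For positive v the bound is
-- attained: v = K + 1 gives exactly 2K + 1.
double-pred : ∀ {K} v → K ℕ.< ∣ v ∣ → K ℕ.+ K ℕ.< ∣ v ℤ.+ ℤ.pred v ∣
double-pred (+ suc n) (ℕ.s≤s le) = ℕ.s≤s (ℕ.+-mono-≤ le le)
double-pred -[1+ n ]  (ℕ.s≤s le) = ℕ.s≤s (ℕ.m≤n⇒m≤1+n (ℕ.+-mono-≤ le (ℕ.m≤n⇒m≤1+n le)))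

-- Triangle inequality. It says that a diagonal farther than 2K from the origin misses the box on
-- which a double sum is supported.
box-sum : ∀ {K} i j → K ℕ.+ K ℕ.< ∣ i ℤ.+ j ∣ → K ℕ.< ∣ i ∣ ⊎ K ℕ.< ∣ j ∣
box-sum {K} i j lt with K ℕ.<? ∣ i ∣
... | yes K<i = inj₁ K<i
... | no  K≮i = inj₂ (ℕ.≰⇒> λ le → ℕ.<⇒≱ lt
  (ℕ.≤-trans (ℤ.∣i+j∣≤∣i∣+∣j∣ i j) (ℕ.+-mono-≤ (ℕ.≮⇒≥ K≮i) le)))

box-difference : ∀ {K} i j → K ℕ.+ K ℕ.< ∣ i ℤ.- j ∣ → K ℕ.< ∣ i ∣ ⊎ K ℕ.< ∣ j ∣
box-difference {K} i j lt =
  Sum.map₂ (≡.subst (K ℕ.<_) (ℤ.∣-i∣≡∣i∣ j)) (box-sum i (ℤ.- j) lt)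

module BilateralSums (R : CommutativeRing 0ℓ 0ℓ) where
  open CommutativeRing R
  open import Relation.Binary.Reasoning.Setoid setoid
  open import Algebra.Solver.Ring.NaturalCoefficients.Default commutativeSemiring
    using (solve; _:=_; _:+_; _:*_; con)
  open import Algebra.Properties.AbelianGroup +-abelianGroup using () renaming (∙-cancelʳ to +-cancelʳ)

  Σ± : ℕ → (ℤ → Carrier) → Carrier
  Σ± zero    f = f (+ 0)
  Σ± (suc B) f = Σ± B f + (f (+ suc B) + f -[1+ B ])

  Supported : ℕ → (ℤ → Carrier) → Set
  Supported B f = ∀ n → B ℕ.< ∣ n ∣ → f n ≈ 0#

  Σ±-cong : ∀ B {f g} → (∀ n → f n ≈ g n) → Σ± B f ≈ Σ± B g
  Σ±-cong zero    e = e _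
  Σ±-cong (suc B) e = +-cong (Σ±-cong B e) (+-cong (e _) (e _))

  Σ±-zero : ∀ B {f} → (∀ n → f n ≈ 0#) → Σ± B f ≈ 0#
  Σ±-zero zero    e = e _
  Σ±-zero (suc B) e =
    trans (+-cong (Σ±-zero B e) (trans (+-cong (e _) (e _)) (+-identityʳ _))) (+-identityʳ _)

  Σ±-+ : ∀ B f g → Σ± B (λ n → f n + g n) ≈ Σ± B f + Σ± B g
  Σ±-+ zero    f g = refl
  Σ±-+ (suc B) f g = trans (+-congʳ (Σ±-+ B f g))
    (solve 6 (λ a b c d x y → (a :+ b) :+ ((c :+ d) :+ (x :+ y)) := (a :+ (c :+ x)) :+ (b :+ (d :+ y)))
      refl _ _ _ _ _ _)

  Σ±-*ˡ : ∀ B c f → Σ± B (λ n → c * f n) ≈ c * Σ± B f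
  Σ±-*ˡ zero    c f = refl
  Σ±-*ˡ (suc B) c f = trans (+-congʳ (Σ±-*ˡ B c f))
    (solve 4 (λ c a x y → c :* a :+ (c :* x :+ c :* y) := c :* (a :+ (x :+ y))) refl _ _ _ _)

  Σ±-*ʳ : ∀ B c f → Σ± B (λ n → f n * c) ≈ Σ± B f * c
  Σ±-*ʳ B c f = trans (Σ±-cong B (λ n → *-comm _ _)) (trans (Σ±-*ˡ B c f) (*-comm _ _))

  Σ±-* : ∀ B f g → Σ± B (λ m → Σ± B (λ n → f m * g n)) ≈ Σ± B f * Σ± B g
  Σ±-* B f g = trans (Σ±-cong B (λ m → Σ±-*ˡ B (f m) g)) (Σ±-*ʳ B _ f)

  Σ±-swap : ∀ B B′ (g : ℤ → ℤ → Carrier) →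
    Σ± B (λ m → Σ± B′ (g m)) ≈ Σ± B′ (λ n → Σ± B (λ m → g m n))
  Σ±-swap zero    B′ g = refl
  Σ±-swap (suc B) B′ g = sym (trans (Σ±-+ B′ _ _) (+-cong (sym (Σ±-swap B B′ g)) (Σ±-+ B′ _ _)))

  Σ±-extend : ∀ {B f} k → Supported B f → Σ± (k ℕ.+ B) f ≈ Σ± B f
  Σ±-extend         zero    s = refl
  Σ±-extend {B} {f} (suc k) s = begin
    Σ± (k ℕ.+ B) f + (f (+ suc (k ℕ.+ B)) + f -[1+ k ℕ.+ B ]) ≈⟨ +-cong (Σ±-extend k s) (+-cong (s _ lt) (s _ lt)) ⟩
    Σ± B f + (0# + 0#)  ≈⟨ solve 1 (λ x → x :+ (con 0 :+ con 0) := x) refl _ ⟩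
    Σ± B f ∎
    where lt = ℕ.s≤s (ℕ.m≤n+m B k)

  Σ±-bound : ∀ {B B′ f} → Supported B f → Supported B′ f → Σ± B f ≈ Σ± B′ f
  Σ±-bound {B} {B′} {f} s s′ = begin
    Σ± B f           ≈⟨ Σ±-extend B′ s ⟨
    Σ± (B′ ℕ.+ B) f  ≡⟨ ≡.cong (λ C → Σ± C f) (ℕ.+-comm B′ B) ⟩
    Σ± (B ℕ.+ B′) f  ≈⟨ Σ±-extend B s′ ⟩
    Σ± B′ f          ∎

  private
    -- Both sides are the sum of `f` from -B to B + 1.
    step : ∀ B (f : ℤ → Carrier) →
      Σ± B (λ n → f (ℤ.suc n)) + f (ℤ.- (+ B)) ≈ Σ± B f + f (+ suc B)
    step zero    f = +-comm _ _
    step (suc B) f = begin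
      (Σ± B f′ + (f (+ suc (suc B)) + f (ℤ.suc -[1+ B ]))) + f -[1+ B ]
        ≡⟨ ≡.cong (λ z → (Σ± B f′ + (f (+ suc (suc B)) + f z)) + f -[1+ B ]) (lemma B) ⟩
      (Σ± B f′ + (f (+ suc (suc B)) + f (ℤ.- (+ B)))) + f -[1+ B ]
        ≈⟨ solve 4 (λ a b c d → (a :+ (b :+ c)) :+ d := (a :+ c) :+ (b :+ d)) refl _ _ _ _ ⟩
      (Σ± B f′ + f (ℤ.- (+ B))) + (f (+ suc (suc B)) + f -[1+ B ])
        ≈⟨ +-congʳ (step B f) ⟩
      (Σ± B f + f (+ suc B)) + (f (+ suc (suc B)) + f -[1+ B ])
        ≈⟨ solve 4 (λ a b c d → (a :+ b) :+ (c :+ d) := (a :+ (b :+ d)) :+ c) refl _ _ _ _ ⟩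
      (Σ± B f + (f (+ suc B) + f -[1+ B ])) + f (+ suc (suc B)) ∎
      where
      f′ = λ n → f (ℤ.suc n)
      lemma : ∀ B → ℤ.suc -[1+ B ] ≡ ℤ.- (+ B)
      lemma zero    = ≡.refl
      lemma (suc B) = ≡.refl

  Σ±-suc : ∀ {B f} → Supported B f → Σ± (suc B) (λ n → f (ℤ.suc n)) ≈ Σ± B f
  Σ±-suc {B} {f} s = begin
    Σ± (suc B) (λ n → f (ℤ.suc n))                  ≈⟨ +-identityʳ _ ⟨
    Σ± (suc B) (λ n → f (ℤ.suc n)) + 0#             ≈⟨ +-congˡ (s -[1+ B ] ℕ.≤-refl) ⟨
    Σ± (suc B) (λ n → f (ℤ.suc n)) + f -[1+ B ]     ≈⟨ step (suc B) f ⟩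
    Σ± (suc B) f + f (+ suc (suc B))                ≈⟨ +-cong (Σ±-extend 1 s) (s _ (ℕ.m≤n+m (suc B) 1)) ⟩
    Σ± B f + 0#                                     ≈⟨ +-identityʳ _ ⟩
    Σ± B f ∎

  Supported-shift : ∀ {B f} h → Supported B f → Supported (∣ h ∣ ℕ.+ B) (λ n → f (n ℤ.+ h))
  Supported-shift h s n lt = s _ (shift-outside h n lt)

  private
    shiftℕ : ∀ k {B f} → Supported B f → Σ± (k ℕ.+ B) (λ n → f (n ℤ.+ + k)) ≈ Σ± B f
    shiftℕ zero    {B} {f} s = Σ±-cong B (λ n → reflexive (≡.cong f (ℤ.+-identityʳ n)))
    shiftℕ (suc k) {B} {f} s = begin
      Σ± (suc (k ℕ.+ B)) (λ n → f (n ℤ.+ + suc k))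
        ≈⟨ Σ±-cong (suc (k ℕ.+ B)) (λ n → reflexive (≡.cong f (i+suc[k]≡suc[i]+k n k))) ⟩
      Σ± (suc (k ℕ.+ B)) (λ n → f (ℤ.suc n ℤ.+ + k))
        ≈⟨ Σ±-suc (Supported-shift (+ k) s) ⟩
      Σ± (k ℕ.+ B) (λ n → f (n ℤ.+ + k)) ≈⟨ shiftℕ k s ⟩
      Σ± B f ∎

  -- Any two windows that contain the support give the same sum. Leaving `B′` free allows a sum over
  -- a box to be recentred without enlarging the box.
  Σ±-shift : ∀ {B B′ f} h → Supported B f → Supported B′ (λ n → f (n ℤ.+ h)) →
    Σ± B′ (λ n → f (n ℤ.+ h)) ≈ Σ± B f
  Σ±-shift (+ k) s s′ = trans (Σ±-bound s′ (Supported-shift (+ k) s)) (shiftℕ k s)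
  -- A negative shift is undone by a positive shift of the already shifted function.
  Σ±-shift {B} {B′} {f} -[1+ k ] s s′ = begin
    Σ± B′ f′                                     ≈⟨ shiftℕ (suc k) s′ ⟨
    Σ± (suc k ℕ.+ B′) (λ n → f′ (n ℤ.+ + suc k)) ≈⟨ Σ±-cong (suc k ℕ.+ B′) back ⟩
    Σ± (suc k ℕ.+ B′) f
      ≈⟨ Σ±-bound {B = suc k ℕ.+ B′} (λ n lt → trans (sym (back n)) (Supported-shift (+ suc k) s′ n lt)) s ⟩
    Σ± B f ∎
    where
    f′ = λ n → f (n ℤ.+ -[1+ k ])
    back : ∀ n → f′ (n ℤ.+ + suc k) ≈ f n
    back n = reflexive (≡.cong f (i+j-j≡i n (+ suc k)))

  -- For u from -B to B the numbers 2u fill the even places from -2B to 2B, but 2u + 1 runs from 1 -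
  -- 2B to 2B + 1; hence the extra term at 2B + 1.
  Σ±-parity : ∀ B (f : ℤ → Carrier) → Σ± (B ℕ.+ B) f + f (+ suc (B ℕ.+ B)) ≈
    Σ± B (λ u → f (u ℤ.+ u)) + Σ± B (λ u → f (ℤ.suc (u ℤ.+ u)))
  Σ±-parity zero    f = refl
  Σ±-parity (suc B) f
    rewrite ℕ.+-suc B B = begin
      ((S + (f (+ suc C) + f -[1+ C ])) + (f (+ suc (suc C)) + f -[1+ suc C ])) + f (+ suc (suc (suc C)))
        ≈⟨ solve 6 (λ s a b c d e → ((s :+ (a :+ b)) :+ (c :+ d)) :+ e := (s :+ a) :+ ((c :+ d) :+ (e :+ b))) refl _ _ _ _ _ _ ⟩
      (S + f (+ suc C)) + ((f (+ suc (suc C)) + f -[1+ suc C ]) + (f (+ suc (suc (suc C))) + f -[1+ C ]))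
        ≈⟨ +-congʳ (Σ±-parity B f) ⟩
      (E + O) + ((f (+ suc (suc C)) + f -[1+ suc C ]) + (f (+ suc (suc (suc C))) + f -[1+ C ]))
        ≈⟨ solve 4 (λ s t a b → (s :+ t) :+ (a :+ b) := (s :+ a) :+ (t :+ b)) refl _ _ _ _ ⟩
      (E + (f (+ suc (suc C)) + f -[1+ suc C ])) + (O + (f (+ suc (suc (suc C))) + f -[1+ C ])) ∎
    where
    C = B ℕ.+ B
    S = Σ± C f
    E = Σ± B (λ u → f (u ℤ.+ u))
    O = Σ± B (λ u → f (ℤ.suc (u ℤ.+ u)))

  Supported² : ℕ → (ℤ → ℤ → Carrier) → Set
  Supported² K g = ∀ m n → K ℕ.< ∣ m ∣ ⊎ K ℕ.< ∣ n ∣ → g m n ≈ 0#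

  -- Sum along the diagonals m + n = d, separate d = 2u from d = 2u + 1, and on each diagonal put m
  -- = u + v. The support condition keeps every window equal to K.
  Σ±-diagonals : ∀ K (g : ℤ → ℤ → Carrier) → Supported² K g →
    Σ± K (λ m → Σ± K (g m)) ≈
      Σ± K (λ u → Σ± K (λ v → g (u ℤ.+ v) (u ℤ.- v)))
      + Σ± K (λ u → Σ± K (λ v → g (u ℤ.+ v) (ℤ.suc (u ℤ.- v))))
  Σ±-diagonals K g s = begin
    Σ± K (λ m → Σ± K (g m))
      ≈⟨ Σ±-cong K (λ m → Σ±-shift (ℤ.- m) (λ n lt → s m n (inj₂ lt)) (λ d lt → s m _ (outside m d lt))) ⟨
    Σ± K (λ m → Σ± (K ℕ.+ K) (λ d → g m (d ℤ.- m)))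
      ≈⟨ Σ±-swap K (K ℕ.+ K) _ ⟩
    Σ± (K ℕ.+ K) D
      -- The diagonal d = 2K + 1 lies outside the support; it is added to supply the extra term of
      -- `Σ±-parity`.
      ≈⟨ +-identityʳ _ ⟨
    Σ± (K ℕ.+ K) D + 0#
      ≈⟨ +-congˡ (Σ±-zero K (λ m → s m _ (outside m (+ suc (K ℕ.+ K)) ℕ.≤-refl))) ⟨
    Σ± (K ℕ.+ K) D + D (+ suc (K ℕ.+ K))
      ≈⟨ Σ±-parity K D ⟩
    Σ± K (λ u → D (u ℤ.+ u)) + Σ± K (λ u → D (ℤ.suc (u ℤ.+ u)))
      ≈⟨ +-cong (Σ±-cong K even) (Σ±-cong K odd) ⟩
    Σ± K (λ u → Σ± K (λ v → g (u ℤ.+ v) (u ℤ.- v)))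
      + Σ± K (λ u → Σ± K (λ v → g (u ℤ.+ v) (ℤ.suc (u ℤ.- v)))) ∎
    where
    outside : ∀ m d → K ℕ.+ K ℕ.< ∣ d ∣ → K ℕ.< ∣ m ∣ ⊎ K ℕ.< ∣ d ℤ.- m ∣
    outside m d lt = box-sum m (d ℤ.- m) (≡.subst (λ z → K ℕ.+ K ℕ.< ∣ z ∣) (≡.sym (i+[j-i]≡j m d)) lt)

    D : ℤ → Carrier
    D d = Σ± K (λ m → g m (d ℤ.- m))

    supp : ∀ d → Supported K (λ m → g m (d ℤ.- m))
    supp d m lt = s m _ (inj₁ lt)

    even : ∀ u → D (u ℤ.+ u) ≈ Σ± K (λ v → g (u ℤ.+ v) (u ℤ.- v))
    even u = sym (trans (Σ±-cong K entry)
      (Σ±-shift {B′ = K} u (supp (u ℤ.+ u)) (λ v lt → trans (sym (entry v)) (s _ _ (box-difference (u ℤ.+ v) (u ℤ.- v)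
        (≡.subst (λ z → K ℕ.+ K ℕ.< ∣ z ∣) ([u+v]-[u-v] u v) (double v lt)))))))
      where
      entry : ∀ v → g (u ℤ.+ v) (u ℤ.- v) ≈ g (v ℤ.+ u) ((u ℤ.+ u) ℤ.- (v ℤ.+ u))
      entry v = reflexive (≡.cong₂ g (ℤ.+-comm u v) (2u-[v+u] u v))

    odd : ∀ u → D (ℤ.suc (u ℤ.+ u)) ≈ Σ± K (λ v → g (u ℤ.+ v) (ℤ.suc (u ℤ.- v)))
    odd u = sym (trans (Σ±-cong K entry)
      (Σ±-shift {B′ = K} u (supp (ℤ.suc (u ℤ.+ u))) (λ v lt → trans (sym (entry v)) (s _ _ (box-difference (u ℤ.+ v) (ℤ.suc (u ℤ.- v))
        (≡.subst (λ z → K ℕ.+ K ℕ.< ∣ z ∣) ([u+v]-suc[u-v] u v) (double-pred v lt)))))))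
      where
      entry : ∀ v → g (u ℤ.+ v) (ℤ.suc (u ℤ.- v)) ≈ g (v ℤ.+ u) (ℤ.suc (u ℤ.+ u) ℤ.- (v ℤ.+ u))
      entry v = reflexive (≡.cong₂ g (ℤ.+-comm u v) (suc[2u]-[v+u] u v))

-- Triangular numbers

triangle : ℕ → ℕ
triangle zero    = 0
triangle (suc n) = suc n ℕ.+ triangle n

-- The integer n (n + 1) / 2, which is nonnegative also for n < 0.
tri : ℤ → ℕ
tri (+ n)    = triangle n
tri -[1+ n ] = triangle n

private
  triangle-double : ∀ n → + triangle n ℤ.+ + triangle n ≡ (+ n) ℤ.* (+ n) ℤ.+ + n
  triangle-double zero    = ≡.refl
  triangle-double (suc n) = begin
    (+ 1 ℤ.+ + n ℤ.+ t) ℤ.+ (+ 1 ℤ.+ + n ℤ.+ t)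
      ≡⟨ solve 2 (λ n t → (con (+ 1) :+ n :+ t) :+ (con (+ 1) :+ n :+ t) := con (+ 2) :+ (n :+ n) :+ (t :+ t)) ≡.refl (+ n) t ⟩
    + 2 ℤ.+ (+ n ℤ.+ + n) ℤ.+ (t ℤ.+ t)
      ≡⟨ ≡.cong (λ z → + 2 ℤ.+ (+ n ℤ.+ + n) ℤ.+ z) (triangle-double n) ⟩
    + 2 ℤ.+ (+ n ℤ.+ + n) ℤ.+ ((+ n) ℤ.* (+ n) ℤ.+ + n)
      ≡⟨ solve 1 (λ n → con (+ 2) :+ (n :+ n) :+ (n :* n :+ n) := (con (+ 1) :+ n) :* (con (+ 1) :+ n) :+ (con (+ 1) :+ n)) ≡.refl (+ n) ⟩
    (+ suc n) ℤ.* (+ suc n) ℤ.+ + suc n ∎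
    where
    open ≡.≡-Reasoning
    open ℤS.+-*-Solver
    t = + triangle n

tri-double : ∀ i → + tri i ℤ.+ + tri i ≡ i ℤ.* i ℤ.+ i
tri-double (+ n)    = triangle-double n
tri-double -[1+ n ] = ≡.trans (triangle-double n)
  (solve 1 (λ n → n :* n :+ n := (:- (con (+ 1) :+ n)) :* (:- (con (+ 1) :+ n)) :+ (:- (con (+ 1) :+ n))) ≡.refl (+ n))
  where open ℤS.+-*-Solver

private
  halve : ∀ i j → i ℤ.+ i ≡ j ℤ.+ j → i ≡ j
  halve i j e = ℤ.*-cancelˡ-≡ (+ 2) i j (≡.trans (two i) (≡.trans e (≡.sym (two j))))
    where
    open ℤS.+-*-Solver
    two : ∀ i → + 2 ℤ.* i ≡ i ℤ.+ i
    two = solve 1 (λ i → con (+ 2) :* i := i :+ i) ≡.refl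

-- Everything is doubled first, because only twice a triangular number is a polynomial over ℤ.
tri-+ : ∀ i j → + tri (i ℤ.+ j) ≡ + tri i ℤ.+ + tri j ℤ.+ i ℤ.* j
tri-+ i j = halve _ _ (begin
  + tri (i ℤ.+ j) ℤ.+ + tri (i ℤ.+ j)  ≡⟨ tri-double (i ℤ.+ j) ⟩
  (i ℤ.+ j) ℤ.* (i ℤ.+ j) ℤ.+ (i ℤ.+ j)
    ≡⟨ solve 2 (λ i j → (i :+ j) :* (i :+ j) :+ (i :+ j) := (i :* i :+ i) :+ (j :* j :+ j) :+ (i :* j :+ i :* j)) ≡.refl i j ⟩
  (i ℤ.* i ℤ.+ i) ℤ.+ (j ℤ.* j ℤ.+ j) ℤ.+ (i ℤ.* j ℤ.+ i ℤ.* j)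
    ≡⟨ ≡.cong₂ (λ a b → a ℤ.+ b ℤ.+ (i ℤ.* j ℤ.+ i ℤ.* j)) (tri-double i) (tri-double j) ⟨
  (+ tri i ℤ.+ + tri i) ℤ.+ (+ tri j ℤ.+ + tri j) ℤ.+ (i ℤ.* j ℤ.+ i ℤ.* j)
    ≡⟨ solve 3 (λ a b c → (a :+ a) :+ (b :+ b) :+ (c :+ c) := (a :+ b :+ c) :+ (a :+ b :+ c)) ≡.refl (+ tri i) (+ tri j) (i ℤ.* j) ⟩
  (+ tri i ℤ.+ + tri j ℤ.+ i ℤ.* j) ℤ.+ (+ tri i ℤ.+ + tri j ℤ.+ i ℤ.* j) ∎)
  where
  open ≡.≡-Reasoning
  open ℤS.+-*-Solver

tri-neg : ∀ i → + tri (ℤ.- i) ≡ + tri i ℤ.- i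
tri-neg i = halve _ _ (begin
  + tri (ℤ.- i) ℤ.+ + tri (ℤ.- i)  ≡⟨ tri-double (ℤ.- i) ⟩
  (ℤ.- i) ℤ.* (ℤ.- i) ℤ.+ (ℤ.- i)
    ≡⟨ solve 1 (λ i → (:- i) :* (:- i) :+ (:- i) := (i :* i :+ i) :+ (:- i :- i)) ≡.refl i ⟩
  (i ℤ.* i ℤ.+ i) ℤ.+ (ℤ.- i ℤ.- i)  ≡⟨ ≡.cong (ℤ._+ (ℤ.- i ℤ.- i)) (tri-double i) ⟨
  (+ tri i ℤ.+ + tri i) ℤ.+ (ℤ.- i ℤ.- i)
    ≡⟨ solve 2 (λ a i → (a :+ a) :+ (:- i :- i) := (a :- i) :+ (a :- i)) ≡.refl (+ tri i) i ⟩
  (+ tri i ℤ.- i) ℤ.+ (+ tri i ℤ.- i) ∎)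
  where
  open ≡.≡-Reasoning
  open ℤS.+-*-Solver

-- The substitution separates the variables because the cross term of `tri` is u v for u + v and -u
-- v for u - v, and the two cancel in each exponent. The comparison is made in ℤ, where `tri-neg`
-- can be stated.
module Exponents (u v : ℤ) where
  private
    U V U⁻ V⁻ : ℕ
    U = tri u
    V = tri v
    U⁻ = tri (ℤ.- u)
    V⁻ = tri (ℤ.- v)
    m n n′ : ℤ
    m = u ℤ.+ v
    n = u ℤ.- v
    n′ = ℤ.suc (u ℤ.- v)

    open ℤS.+-*-Solver

    m-eq : + tri m ≡ + U ℤ.+ + V ℤ.+ u ℤ.* v
    m-eq = tri-+ u v

    m⁻-eq : + tri (ℤ.- m) ≡ + U ℤ.+ + V ℤ.+ u ℤ.* v ℤ.- (u ℤ.+ v)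
    m⁻-eq = ≡.trans (tri-neg m) (≡.cong (ℤ._- m) m-eq)

    n-eq : + tri n ≡ + U ℤ.+ (+ V ℤ.- v) ℤ.+ u ℤ.* (ℤ.- v)
    n-eq = ≡.trans (tri-+ u (ℤ.- v)) (≡.cong (λ z → + U ℤ.+ z ℤ.+ u ℤ.* (ℤ.- v)) (tri-neg v))

    n⁻-eq : + tri (ℤ.- n) ≡ + U ℤ.+ (+ V ℤ.- v) ℤ.+ u ℤ.* (ℤ.- v) ℤ.- (u ℤ.- v)
    n⁻-eq = ≡.trans (tri-neg n) (≡.cong (ℤ._- n) n-eq)

    n′-eq : + tri n′ ≡ + 1 ℤ.+ (+ U ℤ.+ (+ V ℤ.- v) ℤ.+ u ℤ.* (ℤ.- v)) ℤ.+ (+ 1) ℤ.* (u ℤ.- v)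
    n′-eq = ≡.trans (tri-+ (+ 1) n) (≡.cong (λ z → + 1 ℤ.+ z ℤ.+ (+ 1) ℤ.* (u ℤ.- v)) n-eq)

    n′⁻-eq : + tri (ℤ.- n′) ≡ + 1 ℤ.+ (+ U ℤ.+ (+ V ℤ.- v) ℤ.+ u ℤ.* (ℤ.- v)) ℤ.+ (+ 1) ℤ.* (u ℤ.- v) ℤ.- (+ 1 ℤ.+ (u ℤ.- v))
    n′⁻-eq = ≡.trans (tri-neg n′) (≡.cong (ℤ._- n′) n′-eq)

    -- These polynomials imitate how multiplication by 2, 1 and 4 unfolds on ℕ, final zero included,
    -- so that the equation given to the solver is the unfolded goal.
    dbl : ∀ {k} → Polynomial k → Polynomial k
    dbl a = a :+ (a :+ con (+ 0))

    one quad : ∀ {k} → Polynomial k → Polynomial k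
    one a = a :+ con (+ 0)
    quad a = a :+ (a :+ (a :+ (a :+ con (+ 0))))

  -- The exponents of c, g and e in the two halves of the dissection below.
  even-c : (1 ℕ.* tri m ℕ.+ 1 ℕ.* tri (ℤ.- m)) ℕ.+ (1 ℕ.* tri n ℕ.+ 1 ℕ.* tri (ℤ.- n))
    ≡ (2 ℕ.* U ℕ.+ 2 ℕ.* U⁻) ℕ.+ (2 ℕ.* V ℕ.+ 2 ℕ.* V⁻)
  even-c = ℤ.+-injective (≡.trans
    (≡.cong₂ ℤ._+_ (≡.cong₂ (λ a b → (a ℤ.+ + 0) ℤ.+ (b ℤ.+ + 0)) m-eq m⁻-eq) (≡.cong₂ (λ a b → (a ℤ.+ + 0) ℤ.+ (b ℤ.+ + 0)) n-eq n⁻-eq))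
    (≡.trans
      (solve 4 (λ u v U V → (one (U :+ V :+ u :* v) :+ one (U :+ V :+ u :* v :- (u :+ v)))
          :+ (one (U :+ (V :- v) :+ u :* (:- v)) :+ one (U :+ (V :- v) :+ u :* (:- v) :- (u :- v)))
        := (dbl U :+ dbl (U :- u)) :+ (dbl V :+ dbl (V :- v))) ≡.refl u v (+ U) (+ V))
      (≡.sym (≡.cong₂ (λ a b → (+ (2 ℕ.* U) ℤ.+ (a ℤ.+ (a ℤ.+ + 0))) ℤ.+ (+ (2 ℕ.* V) ℤ.+ (b ℤ.+ (b ℤ.+ + 0)))) (tri-neg u) (tri-neg v)))))

  even-g : (1 ℕ.* tri m ℕ.+ 0 ℕ.* tri (ℤ.- m)) ℕ.+ (0 ℕ.* tri n ℕ.+ 1 ℕ.* tri (ℤ.- n))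
    ≡ (1 ℕ.* U ℕ.+ 1 ℕ.* U⁻) ℕ.+ (2 ℕ.* V ℕ.+ 0 ℕ.* V⁻)
  even-g = ℤ.+-injective (≡.trans
    (≡.cong₂ (λ a b → ((a ℤ.+ + 0) ℤ.+ + 0) ℤ.+ (b ℤ.+ + 0)) m-eq n⁻-eq)
    (≡.trans
      (solve 4 (λ u v U V → (one (one (U :+ V :+ u :* v)))
          :+ one (U :+ (V :- v) :+ u :* (:- v) :- (u :- v))
        := (one U :+ one (U :- u)) :+ (one (dbl V))) ≡.refl u v (+ U) (+ V))
      (≡.sym (≡.cong (λ a → (+ (1 ℕ.* U) ℤ.+ (a ℤ.+ + 0)) ℤ.+ + (2 ℕ.* V ℕ.+ 0)) (tri-neg u)))))

  even-e : (0 ℕ.* tri m ℕ.+ 1 ℕ.* tri (ℤ.- m)) ℕ.+ (0 ℕ.* tri n ℕ.+ 1 ℕ.* tri (ℤ.- n))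
    ≡ (0 ℕ.* U ℕ.+ 2 ℕ.* U⁻) ℕ.+ (1 ℕ.* V ℕ.+ 1 ℕ.* V⁻)
  even-e = ℤ.+-injective (≡.trans
    (≡.cong₂ (λ a b → (a ℤ.+ + 0) ℤ.+ (b ℤ.+ + 0)) m⁻-eq n⁻-eq)
    (≡.trans
      (solve 4 (λ u v U V → one (U :+ V :+ u :* v :- (u :+ v))
          :+ one (U :+ (V :- v) :+ u :* (:- v) :- (u :- v))
        := dbl (U :- u) :+ (one V :+ one (V :- v))) ≡.refl u v (+ U) (+ V))
      (≡.sym (≡.cong₂ (λ a b → (a ℤ.+ (a ℤ.+ + 0)) ℤ.+ (+ (1 ℕ.* V) ℤ.+ (b ℤ.+ + 0))) (tri-neg u) (tri-neg v)))))

  odd-c : (1 ℕ.* tri m ℕ.+ 1 ℕ.* tri (ℤ.- m)) ℕ.+ (1 ℕ.* tri n′ ℕ.+ 1 ℕ.* tri (ℤ.- n′))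
    ≡ 1 ℕ.+ ((4 ℕ.* U ℕ.+ 0 ℕ.* U⁻) ℕ.+ (0 ℕ.* V ℕ.+ 4 ℕ.* V⁻))
  odd-c = ℤ.+-injective (≡.trans
    (≡.cong₂ ℤ._+_ (≡.cong₂ (λ a b → (a ℤ.+ + 0) ℤ.+ (b ℤ.+ + 0)) m-eq m⁻-eq) (≡.cong₂ (λ a b → (a ℤ.+ + 0) ℤ.+ (b ℤ.+ + 0)) n′-eq n′⁻-eq))
    (≡.trans
      (solve 4 (λ u v U V → (one (U :+ V :+ u :* v) :+ one (U :+ V :+ u :* v :- (u :+ v)))
          :+ (one (con (+ 1) :+ (U :+ (V :- v) :+ u :* (:- v)) :+ con (+ 1) :* (u :- v)) :+ one (con (+ 1) :+ (U :+ (V :- v) :+ u :* (:- v)) :+ con (+ 1) :* (u :- v) :- (con (+ 1) :+ (u :- v))))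
        := con (+ 1) :+ (one (quad U) :+ quad (V :- v))) ≡.refl u v (+ U) (+ V))
      (≡.sym (≡.cong (λ b → + 1 ℤ.+ (+ (4 ℕ.* U ℕ.+ 0) ℤ.+ (b ℤ.+ (b ℤ.+ (b ℤ.+ (b ℤ.+ + 0)))))) (tri-neg v)))))

  odd-g : (1 ℕ.* tri m ℕ.+ 0 ℕ.* tri (ℤ.- m)) ℕ.+ (0 ℕ.* tri n′ ℕ.+ 1 ℕ.* tri (ℤ.- n′))
    ≡ (2 ℕ.* U ℕ.+ 0 ℕ.* U⁻) ℕ.+ (1 ℕ.* V ℕ.+ 1 ℕ.* V⁻)
  odd-g = ℤ.+-injective (≡.trans
    (≡.cong₂ (λ a b → ((a ℤ.+ + 0) ℤ.+ + 0) ℤ.+ (b ℤ.+ + 0)) m-eq n′⁻-eq)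
    (≡.trans
      (solve 4 (λ u v U V → (one (one (U :+ V :+ u :* v)))
          :+ one (con (+ 1) :+ (U :+ (V :- v) :+ u :* (:- v)) :+ con (+ 1) :* (u :- v) :- (con (+ 1) :+ (u :- v)))
        := one (dbl U) :+ (one V :+ one (V :- v))) ≡.refl u v (+ U) (+ V))
      (≡.sym (≡.cong (λ b → + (2 ℕ.* U ℕ.+ 0) ℤ.+ (+ (1 ℕ.* V) ℤ.+ (b ℤ.+ + 0))) (tri-neg v)))))

  odd-e : (0 ℕ.* tri m ℕ.+ 1 ℕ.* tri (ℤ.- m)) ℕ.+ (0 ℕ.* tri n′ ℕ.+ 1 ℕ.* tri (ℤ.- n′))
    ≡ (1 ℕ.* U ℕ.+ 1 ℕ.* U⁻) ℕ.+ (0 ℕ.* V ℕ.+ 2 ℕ.* V⁻)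
  odd-e = ℤ.+-injective (≡.trans
    (≡.cong₂ (λ a b → (a ℤ.+ + 0) ℤ.+ (b ℤ.+ + 0)) m⁻-eq n′⁻-eq)
    (≡.trans
      (solve 4 (λ u v U V → one (U :+ V :+ u :* v :- (u :+ v))
          :+ one (con (+ 1) :+ (U :+ (V :- v) :+ u :* (:- v)) :+ con (+ 1) :* (u :- v) :- (con (+ 1) :+ (u :- v)))
        := (one U :+ one (U :- u)) :+ dbl (V :- v)) ≡.refl u v (+ U) (+ V))
      (≡.sym (≡.cong₂ (λ a b → (+ (1 ℕ.* U) ℤ.+ (a ℤ.+ + 0)) ℤ.+ (b ℤ.+ (b ℤ.+ + 0))) (tri-neg u) (tri-neg v)))))

-- Ramanujan's theta function

≤-triangle : ∀ n → n ℕ.≤ triangle n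
≤-triangle zero    = ℕ.z≤n
≤-triangle (suc n) = ℕ.m≤m+n (suc n) (triangle n)

≤-tri : ∀ {K} n → K ℕ.< ∣ n ∣ → K ℕ.≤ tri n
≤-tri (+ n)    lt = ℕ.≤-trans (ℕ.<⇒≤ lt) (≤-triangle n)
≤-tri -[1+ n ] lt = ℕ.≤-trans (ℕ.s≤s⁻¹ lt) (≤-triangle n)

≤-tri-neg : ∀ {K} n → K ℕ.< ∣ n ∣ → K ℕ.≤ tri (ℤ.- n)
≤-tri-neg {K} n lt = ≤-tri (ℤ.- n) (≡.subst (K ℕ.<_) (≡.sym (ℤ.∣-i∣≡∣i∣ n)) lt)

-- Ramanujan's theta function f(x,y) = Σ x^(n(n+1)/2) y^(n(n-1)/2) over all integers n, in a ring
-- where (xy)^K = 0 makes the sum finite.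
module Theta (R : CommutativeRing 0ℓ 0ℓ) (K : ℕ) where
  open CommutativeRing R
  open BilateralSums R
  open import Relation.Binary.Reasoning.Setoid setoid
  open import Algebra.Properties.Semiring.Exp semiring
  open import Algebra.Properties.CommutativeSemiring.Exp commutativeSemiring using (^-distrib-*)
  open import Algebra.Properties.Ring ring
  open import Algebra.Solver.Ring.NaturalCoefficients.Default commutativeSemiring
    using (solve; _:=_; _:*_; _:^_; Polynomial)

  Null : Carrier → Set
  Null m = m ^ K ≈ 0#

  θterm : Carrier → Carrier → ℤ → Carrier
  θterm x y n = x ^ tri n * y ^ tri (ℤ.- n)

  f : Carrier → Carrier → Carrier
  f x y = Σ± K (θterm x y)

  f-cong : ∀ {x x′ y y′} → x ≈ x′ → y ≈ y′ → f x y ≈ f x′ y′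
  f-cong p q = Σ±-cong K (λ n → *-cong (^-congˡ (tri n) p) (^-congˡ (tri (ℤ.- n)) q))

  f-sym : ∀ x y → f x y ≈ f y x
  f-sym x y = trans (reflect K _) (Σ±-cong K (λ n → trans (*-comm _ _) (*-congʳ (reflexive (≡.cong (λ z → y ^ tri z) (ℤ.neg-involutive n))))))
    where
    reflect : ∀ B g → Σ± B g ≈ Σ± B (λ n → g (ℤ.- n))
    reflect zero    g = refl
    reflect (suc B) g = +-cong (reflect B g) (+-comm _ _)

  power-null : ∀ {m n} → Null m → K ℕ.≤ n → m ^ n ≈ 0#
  power-null {m} {n} null K≤n = begin
    m ^ n                     ≡⟨ ≡.cong (m ^_) (ℕ.m+[n∸m]≡n K≤n) ⟨
    m ^ (K ℕ.+ (n ℕ.∸ K))     ≈⟨ ^-homo-* m K _ ⟩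
    m ^ K * m ^ (n ℕ.∸ K)     ≈⟨ *-congʳ null ⟩
    0# * m ^ (n ℕ.∸ K)        ≈⟨ zeroˡ _ ⟩
    0#                        ∎

  powers-null : ∀ {x y} a b → Null (x * y) → K ℕ.≤ a → K ℕ.≤ b → x ^ a * y ^ b ≈ 0#
  powers-null {x} {y} a b null K≤a K≤b = begin
    x ^ a * y ^ b
      ≡⟨ ≡.cong₂ (λ i j → x ^ i * y ^ j) (ℕ.m+[n∸m]≡n K≤a) (ℕ.m+[n∸m]≡n K≤b) ⟨
    x ^ (K ℕ.+ (a ℕ.∸ K)) * y ^ (K ℕ.+ (b ℕ.∸ K))
      ≈⟨ *-cong (^-homo-* x K _) (^-homo-* y K _) ⟩
    (x ^ K * x ^ (a ℕ.∸ K)) * (y ^ K * y ^ (b ℕ.∸ K))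
      ≈⟨ solve 4 (λ p q r s → (p :* q) :* (r :* s) := (p :* r) :* (q :* s)) refl _ _ _ _ ⟩
    (x ^ K * y ^ K) * (x ^ (a ℕ.∸ K) * y ^ (b ℕ.∸ K))
      ≈⟨ *-congʳ (trans (sym (^-distrib-* x y K)) null) ⟩
    0# * (x ^ (a ℕ.∸ K) * y ^ (b ℕ.∸ K))  ≈⟨ zeroˡ _ ⟩
    0# ∎

  -- For |n| > K both n(n+1)/2 and n(n-1)/2 are at least K, so the term contains (xy)^K. This leaves
  -- room for x = 1, as in the degenerate theta factor.
  Supported-θ : ∀ {x y} → Null (x * y) → Supported K (θterm x y)
  Supported-θ null n lt = powers-null (tri n) (tri (ℤ.- n)) null (≤-tri n lt) (≤-tri-neg n lt)

  Null-resp : ∀ {m m′} → m ≈ m′ → Null m → Null m′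
  Null-resp e null = trans (^-congˡ K (sym e)) null

  module Dissection (c g e : Carrier) where

    -- All theta arguments in the dissection are monomials of this kind, which reduces the
    -- comparison of terms to the comparison of three exponents.
    mono : ℕ → ℕ → ℕ → Carrier
    mono i j k = c ^ i * (g ^ j * e ^ k)

    mono-* : ∀ i j k i′ j′ k′ → mono i j k * mono i′ j′ k′ ≈ mono (i ℕ.+ i′) (j ℕ.+ j′) (k ℕ.+ k′)
    mono-* i j k i′ j′ k′ = trans
      (solve 6 (λ a b c x y z → (a :* (b :* c)) :* (x :* (y :* z)) := (a :* x) :* ((b :* y) :* (c :* z))) refl _ _ _ _ _ _)
      (sym (*-cong (^-homo-* c i i′) (*-cong (^-homo-* g j j′) (^-homo-* e k k′))))

    mono-^ : ∀ i j k n → mono i j k ^ n ≈ mono (i ℕ.* n) (j ℕ.* n) (k ℕ.* n)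
    mono-^ i j k n = trans (^-distrib-* _ _ n) (*-cong (^-assocʳ c i n)
      (trans (^-distrib-* _ _ n) (*-cong (^-assocʳ g j n) (^-assocʳ e k n))))

    mono-θ : ∀ i j k i′ j′ k′ n → θterm (mono i j k) (mono i′ j′ k′) n ≈
      mono (i ℕ.* tri n ℕ.+ i′ ℕ.* tri (ℤ.- n)) (j ℕ.* tri n ℕ.+ j′ ℕ.* tri (ℤ.- n)) (k ℕ.* tri n ℕ.+ k′ ℕ.* tri (ℤ.- n))
    mono-θ i j k i′ j′ k′ n = trans (*-cong (mono-^ i j k (tri n)) (mono-^ i′ j′ k′ (tri (ℤ.- n))))
      (mono-* (i ℕ.* tri n) (j ℕ.* tri n) (k ℕ.* tri n) (i′ ℕ.* tri (ℤ.- n)) (j′ ℕ.* tri (ℤ.- n)) (k′ ℕ.* tri (ℤ.- n)))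

    mono-θθ : ∀ i j k i′ j′ k′ p q r p′ q′ r′ m n →
      θterm (mono i j k) (mono i′ j′ k′) m * θterm (mono p q r) (mono p′ q′ r′) n ≈
      mono ((i ℕ.* tri m ℕ.+ i′ ℕ.* tri (ℤ.- m)) ℕ.+ (p ℕ.* tri n ℕ.+ p′ ℕ.* tri (ℤ.- n)))
           ((j ℕ.* tri m ℕ.+ j′ ℕ.* tri (ℤ.- m)) ℕ.+ (q ℕ.* tri n ℕ.+ q′ ℕ.* tri (ℤ.- n)))
           ((k ℕ.* tri m ℕ.+ k′ ℕ.* tri (ℤ.- m)) ℕ.+ (r ℕ.* tri n ℕ.+ r′ ℕ.* tri (ℤ.- n)))
    mono-θθ i j k i′ j′ k′ p q r p′ q′ r′ m n =
      trans (*-cong (mono-θ i j k i′ j′ k′ m) (mono-θ p q r p′ q′ r′ n))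
        (mono-* (i ℕ.* tri m ℕ.+ i′ ℕ.* tri (ℤ.- m)) (j ℕ.* tri m ℕ.+ j′ ℕ.* tri (ℤ.- m)) (k ℕ.* tri m ℕ.+ k′ ℕ.* tri (ℤ.- m))
                (p ℕ.* tri n ℕ.+ p′ ℕ.* tri (ℤ.- n)) (q ℕ.* tri n ℕ.+ q′ ℕ.* tri (ℤ.- n)) (r ℕ.* tri n ℕ.+ r′ ℕ.* tri (ℤ.- n)))

    mono-cong : ∀ {i j k i′ j′ k′} → i ≡ i′ → j ≡ j′ → k ≡ k′ → mono i j k ≈ mono i′ j′ k′
    mono-cong ≡.refl ≡.refl ≡.refl = refl

    even-term : ∀ u v →
      θterm (mono 1 1 0) (mono 1 0 1) (u ℤ.+ v) * θterm (mono 1 0 0) (mono 1 1 1) (u ℤ.- v)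
      ≈ θterm (mono 2 1 0) (mono 2 1 2) u * θterm (mono 2 2 1) (mono 2 0 1) v
    even-term u v =
      trans (mono-θθ 1 1 0 1 0 1 1 0 0 1 1 1 (u ℤ.+ v) (u ℤ.- v))
      (trans (mono-cong even-c even-g even-e) (sym (mono-θθ 2 1 0 2 1 2 2 2 1 2 0 1 u v)))
      where open Exponents u v

    odd-term : ∀ u v →
      θterm (mono 1 1 0) (mono 1 0 1) (u ℤ.+ v) * θterm (mono 1 0 0) (mono 1 1 1) (ℤ.suc (u ℤ.- v))
      ≈ c * (θterm (mono 4 2 1) (mono 0 0 1) u * θterm (mono 0 1 0) (mono 4 1 2) v)
    odd-term u v =
      trans (mono-θθ 1 1 0 1 0 1 1 0 0 1 1 1 (u ℤ.+ v) (ℤ.suc (u ℤ.- v)))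
      (trans (mono-cong odd-c odd-g odd-e)
      (trans (*-assoc _ _ _) (*-congˡ (sym (mono-θθ 4 2 1 0 0 1 0 1 0 4 1 2 u v)))))
      where open Exponents u v

    -- Ramanujan's formula for f(a,b) f(c,d) with ab = cd, in the coordinates a = cg, b = ce, d =
    -- cge. The quotients a/c and b/c of the usual form are then the ring elements g and e. Pairs
    -- with m + n even give the first product, those with m + n odd the second.
    dissect-mono : Null (c * c * (g * e)) →
      f (mono 1 1 0) (mono 1 0 1) * f (mono 1 0 0) (mono 1 1 1)
      ≈ f (mono 2 1 0) (mono 2 1 2) * f (mono 2 2 1) (mono 2 0 1)
        + c * (f (mono 4 2 1) (mono 0 0 1) * f (mono 0 1 0) (mono 4 1 2))
    dissect-mono null = begin
      f (mono 1 1 0) (mono 1 0 1) * f (mono 1 0 0) (mono 1 1 1)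
        ≈⟨ Σ±-* K _ _ ⟨
      Σ± K (λ m → Σ± K (λ n → a m * b n))
        ≈⟨ Σ±-diagonals K (λ m n → a m * b n) supp ⟩
      Σ± K (λ u → Σ± K (λ v → a (u ℤ.+ v) * b (u ℤ.- v)))
        + Σ± K (λ u → Σ± K (λ v → a (u ℤ.+ v) * b (ℤ.suc (u ℤ.- v))))
        ≈⟨ +-cong (Σ±-cong K (λ u → Σ±-cong K (even-term u))) (Σ±-cong K (λ u → Σ±-cong K (odd-term u))) ⟩
      Σ± K (λ u → Σ± K (λ v → a₁ u * b₁ v)) + Σ± K (λ u → Σ± K (λ v → c * (a₂ u * b₂ v)))
        ≈⟨ +-cong (Σ±-* K a₁ b₁) (trans (Σ±-cong K (λ u → Σ±-*ˡ K c _)) (trans (Σ±-*ˡ K c _) (*-congˡ (Σ±-* K a₂ b₂)))) ⟩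
      f (mono 2 1 0) (mono 2 1 2) * f (mono 2 2 1) (mono 2 0 1)
        + c * (f (mono 4 2 1) (mono 0 0 1) * f (mono 0 1 0) (mono 4 1 2)) ∎
      where
      a b a₁ b₁ a₂ b₂ : ℤ → Carrier
      a = θterm (mono 1 1 0) (mono 1 0 1)
      b = θterm (mono 1 0 0) (mono 1 1 1)
      a₁ = θterm (mono 2 1 0) (mono 2 1 2)
      b₁ = θterm (mono 2 2 1) (mono 2 0 1)
      a₂ = θterm (mono 4 2 1) (mono 0 0 1)
      b₂ = θterm (mono 0 1 0) (mono 4 1 2)
      null-a : Null (mono 1 1 0 * mono 1 0 1)
      null-a = Null-resp (solve 3 (λ c g e → c :* c :* (g :* e) := (c :^ 1 :* (g :^ 1 :* e :^ 0)) :* (c :^ 1 :* (g :^ 0 :* e :^ 1))) refl c g e) null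
      null-b : Null (mono 1 0 0 * mono 1 1 1)
      null-b = Null-resp (solve 3 (λ c g e → c :* c :* (g :* e) := (c :^ 1 :* (g :^ 0 :* e :^ 0)) :* (c :^ 1 :* (g :^ 1 :* e :^ 1))) refl c g e) null
      supp : Supported² K (λ m n → a m * b n)
      supp m n (inj₁ lt) = trans (*-congʳ (Supported-θ null-a m lt)) (zeroˡ _)
      supp m n (inj₂ lt) = trans (*-congˡ (Supported-θ null-b n lt)) (zeroʳ _)

  -- Only c² and one factor c occur on the right, so the sign of c is easily changed.
  dissect : ∀ c g e {s} → c * c ≈ s → Null (s * (g * e)) →
    f (c * g) (c * e) * f c (c * (g * e))
    ≈ f (s * g) (s * g * (e * e)) * f (s * (g * g) * e) (s * e)
      + c * (f (s * s * (g * g) * e) e * f g (s * s * g * (e * e)))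
  dissect c g e {s} cc≈s null = begin
    f (c * g) (c * e) * f c (c * (g * e))
      ≈⟨ *-cong (f-cong (S (λ c g e → c :* g := mon c g e 1 1 0) refl c g e) (S (λ c g e → c :* e := mon c g e 1 0 1) refl c g e))
                (f-cong (S (λ c g e → c := mon c g e 1 0 0) refl c g e) (S (λ c g e → c :* (g :* e) := mon c g e 1 1 1) refl c g e)) ⟩
    f (mono 1 1 0) (mono 1 0 1) * f (mono 1 0 0) (mono 1 1 1)
      ≈⟨ dissect-mono (Null-resp (*-congʳ (sym cc≈s)) null) ⟩
    f (mono 2 1 0) (mono 2 1 2) * f (mono 2 2 1) (mono 2 0 1)
        + c * (f (mono 4 2 1) (mono 0 0 1) * f (mono 0 1 0) (mono 4 1 2))
      ≈⟨ +-cong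
          (*-cong (f-cong (S (λ c g e → mon c g e 2 1 0 := c :* c :* g) refl c g e) (S (λ c g e → mon c g e 2 1 2 := c :* c :* g :* (e :* e)) refl c g e))
                  (f-cong (S (λ c g e → mon c g e 2 2 1 := c :* c :* (g :* g) :* e) refl c g e) (S (λ c g e → mon c g e 2 0 1 := c :* c :* e) refl c g e)))
          (*-congˡ
          (*-cong (f-cong (S (λ c g e → mon c g e 4 2 1 := c :* c :* (c :* c) :* (g :* g) :* e) refl c g e) (S (λ c g e → mon c g e 0 0 1 := e) refl c g e))
                  (f-cong (S (λ c g e → mon c g e 0 1 0 := g) refl c g e) (S (λ c g e → mon c g e 4 1 2 := c :* c :* (c :* c) :* g :* (e :* e)) refl c g e)))) ⟩
    f (c * c * g) (c * c * g * (e * e)) * f (c * c * (g * g) * e) (c * c * e)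
      + c * (f (c * c * (c * c) * (g * g) * e) e * f g (c * c * (c * c) * g * (e * e)))
      ≈⟨ +-cong
          (*-cong (f-cong (*-congʳ cc≈s) (*-congʳ (*-congʳ cc≈s))) (f-cong (*-congʳ (*-congʳ cc≈s)) (*-congʳ cc≈s)))
          (*-congˡ (*-cong (f-cong (*-congʳ (*-congʳ (*-cong cc≈s cc≈s))) refl) (f-cong refl (*-congʳ (*-congʳ (*-cong cc≈s cc≈s)))))) ⟩
    f (s * g) (s * g * (e * e)) * f (s * (g * g) * e) (s * e)
      + c * (f (s * s * (g * g) * e) e * f g (s * s * g * (e * e))) ∎
    where
    open Dissection c g e
    S = solve 3
    mon : ∀ {n} → Polynomial n → Polynomial n → Polynomial n → ℕ → ℕ → ℕ → Polynomial n
    mon c g e i j k = c :^ i :* (g :^ j :* e :^ k)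

-- Jacobi's four-theta formulas and the two-theta formulas

module ThetaIdentities (R : CommutativeRing 0ℓ 0ℓ) (K : ℕ) where
  open CommutativeRing R
  open Theta R K
  open import Relation.Binary.Reasoning.Setoid setoid
  open import Algebra.Properties.Ring ring
  open import Algebra.Solver.Ring.NaturalCoefficients.Default commutativeSemiring
    using (solve; _:=_; _:+_; _:*_; con)

  2# : Carrier
  2# = 1# + 1#

  -x*-y≈x*y : ∀ x y → - x * - y ≈ x * y
  -x*-y≈x*y x y = begin
    - x * - y     ≈⟨ -‿distribˡ-* x (- y) ⟨
    - (x * - y)   ≈⟨ -‿cong (-‿distribʳ-* x y) ⟨
    - (- (x * y)) ≈⟨ -‿involutive _ ⟩
    x * y         ∎

  private
    signs : ∀ p q r s c d → (p + - c * q) * (r + - d * s) ≈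
      (p * r + c * d * (q * s)) + - (p * (d * s) + c * q * r)
    signs p q r s c d = begin
      (p + - c * q) * (r + - d * s)
        ≈⟨ solve 6 (λ p q r s c d → (p :+ c :* q) :* (r :+ d :* s) := (p :* r :+ c :* d :* (q :* s)) :+ (d :* (p :* s) :+ c :* (q :* r))) refl p q r s (- c) (- d) ⟩
      (p * r + - c * - d * (q * s)) + (- d * (p * s) + - c * (q * r))
        ≈⟨ +-cong (+-congˡ (*-congʳ (-x*-y≈x*y c d))) (+-cong (sym (-‿distribˡ-* _ _)) (sym (-‿distribˡ-* _ _))) ⟩
      (p * r + c * d * (q * s)) + (- (d * (p * s)) + - (c * (q * r)))
        ≈⟨ +-congˡ (-‿+-comm _ _) ⟩
      (p * r + c * d * (q * s)) + - (d * (p * s) + c * (q * r))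
        ≈⟨ +-congˡ (-‿cong (solve 6 (λ p q r s c d → d :* (p :* s) :+ c :* (q :* r) := p :* (d :* s) :+ c :* q :* r) refl p q r s c d)) ⟩
      (p * r + c * d * (q * s)) + - (p * (d * s) + c * q * r) ∎

    signs⁺ : ∀ p q r s c d → (p + c * q) * (r + d * s) ≈
      (p * r + c * d * (q * s)) + (p * (d * s) + c * q * r)
    signs⁺ = solve 6 (λ p q r s c d → (p :+ c :* q) :* (r :+ d :* s) := (p :* r :+ c :* d :* (q :* s)) :+ (p :* (d :* s) :+ c :* q :* r)) refl

    sum-± : ∀ a b → (a + - b) + (a + b) ≈ 2# * a
    sum-± a b = begin
      (a + - b) + (a + b)  ≈⟨ solve 3 (λ a b n → (a :+ n) :+ (a :+ b) := con 2 :* a :+ (n :+ b)) refl a b (- b) ⟩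
      2# * a + (- b + b)   ≈⟨ +-congˡ (-‿inverseˡ b) ⟩
      2# * a + 0#          ≈⟨ +-identityʳ _ ⟩
      2# * a               ∎

    difference-± : ∀ a b → (a + - b) + - 1# * (a + b) ≈ - (2# * b)
    difference-± a b = begin
      (a + - b) + - 1# * (a + b)     ≈⟨ +-congˡ (trans (-1*x≈-x _) (sym (-‿+-comm a b))) ⟩
      (a + - b) + (- a + - b)        ≈⟨ solve 3 (λ a n m → (a :+ n) :+ (m :+ n) := (a :+ m) :+ con 2 :* n) refl a (- b) (- a) ⟩
      (a + - a) + 2# * - b           ≈⟨ +-cong (-‿inverseʳ a) (sym (-‿distribʳ-* 2# b)) ⟩
      0# + - (2# * b)                ≈⟨ +-identityˡ _ ⟩
      - (2# * b)                     ∎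

    difference-∓ : ∀ a b → (a + b) + - 1# * (a + - b) ≈ 2# * b
    difference-∓ a b = begin
      (a + b) + - 1# * (a + - b)     ≈⟨ +-congʳ (+-congˡ (-‿involutive b)) ⟨
      (a + - (- b)) + - 1# * (a + - b) ≈⟨ difference-± a (- b) ⟩
      - (2# * - b)                   ≈⟨ -‿cong (-‿distribʳ-* 2# b) ⟨
      - (- (2# * b))                 ≈⟨ -‿involutive _ ⟩
      2# * b ∎

    evenPart oddPart : Carrier → Carrier → Carrier → Carrier
    evenPart s g e = f (s * g) (s * g * (e * e)) * f (s * (g * g) * e) (s * e)
    oddPart  s g e = f (s * s * (g * g) * e) e * f g (s * s * g * (e * e))

    split⁺ : ∀ c g e → Null (c * c * (g * e)) →
      f (c * g) (c * e) * f c (c * g * e) ≈ evenPart (c * c) g e + c * oddPart (c * c) g e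
    split⁺ c g e null = trans (*-congˡ (f-cong refl (*-assoc c g e))) (dissect c g e refl null)

    -- Negating all four arguments amounts to c ↦ -c with g and e fixed, so the even part is
    -- unchanged and the odd part changes sign.
    split⁻ : ∀ c g e → Null (c * c * (g * e)) →
      f (- (c * g)) (- (c * e)) * f (- c) (- (c * g * e)) ≈ evenPart (c * c) g e + - c * oddPart (c * c) g e
    split⁻ c g e null = trans
      (*-cong (f-cong (-‿distribˡ-* c g) (-‿distribˡ-* c e))
              (f-cong refl (trans (-‿cong (*-assoc c g e)) (-‿distribˡ-* c (g * e)))))
      (dissect (- c) g e (-x*-y≈x*y c c) null)

    -- For c = 1 the even and the odd half consist of the same two theta functions. This is where
    -- the factor 2 originates.
    dissect-1 : ∀ g e → Null (g * e) →
      f 1# (g * e) * f g e ≈ 2# * (f g (g * (e * e)) * f (g * g * e) e)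
    dissect-1 g e null = begin
      f 1# (g * e) * f g e
        ≈⟨ trans (*-comm _ _) (*-cong (f-cong (sym (*-identityˡ g)) (sym (*-identityˡ e))) (f-cong refl (sym (*-identityˡ (g * e))))) ⟩
      f (1# * g) (1# * e) * f 1# (1# * (g * e))
        ≈⟨ dissect 1# g e (*-identityˡ 1#) (Null-resp (sym (*-identityˡ _)) null) ⟩
      f (1# * g) (1# * g * (e * e)) * f (1# * (g * g) * e) (1# * e)
        + 1# * (f (1# * 1# * (g * g) * e) e * f g (1# * 1# * g * (e * e)))
        ≈⟨ +-cong
            (*-cong (f-cong (*-identityˡ g) (*-congʳ (*-identityˡ g))) (f-cong (*-congʳ (*-identityˡ _)) (*-identityˡ e)))
            (*-congˡ (*-cong (f-cong (one2 _ e) refl) (f-cong refl (one2 g (e * e))))) ⟩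
      f g (g * (e * e)) * f (g * g * e) e + 1# * (f (g * g * e) e * f g (g * (e * e)))
        ≈⟨ solve 2 (λ a b → a :* b :+ con 1 :* (b :* a) := con 2 :* (a :* b)) refl _ _ ⟩
      2# * (f g (g * (e * e)) * f (g * g * e) e) ∎
      where
      one2 : ∀ x y → 1# * 1# * x * y ≈ x * y
      one2 = solve 2 (λ x y → con 1 :* con 1 :* x :* y := x :* y) refl

  module _ (Y g D h : Carrier) where
    private
      X Z : Carrier
      X = Y * g
      Z = D * h

    -- Each pair of thetas splits as E ± cO, and in the sum of the two fourfold products the mixed
    -- terms cancel, leaving 2(E₁E₂ + YD O₁O₂). Here P₁ divides E₁ and O₂ while P₂ divides O₁ and
    -- E₂, so P₁P₂ comes out as a common factor. By `dissect-1`, 2P₁P₂ is a product of two thetas,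
    -- one of them f(1, XYZD); the cofactor U′U + YD V′V is again a dissection, with YD in the role
    -- of c.
    quartic-sum : Null (X * Y * (Z * D)) →
      (f (- X) (- (Y * (Z * D))) * f (- Y) (- (X * (Z * D)))) *
      (f (- Z) (- (D * (X * Y))) * f (- D) (- (Z * (X * Y))))
      + (f X (Y * (Z * D)) * f Y (X * (Z * D))) * (f Z (D * (X * Y)) * f D (Z * (X * Y)))
      ≈ (f 1# (X * Y * (Z * D)) * f (X * Y) (Z * D)) * (f (X * D) (Y * Z) * f (Y * D) (X * Z))
    quartic-sum null = begin
      _ ≈⟨ +-cong (*-cong (split⁻ Y g (Z * D) null₁) (split⁻ D h (X * Y) null₂))
                  (*-cong (split⁺ Y g (Z * D) null₁) (split⁺ D h (X * Y) null₂)) ⟩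
      (E₁ + - Y * O₁) * (E₂ + - D * O₂) + (E₁ + Y * O₁) * (E₂ + D * O₂)
        ≈⟨ +-cong (signs E₁ O₁ E₂ O₂ Y D) (signs⁺ E₁ O₁ E₂ O₂ Y D) ⟩
      _ ≈⟨ sum-± _ _ ⟩
      2# * (E₁ * E₂ + Y * D * (O₁ * O₂))
        ≈⟨ *-congˡ (+-cong (*-cong E₁≈ E₂≈) (*-congˡ (*-cong O₁≈ O₂≈))) ⟩
      2# * ((P₁ * U) * (P₂ * U′) + Y * D * ((P₂ * V) * (P₁ * V′)))
        ≈⟨ solve 7 (λ p q u u′ v v′ yd → con 2 :* ((p :* u) :* (q :* u′) :+ yd :* ((q :* v) :* (p :* v′)))
              := con 2 :* (p :* q) :* (u′ :* u :+ yd :* (v′ :* v))) refl P₁ P₂ U U′ V V′ (Y * D) ⟩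
      2# * (P₁ * P₂) * (U′ * U + Y * D * (V′ * V))
        ≈⟨ *-cong (sym (dissect-1 (X * Y) (Z * D) null)) (sym last) ⟩
      _ ∎
      where
      null₁ : Null (Y * Y * (g * (Z * D)))
      null₁ = Null-resp (solve 4 (λ Y g D h → Y :* g :* Y :* (D :* h :* D) := Y :* Y :* (g :* (D :* h :* D))) refl Y g D h) null
      null₂ : Null (D * D * (h * (X * Y)))
      null₂ = Null-resp (solve 4 (λ Y g D h → Y :* g :* Y :* (D :* h :* D) := D :* D :* (h :* (Y :* g :* Y))) refl Y g D h) null
      null₃ : Null (Y * D * (Y * D) * (g * h))
      null₃ = Null-resp (solve 4 (λ Y g D h → Y :* g :* Y :* (D :* h :* D) := Y :* D :* (Y :* D) :* (g :* h)) refl Y g D h) null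
      E₁ = evenPart (Y * Y) g (Z * D)
      O₁ = oddPart  (Y * Y) g (Z * D)
      E₂ = evenPart (D * D) h (X * Y)
      O₂ = oddPart  (D * D) h (X * Y)
      P₁ = f (X * Y) (X * Y * (Z * D * (Z * D)))
      P₂ = f (X * Y * (X * Y) * (Z * D)) (Z * D)
      U  = f (X * X * (Z * D)) (Y * Y * (Z * D))
      V  = f g (Y * Y * (Y * Y) * g * (Z * D * (Z * D)))
      U′ = f (D * D * (X * Y)) (Z * Z * (X * Y))
      V′ = f (D * D * (D * D) * h * (X * Y * (X * Y))) h
      E₁≈ : E₁ ≈ P₁ * U
      E₁≈ = *-cong
        (f-cong (solve 2 (λ Y g → Y :* Y :* g := Y :* g :* Y) refl Y g)
                (solve 3 (λ Y g W → Y :* Y :* g :* W := Y :* g :* Y :* W) refl Y g _))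
        (f-cong (solve 3 (λ Y g W → Y :* Y :* (g :* g) :* W := Y :* g :* (Y :* g) :* W) refl Y g _) refl)
      O₁≈ : O₁ ≈ P₂ * V
      O₁≈ = *-congʳ (f-cong (solve 3 (λ Y g W → Y :* Y :* (Y :* Y) :* (g :* g) :* W := Y :* g :* Y :* (Y :* g :* Y) :* W) refl Y g _) refl)
      E₂≈ : E₂ ≈ P₂ * U′
      E₂≈ = *-cong
        (trans (f-cong (solve 2 (λ D h → D :* D :* h := D :* h :* D) refl D h)
                       (solve 3 (λ D h W → D :* D :* h :* W := W :* (D :* h :* D)) refl D h _)) (f-sym _ _))
        (trans (f-cong (solve 3 (λ D h W → D :* D :* (h :* h) :* W := D :* h :* (D :* h) :* W) refl D h _) refl) (f-sym _ _))
      O₂≈ : O₂ ≈ P₁ * V′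
      O₂≈ = *-cong
        (trans (f-cong (solve 3 (λ D h W → D :* D :* (D :* D) :* (h :* h) :* W := W :* (D :* h :* D :* (D :* h :* D))) refl D h _) refl) (f-sym _ _))
        (f-sym _ _)
      last : f (X * D) (Y * Z) * f (Y * D) (X * Z) ≈ U′ * U + Y * D * (V′ * V)
      last = begin
        f (X * D) (Y * Z) * f (Y * D) (X * Z)
          ≈⟨ *-cong (f-cong (solve 3 (λ Y g D → Y :* g :* D := Y :* D :* g) refl Y g D) (sym (*-assoc Y D h)))
                    (f-cong refl (solve 4 (λ Y g D h → Y :* g :* (D :* h) := Y :* D :* g :* h) refl Y g D h)) ⟩
        f (Y * D * g) (Y * D * h) * f (Y * D) (Y * D * g * h)
          ≈⟨ split⁺ (Y * D) g h null₃ ⟩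
        _ ≈⟨ +-cong
            (*-cong (f-cong (solve 3 (λ Y g D → Y :* D :* (Y :* D) :* g := D :* D :* (Y :* g :* Y)) refl Y g D)
                            (solve 4 (λ Y g D h → Y :* D :* (Y :* D) :* g :* (h :* h) := D :* h :* (D :* h) :* (Y :* g :* Y)) refl Y g D h))
                    (f-cong (solve 4 (λ Y g D h → Y :* D :* (Y :* D) :* (g :* g) :* h := Y :* g :* (Y :* g) :* (D :* h :* D)) refl Y g D h)
                            (solve 3 (λ Y D h → Y :* D :* (Y :* D) :* h := Y :* Y :* (D :* h :* D)) refl Y D h)))
            (*-congˡ
            (*-cong (f-cong (solve 4 (λ Y g D h → Y :* D :* (Y :* D) :* (Y :* D :* (Y :* D)) :* (g :* g) :* h := D :* D :* (D :* D) :* h :* (Y :* g :* Y :* (Y :* g :* Y))) refl Y g D h) refl)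
                    (f-cong refl (solve 4 (λ Y g D h → Y :* D :* (Y :* D) :* (Y :* D :* (Y :* D)) :* g :* (h :* h) := Y :* Y :* (Y :* Y) :* g :* (D :* h :* D :* (D :* h :* D))) refl Y g D h)))) ⟩
        U′ * U + Y * D * (V′ * V) ∎

  module _ (J h C E : Carrier) where
    private
      I : Carrier
      I = J * h

    -- Now the mixed terms E₁O₂ and O₁E₂ survive. In this parametrization P₁ divides both even parts
    -- and P₂ both odd parts, so that P₁P₂ is again a common factor, and the cofactor is a
    -- dissection with J in the role of c.
    quartic-difference : Null (C * C * (I * J) * E) →
      (f (- (C * (I * J))) (- (C * E)) * f (- C) (- (C * (I * J) * E))) *
      (f (- (C * I)) (- (C * J * E)) * f (- (C * J)) (- (C * I * E)))
      + - 1# * ((f (C * (I * J)) (C * E) * f C (C * (I * J) * E)) *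
               (f (C * I) (C * J * E) * f (C * J) (C * I * E)))
      ≈ - C * ((f 1# (C * C * (I * J) * E) * f (C * C * (I * J)) E) *
               (f I (C * C * J * E) * f J (C * C * I * E)))
    quartic-difference null = begin
      _ ≈⟨ +-cong (*-cong (split⁻ C (I * J) E null₁) (trans (*-cong (f-cong (-‿cong CI≈) refl) (f-cong refl (-‿cong (*-congʳ CI≈)))) (split⁻ (C * J) h E null₂)))
                  (*-congˡ (*-cong (split⁺ C (I * J) E null₁) (trans (*-cong (f-cong CI≈ refl) (f-cong refl (*-congʳ CI≈))) (split⁺ (C * J) h E null₂)))) ⟩
      (E₁ + - C * O₁) * (E₂ + - (C * J) * O₂) + - 1# * ((E₁ + C * O₁) * (E₂ + C * J * O₂))
        ≈⟨ +-cong (signs E₁ O₁ E₂ O₂ C (C * J)) (*-congˡ (signs⁺ E₁ O₁ E₂ O₂ C (C * J))) ⟩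
      _ ≈⟨ difference-± _ _ ⟩
      - (2# * (E₁ * (C * J * O₂) + C * O₁ * E₂))
        ≈⟨ -‿cong (*-congˡ (+-cong (*-congˡ (*-congˡ O₂≈)) (*-congˡ E₂≈))) ⟩
      - (2# * ((P₁ * U) * (C * J * (P₂ * V₂)) + C * (P₂ * V₁) * (P₁ * U₂)))
        ≈⟨ -‿cong (solve 8 (λ p q u u′ v v′ c j → con 2 :* ((p :* u) :* (c :* j :* (q :* v′)) :+ c :* (q :* v) :* (p :* u′))
              := c :* (con 2 :* (p :* q) :* (v :* u′ :+ j :* (u :* v′)))) refl P₁ P₂ U U₂ V₁ V₂ C J) ⟩
      - (C * (2# * (P₁ * P₂) * (V₁ * U₂ + J * (U * V₂))))
        ≈⟨ -‿distribˡ-* _ _ ⟩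
      - C * (2# * (P₁ * P₂) * (V₁ * U₂ + J * (U * V₂)))
        ≈⟨ *-congˡ (*-cong (sym first) (sym last)) ⟩
      _ ∎
      where
      CI≈ : C * I ≈ C * J * h
      CI≈ = sym (*-assoc C J h)
      null₁ : Null (C * C * (I * J * E))
      null₁ = Null-resp (*-assoc _ _ _) null
      null₂ : Null (C * J * (C * J) * (h * E))
      null₂ = Null-resp (solve 4 (λ J h C E → C :* C :* (J :* h :* J) :* E := C :* J :* (C :* J) :* (h :* E)) refl J h C E) null
      null₃ : Null (J * J * (h * (C * C * E)))
      null₃ = Null-resp (solve 4 (λ J h C E → C :* C :* (J :* h :* J) :* E := J :* J :* (h :* (C :* C :* E))) refl J h C E) null
      E₁ = evenPart (C * C) (I * J) E
      O₁ = oddPart  (C * C) (I * J) E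
      E₂ = evenPart (C * J * (C * J)) h E
      O₂ = oddPart  (C * J * (C * J)) h E
      P₁ = f (C * C * (I * J)) (C * C * (I * J) * (E * E))
      P₂ = f (C * C * (C * C) * (I * J * (I * J)) * E) E
      U  = f (C * C * (I * J * (I * J)) * E) (C * C * E)
      V₁ = f (I * J) (C * C * (C * C) * (I * J) * (E * E))
      U₂ = f (C * J * (C * J) * (h * h) * E) (C * J * (C * J) * E)
      V₂ = f h (C * J * (C * J) * (C * J * (C * J)) * h * (E * E))
      E₂≈ : E₂ ≈ P₁ * U₂
      E₂≈ = *-congʳ (f-cong (solve 3 (λ C J h → C :* J :* (C :* J) :* h := C :* C :* (J :* h :* J)) refl C J h)
                            (solve 4 (λ C J h W → C :* J :* (C :* J) :* h :* W := C :* C :* (J :* h :* J) :* W) refl C J h _))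
      O₂≈ : O₂ ≈ P₂ * V₂
      O₂≈ = *-congʳ (f-cong (solve 4 (λ C J h E → C :* J :* (C :* J) :* (C :* J :* (C :* J)) :* (h :* h) :* E := C :* C :* (C :* C) :* (J :* h :* J :* (J :* h :* J)) :* E) refl C J h E) refl)
      first : f 1# (C * C * (I * J) * E) * f (C * C * (I * J)) E ≈ 2# * (P₁ * P₂)
      first = trans (dissect-1 (C * C * (I * J)) E null) (*-congˡ (*-congˡ (f-cong
        (solve 3 (λ C W E → C :* C :* W :* (C :* C :* W) :* E := C :* C :* (C :* C) :* (W :* W) :* E) refl C _ E) refl)))
      last : f I (C * C * J * E) * f J (C * C * I * E) ≈ V₁ * U₂ + J * (U * V₂)
      last = begin
        f I (C * C * J * E) * f J (C * C * I * E)
          ≈⟨ *-cong (f-cong refl (solve 3 (λ J C E → C :* C :* J :* E := J :* (C :* C :* E)) refl J C E))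
                    (f-cong refl (solve 3 (λ I C E → C :* C :* I :* E := I :* (C :* C :* E)) refl I C E)) ⟩
        f (J * h) (J * (C * C * E)) * f J (J * h * (C * C * E))
          ≈⟨ split⁺ J h (C * C * E) null₃ ⟩
        _ ≈⟨ +-cong
            (*-cong (f-cong (solve 2 (λ J h → J :* J :* h := J :* h :* J) refl J h)
                            (solve 4 (λ J h C E → J :* J :* h :* (C :* C :* E :* (C :* C :* E)) := C :* C :* (C :* C) :* (J :* h :* J) :* (E :* E)) refl J h C E))
                    (f-cong (solve 4 (λ J h C E → J :* J :* (h :* h) :* (C :* C :* E) := C :* J :* (C :* J) :* (h :* h) :* E) refl J h C E)
                            (solve 3 (λ J C E → J :* J :* (C :* C :* E) := C :* J :* (C :* J) :* E) refl J C E)))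
            (*-congˡ
            (*-cong (f-cong (solve 4 (λ J h C E → J :* J :* (J :* J) :* (h :* h) :* (C :* C :* E) := C :* C :* (J :* h :* J :* (J :* h :* J)) :* E) refl J h C E) refl)
                    (f-cong refl (solve 4 (λ J h C E → J :* J :* (J :* J) :* h :* (C :* C :* E :* (C :* C :* E)) := C :* J :* (C :* J) :* (C :* J :* (C :* J)) :* h :* (E :* E)) refl J h C E)))) ⟩
        V₁ * U₂ + J * (U * V₂) ∎

  module _ (c g e : Carrier) where
    private
      P Q : Carrier
      P = f (- (c * c * g)) (- (c * c * g * (e * e))) * f (- (c * c * (g * g) * e)) (- (c * c * e))
      Q = f (- (c * c * (c * c) * (g * g) * e)) (- e) * f (- g) (- (c * c * (c * c) * g * (e * e)))

      neg₂ : ∀ {x y} → x * - y ≈ - (x * y)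
      neg₂ = sym (-‿distribʳ-* _ _)

      even≈P : evenPart (c * c) (- g) (- e) ≈ P
      even≈P = *-cong
        (f-cong neg₂ (trans (*-cong neg₂ (-x*-y≈x*y e e)) (sym (-‿distribˡ-* _ _))))
        (f-cong (trans (*-congʳ (*-congˡ (-x*-y≈x*y g g))) neg₂) neg₂)

      odd≈Q : oddPart (c * c) (- g) (- e) ≈ Q
      odd≈Q = *-cong
        (f-cong (trans (*-congʳ (*-congˡ (-x*-y≈x*y g g))) neg₂) refl)
        (f-cong refl (trans (*-cong neg₂ (-x*-y≈x*y e e)) (sym (-‿distribˡ-* _ _))))

      module _ (null : Null (c * c * (g * e))) where
        null₋ : Null (c * c * (- g * - e))
        null₋ = Null-resp (*-congˡ (sym (-x*-y≈x*y g e))) null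

        first : f (- (c * g)) (- (c * e)) * f c (c * g * e) ≈ P + c * Q
        first = trans
          (*-cong (f-cong (sym neg₂) (sym neg₂)) (f-cong refl (trans (*-assoc c g e) (*-congˡ (sym (-x*-y≈x*y g e))))))
          (trans (dissect c (- g) (- e) refl null₋) (+-cong even≈P (*-congˡ odd≈Q)))

        second : f (c * g) (c * e) * f (- c) (- (c * g * e)) ≈ P + - (c * Q)
        second = trans
          (*-cong (f-cong (sym (-x*-y≈x*y c g)) (sym (-x*-y≈x*y c e)))
            (f-cong refl (trans (-‿cong (*-assoc c g e)) (trans (-‿distribˡ-* c (g * e)) (*-congˡ (sym (-x*-y≈x*y g e)))))))
          (trans (dissect (- c) (- g) (- e) (-x*-y≈x*y c c) null₋) (+-cong even≈P (trans (*-congˡ odd≈Q) (sym (-‿distribˡ-* c Q)))))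

    -- Since (-g)(-e) = ge, the dissection at -g, -e negates the arguments of only one of the two
    -- thetas, and replacing c by -c as well negates those of the other one instead. The two
    -- products therefore have the same even part P and opposite odd parts.
    mixed-sum : Null (c * c * (g * e)) →
      f (c * g) (c * e) * f (- c) (- (c * g * e)) + f (- (c * g)) (- (c * e)) * f c (c * g * e)
      ≈ 2# * (f (- (c * c * g)) (- (c * c * g * (e * e))) * f (- (c * c * (g * g) * e)) (- (c * c * e)))
    mixed-sum null = trans (+-cong (second null) (first null)) (sum-± P (c * Q))

    mixed-difference : Null (c * c * (g * e)) →
      f (- (c * g)) (- (c * e)) * f c (c * g * e) + - 1# * (f (c * g) (c * e) * f (- c) (- (c * g * e)))
      ≈ 2# * (c * (f (- (c * c * (c * c) * (g * g) * e)) (- e) * f (- g) (- (c * c * (c * c) * g * (e * e)))))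
    mixed-difference null = trans (+-cong (first null) (*-congˡ (second null))) (difference-∓ P (c * Q))

-- The Jacobi triple product

private
  suc-⊖ : ∀ A i → suc A ⊖ i ≡ + 1 ℤ.+ (A ⊖ i)
  suc-⊖ A i = ≡.trans (≡.sym (ℤ.m-n≡m⊖n (suc A) i))
    (≡.trans (ℤ.+-assoc (+ 1) (+ A) (ℤ.- (+ i))) (≡.cong ℤ.suc (ℤ.m-n≡m⊖n A i)))

  tri-suc-⊖ : ∀ A i → + tri (suc A ⊖ i) ≡ + 1 ℤ.+ + tri (A ⊖ i) ℤ.+ + 1 ℤ.* (+ A ℤ.- + i)
  tri-suc-⊖ A i = ≡.trans (≡.cong (λ z → + tri z) (suc-⊖ A i)) (≡.trans (tri-+ (+ 1) (A ⊖ i))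
    (≡.cong (λ z → + 1 ℤ.+ + tri (A ⊖ i) ℤ.+ + 1 ℤ.* z) (≡.sym (ℤ.m-n≡m⊖n A i))))

-- This is the exponent of x in the identity `w-shift` of theta terms; `tri-shift-right` is the
-- exponent of y.
tri-shift-left : ∀ A i → suc A ℕ.+ tri (A ⊖ i) ≡ i ℕ.+ tri (suc A ⊖ i)
tri-shift-left A i = ℤ.+-injective (≡.sym (≡.trans (≡.cong (λ z → + i ℤ.+ z) (tri-suc-⊖ A i))
  (solve 3 (λ a i t → i :+ (con (+ 1) :+ t :+ con (+ 1) :* (a :- i)) := (con (+ 1) :+ a) :+ t) ≡.refl (+ A) (+ i) (+ tri (A ⊖ i)))))
  where open ℤS.+-*-Solver

tri-shift-right : ∀ A i → A ℕ.+ tri (ℤ.- (A ⊖ i)) ≡ i ℕ.+ tri (ℤ.- (suc A ⊖ i))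
tri-shift-right A i = ℤ.+-injective (≡.trans
  (≡.cong (λ z → + A ℤ.+ z) (≡.trans (tri-neg (A ⊖ i)) (≡.cong (λ z → + tri (A ⊖ i) ℤ.- z) (≡.sym (ℤ.m-n≡m⊖n A i)))))
  (≡.trans
   (solve 3 (λ a i t → a :+ (t :- (a :- i)) := i :+ ((con (+ 1) :+ t :+ con (+ 1) :* (a :- i)) :- ((con (+ 1) :+ a) :- i))) ≡.refl (+ A) (+ i) (+ tri (A ⊖ i)))
  (≡.sym (≡.cong (λ z → + i ℤ.+ z) (≡.trans (tri-neg (suc A ⊖ i))
    (≡.cong₂ ℤ._-_ (tri-suc-⊖ A i) (≡.sym (ℤ.m-n≡m⊖n (suc A) i))))))))
  where open ℤS.+-*-Solver

⊖-reflect : ∀ N i j → i ℕ.+ j ≡ N ℕ.+ N → ∣ N ⊖ i ∣ ≡ ∣ N ⊖ j ∣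
⊖-reflect N i j e = begin
  ∣ N ⊖ i ∣                      ≡⟨ ≡.cong ∣_∣ (ℤ.+-cancelˡ-⊖ N N i) ⟨
  ∣ (N ℕ.+ N) ⊖ (N ℕ.+ i) ∣      ≡⟨ ≡.cong₂ (λ a b → ∣ a ⊖ b ∣) (≡.sym e) (ℕ.+-comm N i) ⟩
  ∣ (i ℕ.+ j) ⊖ (i ℕ.+ N) ∣      ≡⟨ ≡.cong ∣_∣ (ℤ.+-cancelˡ-⊖ i j N) ⟩
  ∣ j ⊖ N ∣                      ≡⟨ ≡.cong ∣_∣ (ℤ.⊖-swap j N) ⟩
  ∣ ℤ.- (N ⊖ j) ∣                ≡⟨ ℤ.∣-i∣≡∣i∣ (N ⊖ j) ⟩
  ∣ N ⊖ j ∣                      ∎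
  where open ≡.≡-Reasoning

module Products (R : CommutativeRing 0ℓ 0ℓ) where
  open CommutativeRing R
  open import Relation.Binary.Reasoning.Setoid setoid
  open import Algebra.Solver.Ring.NaturalCoefficients.Default commutativeSemiring
    using (solve; _:=_; _:*_)

  Π< : ℕ → (ℕ → Carrier) → Carrier
  Π< zero    h = 1#
  Π< (suc n) h = Π< n h * h n

  Π<-cong : ∀ n {h k} → (∀ i → h i ≈ k i) → Π< n h ≈ Π< n k
  Π<-cong zero    e = refl
  Π<-cong (suc n) e = *-cong (Π<-cong n e) (e n)

  Π<-* : ∀ n h k → Π< n (λ i → h i * k i) ≈ Π< n h * Π< n k
  Π<-* zero    h k = sym (*-identityʳ 1#)
  Π<-* (suc n) h k = trans (*-congʳ (Π<-* n h k))
    (solve 4 (λ a b c d → (a :* b) :* (c :* d) := (a :* c) :* (b :* d)) refl _ _ _ _)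

  Π<-front : ∀ n h → Π< (suc n) h ≈ h 0 * Π< n (λ i → h (suc i))
  Π<-front zero    h = *-comm _ _
  Π<-front (suc n) h = trans (*-congʳ (Π<-front n h)) (*-assoc _ _ _)

  Π<-1 : ∀ n {h} → (∀ i → h i ≈ 1#) → Π< n h ≈ 1#
  Π<-1 zero    e = refl
  Π<-1 (suc n) e = trans (*-cong (Π<-1 n e) (e n)) (*-identityʳ 1#)

  Π<-stable : ∀ {h} K {n} → (∀ i → K ℕ.≤ i → h i ≈ 1#) → K ℕ.≤ n → Π< n h ≈ Π< K h
  Π<-stable {h} K {n} e K≤n =
    trans (reflexive (≡.cong (λ k → Π< k h) (≡.sym (ℕ.m∸n+n≡m K≤n)))) (extend (n ℕ.∸ K))
    where
    extend : ∀ j → Π< (j ℕ.+ K) h ≈ Π< K h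
    extend zero    = refl
    extend (suc j) = trans (*-cong (extend j) (e _ (ℕ.m≤n+m K j))) (*-identityʳ _)

  Π<-parity : ∀ n h → Π< (n ℕ.+ n) h ≈ Π< n (λ i → h (i ℕ.+ i)) * Π< n (λ i → h (suc (i ℕ.+ i)))
  Π<-parity zero    h = sym (*-identityʳ 1#)
  Π<-parity (suc n) h rewrite ℕ.+-suc n n = trans (*-congʳ (*-congʳ (Π<-parity n h)))
    (solve 4 (λ a b c d → a :* b :* c :* d := (a :* c) :* (b :* d)) refl _ _ _ _)

  Π<-split : ∀ a n h → Π< (n ℕ.+ a) h ≈ Π< a h * Π< n (λ i → h (i ℕ.+ a))
  Π<-split a zero    h = sym (*-identityʳ _)
  Π<-split a (suc n) h = trans (*-congʳ (Π<-split a n h)) (*-assoc _ _ _)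

  Π<-blocks : ∀ n M h → Π< (n ℕ.* M) h ≈ Π< n (λ i → Π< M (λ r → h (r ℕ.+ i ℕ.* M)))
  Π<-blocks zero    M h = refl
  Π<-blocks (suc n) M h = trans (Π<-split (n ℕ.* M) M h) (*-congʳ (Π<-blocks n M h))

  Π<-swap : ∀ n M (h : ℕ → ℕ → Carrier) → Π< n (λ i → Π< M (h i)) ≈ Π< M (λ r → Π< n (λ i → h i r))
  Π<-swap zero    M h = sym (Π<-1 M (λ _ → refl))
  Π<-swap (suc n) M h = trans (*-congʳ (Π<-swap n M h)) (sym (Π<-* M _ _))

  -- Meant for the factor 2 of f(1, q^28): over ℤ it is cancellable without being a unit.
  TwoCancellable : Set
  TwoCancellable = ∀ x y → (1# + 1#) * x ≈ (1# + 1#) * y → x ≈ y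

  Unit : Carrier → Set
  Unit a = ∃[ b ] a * b ≈ 1#

  Unit-* : ∀ {a b} → Unit a → Unit b → Unit (a * b)
  Unit-* (a′ , p) (b′ , q) = a′ * b′ , trans
    (solve 4 (λ a b c d → (a :* b) :* (c :* d) := (a :* c) :* (b :* d)) refl _ _ _ _)
    (trans (*-cong p q) (*-identityʳ 1#))

  Unit-Π< : ∀ n {h} → (∀ i → Unit (h i)) → Unit (Π< n h)
  Unit-Π< zero    u = 1# , *-identityʳ 1#
  Unit-Π< (suc n) u = Unit-* (Unit-Π< n u) (u n)

  Unit-resp : ∀ {a b} → a ≈ b → Unit a → Unit b
  Unit-resp e (c , p) = c , trans (*-congʳ (sym e)) p

  cancelˡ : ∀ {a} → Unit a → ∀ {x y} → a * x ≈ a * y → x ≈ y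
  cancelˡ {a} (b , ab≈1) {x} {y} e = begin
    x            ≈⟨ lem x ⟨
    b * (a * x)  ≈⟨ *-congˡ e ⟩
    b * (a * y)  ≈⟨ lem y ⟩
    y            ∎
    where
    lem : ∀ z → b * (a * z) ≈ z
    lem z = trans (solve 3 (λ b a z → b :* (a :* z) := (a :* b) :* z) refl b a z) (trans (*-congʳ ab≈1) (*-identityˡ z))

module JacobiTripleProduct (R : CommutativeRing 0ℓ 0ℓ) (K : ℕ) where
  open CommutativeRing R
  open Products R
  open BilateralSums R
  open Theta R K
  open import Relation.Binary.Reasoning.Setoid setoid
  open import Algebra.Properties.Ring ring
  open import Algebra.Properties.Semiring.Exp semiring
  open import Algebra.Properties.CommutativeSemiring.Exp commutativeSemiring using (^-distrib-*)
  open import Algebra.Solver.Ring.NaturalCoefficients.Default commutativeSemiring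
    using (solve; _:=_; _:+_; _:*_; con)

  anti : ℕ → (ℕ → ℕ → Carrier) → Carrier
  anti zero    g = g 0 0
  anti (suc n) g = g 0 (suc n) + anti n (λ i j → g (suc i) j)

  anti-cong : ∀ n {g h} → (∀ i j → i ℕ.+ j ≡ n → g i j ≈ h i j) → anti n g ≈ anti n h
  anti-cong zero    e = e 0 0 ≡.refl
  anti-cong (suc n) e = +-cong (e 0 (suc n) ≡.refl) (anti-cong n (λ i j p → e (suc i) j (≡.cong suc p)))

  anti-+ : ∀ n g h → anti n (λ i j → g i j + h i j) ≈ anti n g + anti n h
  anti-+ zero    g h = refl
  anti-+ (suc n) g h = trans (+-congˡ (anti-+ n _ _))
    (solve 4 (λ a b c d → (a :+ b) :+ (c :+ d) := (a :+ c) :+ (b :+ d)) refl _ _ _ _)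

  anti-*ʳ : ∀ n g c → anti n (λ i j → g i j * c) ≈ anti n g * c
  anti-*ʳ zero    g c = refl
  anti-*ʳ (suc n) g c = trans (+-congˡ (anti-*ʳ n _ c)) (sym (distribʳ c _ _))

  anti-back : ∀ n g → anti (suc n) g ≈ anti n (λ i j → g i (suc j)) + g (suc n) 0
  anti-back zero    g = refl
  anti-back (suc n) g = trans (+-congˡ (anti-back n (λ i j → g (suc i) j))) (sym (+-assoc _ _ _))

  anti-Σ± : ∀ N (w : ℤ → Carrier) → anti (N ℕ.+ N) (λ i j → w (N ⊖ i)) ≈ Σ± N w
  anti-Σ± zero    w = refl
  anti-Σ± (suc N) w rewrite ℕ.+-suc N N = begin
    w (+ suc N) + anti (suc (N ℕ.+ N)) (λ i j → w (suc N ⊖ suc i))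
      ≈⟨ +-congˡ (anti-back (N ℕ.+ N) (λ i j → w (suc N ⊖ suc i))) ⟩
    w (+ suc N) + (anti (N ℕ.+ N) (λ i j → w (suc N ⊖ suc i)) + w (suc N ⊖ suc (suc (N ℕ.+ N))))
      ≈⟨ +-congˡ (+-cong (trans (anti-cong (N ℕ.+ N) (λ i j _ → reflexive (≡.cong w (ℤ.[1+m]⊖[1+n]≡m⊖n N i)))) (anti-Σ± N w))
           (reflexive (≡.cong w bottom))) ⟩
    w (+ suc N) + (Σ± N w + w -[1+ N ])
      ≈⟨ solve 3 (λ a b c → a :+ (b :+ c) := b :+ (a :+ c)) refl _ _ _ ⟩
    Σ± N w + (w (+ suc N) + w -[1+ N ]) ∎
    where
    bottom : suc N ⊖ suc (suc (N ℕ.+ N)) ≡ -[1+ N ]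
    bottom = ≡.trans (ℤ.[1+m]⊖[1+n]≡m⊖n N (suc (N ℕ.+ N)))
      (≡.trans (ℤ.⊖-≤ (ℕ.m≤n⇒m≤1+n (ℕ.m≤m+n N N)))
        (≡.cong (λ k → ℤ.- (+ k)) (≡.trans (≡.cong (ℕ._∸ N) (≡.sym (ℕ.+-suc N N))) (ℕ.m+n∸m≡n N (suc N)))))

  module _ (m : Carrier) where

    -- The Gaussian binomial coefficient [i + j choose i] at m.
    gauss : ℕ → ℕ → Carrier
    gauss zero    j       = 1#
    gauss (suc i) zero    = 1#
    gauss (suc i) (suc j) = gauss i (suc j) + m ^ suc i * gauss (suc i) j

    euler : ℕ → Carrier
    euler n = Π< n (λ l → 1# - m ^ suc l)

    gauss-zeroʳ : ∀ i → gauss i 0 ≈ 1#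
    gauss-zeroʳ zero    = refl
    gauss-zeroʳ (suc i) = refl

    -- The quotient formula for Gaussian binomials, cleared of denominators. In the induction the
    -- two terms of the Pascal rule combine by (1 - m^(i+1)) + m^(i+1) (1 - m^(j+1)) = 1 -
    -- m^(i+j+2).
    gauss-euler : ∀ i j → gauss i j * (euler i * euler j) ≈ euler (i ℕ.+ j)
    gauss-euler zero    j       = trans (*-identityˡ _) (*-identityˡ _)
    gauss-euler (suc i) zero    = trans (*-identityˡ _) (trans (*-identityʳ _) (reflexive (≡.cong euler (≡.sym (ℕ.+-identityʳ (suc i))))))
    gauss-euler (suc i) (suc j) = begin
      (gauss i (suc j) + mi * gauss (suc i) j) * ((euler i * di) * (euler j * dj))
        ≈⟨ solve 7 (λ a b mi ei di ej dj → (a :+ mi :* b) :* ((ei :* di) :* (ej :* dj)) :=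
             (a :* (ei :* (ej :* dj))) :* di :+ (b :* ((ei :* di) :* ej)) :* (mi :* dj)) refl _ _ _ _ _ _ _ ⟩
      (gauss i (suc j) * (euler i * euler (suc j))) * di + (gauss (suc i) j * (euler (suc i) * euler j)) * (mi * dj)
        ≈⟨ +-cong (*-congʳ (gauss-euler i (suc j))) (*-congʳ (gauss-euler (suc i) j)) ⟩
      euler (i ℕ.+ suc j) * di + euler (suc i ℕ.+ j) * (mi * dj)
        ≈⟨ +-congʳ (*-congʳ (reflexive (≡.cong euler (ℕ.+-suc i j)))) ⟩
      euler (suc i ℕ.+ j) * di + euler (suc i ℕ.+ j) * (mi * dj)
        ≈⟨ distribˡ _ _ _ ⟨
      euler (suc i ℕ.+ j) * ((1# - mi) + mi * (1# - mj))
        ≈⟨ *-congˡ telescope ⟩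
      euler (suc i ℕ.+ j) * (1# - m ^ suc (suc i ℕ.+ j))
        ≡⟨ ≡.cong (λ k → euler k) (≡.sym (ℕ.+-suc (suc i) j)) ⟩
      euler (suc i ℕ.+ suc j) ∎
      where
      mi = m ^ suc i
      mj = m ^ suc j
      di = 1# - mi
      dj = 1# - mj
      telescope : (1# - mi) + mi * (1# - mj) ≈ 1# - m ^ suc (suc i ℕ.+ j)
      telescope = begin
        (1# - mi) + mi * (1# - mj)
          ≈⟨ solve 3 (λ a b n → (con 1 :+ n) :+ a :* (con 1 :+ b) := con 1 :+ (a :+ n) :+ a :* b) refl mi (- mj) (- mi) ⟩
        1# + (mi - mi) + mi * - mj
          ≈⟨ +-cong (trans (+-congˡ (-‿inverseʳ mi)) (+-identityʳ 1#)) (sym (-‿distribʳ-* mi mj)) ⟩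
        1# - mi * mj
          ≈⟨ +-congˡ (-‿cong (trans (sym (^-homo-* m (suc i) (suc j))) (^-congʳ m (ℕ.+-suc (suc i) j)))) ⟩
        1# - m ^ suc (suc i ℕ.+ j) ∎

    -- The Pascal rule summed over an antidiagonal. It is the induction step of both the q-binomial
    -- theorem and the finite triple product: in each, one more linear factor turns the weight W i
    -- into m^i W i + W (i + 1).
    anti-pascal : ∀ n (W : ℕ → Carrier) →
      anti n (λ i j → gauss i j * (m ^ i * W i + W (suc i))) ≈ anti (suc n) (λ i j → gauss i j * W i)
    anti-pascal n W = sym (begin
      1# * W 0 + anti n (λ i j → gauss (suc i) j * W (suc i))
        ≈⟨ +-congˡ (trans (anti-cong n (λ i j _ → pascal i j)) (anti-+ n _ _)) ⟩
      1# * W 0 + (anti n (λ i j → gauss i j * W (suc i)) + anti n (λ i j → m ^ suc i * (lower (suc i) j * W (suc i))))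
        ≈⟨ solve 3 (λ a b c → con 1 :* a :+ (b :+ c) := (con 1 :* (con 1 :* a) :+ c) :+ b) refl _ _ _ ⟩
      anti (suc n) (λ i j → m ^ i * (lower i j * W i)) + anti n (λ i j → gauss i j * W (suc i))
        ≈⟨ +-congʳ (trans (anti-back n (λ i j → m ^ i * (lower i j * W i))) (trans (+-congˡ (trans (*-congˡ (zeroˡ _)) (zeroʳ _))) (+-identityʳ _))) ⟩
      anti n (λ i j → m ^ i * (gauss i j * W i)) + anti n (λ i j → gauss i j * W (suc i))
        ≈⟨ anti-+ n _ _ ⟨
      anti n (λ i j → m ^ i * (gauss i j * W i) + gauss i j * W (suc i))
        ≈⟨ anti-cong n (λ i j _ → solve 4 (λ a g w w′ → a :* (g :* w) :+ g :* w′ := g :* (a :* w :+ w′)) refl _ _ _ _) ⟩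
      anti n (λ i j → gauss i j * (m ^ i * W i + W (suc i))) ∎)
      where
      -- The coefficient with j lowered by one, set to 0 at j = 0 so that the Pascal rule also holds
      -- on the boundary.
      lower : ℕ → ℕ → Carrier
      lower i zero    = 0#
      lower i (suc j) = gauss i j
      pascal : ∀ i j → gauss (suc i) j * W (suc i) ≈ gauss i j * W (suc i) + m ^ suc i * (lower (suc i) j * W (suc i))
      pascal i zero    = begin
        1# * W (suc i)           ≈⟨ *-congʳ (gauss-zeroʳ i) ⟨
        gauss i 0 * W (suc i)    ≈⟨ solve 3 (λ a w c → a :* w := a :* w :+ c :* (con 0 :* w)) refl _ _ _ ⟩
        gauss i 0 * W (suc i) + m ^ suc i * (0# * W (suc i)) ∎
      pascal i (suc j) = solve 4 (λ a b c w → (a :+ c :* b) :* w := a :* w :+ c :* (b :* w)) refl _ _ _ _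

    -- The weights are y^i m^(i(i-1)/2), given only by their recurrence: splitting off the factor l
    -- = 0 replaces y by ym, and the weights m^i W i satisfy the recurrence for ym.
    q-binomial : ∀ B y (W : ℕ → Carrier) → W 0 ≈ 1# → (∀ i → W (suc i) ≈ y * m ^ i * W i) →
      Π< B (λ l → 1# + y * m ^ l) ≈ anti B (λ i j → gauss i j * W i)
    q-binomial zero    y W W₀ Wₛ = sym (trans (*-identityˡ _) W₀)
    q-binomial (suc B) y W W₀ Wₛ = begin
      Π< (suc B) (λ l → 1# + y * m ^ l)
        ≈⟨ Π<-front B _ ⟩
      (1# + y * m ^ 0) * Π< B (λ l → 1# + y * m ^ suc l)
        ≈⟨ *-comm _ _ ⟩
      Π< B (λ l → 1# + y * m ^ suc l) * (1# + y * m ^ 0)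
        ≈⟨ *-congʳ (Π<-cong B (λ l → +-congˡ (sym (*-assoc y m _)))) ⟩
      Π< B (λ l → 1# + y * m * m ^ l) * (1# + y * m ^ 0)
        ≈⟨ *-cong (q-binomial B (y * m) W′ (trans (*-identityˡ _) W₀) W′ₛ) (+-congˡ (*-identityʳ y)) ⟩
      anti B (λ i j → gauss i j * W′ i) * (1# + y)
        ≈⟨ anti-*ʳ B _ _ ⟨
      anti B (λ i j → gauss i j * W′ i * (1# + y))
        ≈⟨ anti-cong B (λ i j _ → trans
             (solve 4 (λ g a w y → g :* (a :* w) :* (con 1 :+ y) := g :* (a :* w :+ y :* a :* w)) refl _ _ _ _)
             (*-congˡ (+-congˡ (sym (Wₛ i))))) ⟩
      anti B (λ i j → gauss i j * (m ^ i * W i + W (suc i)))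
        ≈⟨ anti-pascal B W ⟩
      anti (suc B) (λ i j → gauss i j * W i) ∎
      where
      W′ : ℕ → Carrier
      W′ i = m ^ i * W i
      W′ₛ : ∀ i → W′ (suc i) ≈ y * m * m ^ i * W′ i
      W′ₛ i = trans (*-congˡ (Wₛ i)) (solve 4 (λ m a y w → m :* a :* (y :* a :* w) := y :* m :* a :* (a :* w)) refl _ _ _ _)

  module _ (x y : Carrier) where
    private
      m = x * y
      w = θterm x y

      monomial : ∀ a b a′ b′ → (x ^ a * y ^ b) * (x ^ a′ * y ^ b′) ≈ x ^ (a ℕ.+ a′) * y ^ (b ℕ.+ b′)
      monomial a b a′ b′ = trans
        (solve 4 (λ a b c d → (a :* b) :* (c :* d) := (a :* c) :* (b :* d)) refl _ _ _ _)
        (sym (*-cong (^-homo-* x a a′) (^-homo-* y b b′)))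

      w-shift : ∀ A i → x * m ^ A * w (A ⊖ i) ≈ m ^ i * w (suc A ⊖ i)
      w-shift A i = begin
        x * m ^ A * w (A ⊖ i)
          ≈⟨ *-congʳ (trans (*-congˡ (^-distrib-* x y A)) (sym (*-assoc _ _ _))) ⟩
        (x ^ suc A * y ^ A) * w (A ⊖ i)
          ≈⟨ monomial (suc A) A (tri (A ⊖ i)) (tri (ℤ.- (A ⊖ i))) ⟩
        x ^ (suc A ℕ.+ tri (A ⊖ i)) * y ^ (A ℕ.+ tri (ℤ.- (A ⊖ i)))
          ≡⟨ ≡.cong₂ (λ a b → x ^ a * y ^ b) (tri-shift-left A i) (tri-shift-right A i) ⟩
        x ^ (i ℕ.+ tri (suc A ⊖ i)) * y ^ (i ℕ.+ tri (ℤ.- (suc A ⊖ i)))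
          ≈⟨ monomial i i (tri (suc A ⊖ i)) (tri (ℤ.- (suc A ⊖ i))) ⟨
        (x ^ i * y ^ i) * w (suc A ⊖ i)
          ≈⟨ *-congʳ (^-distrib-* x y i) ⟨
        m ^ i * w (suc A ⊖ i) ∎

    -- Induction on A. For A = 0 this is the q-binomial theorem, as w(-i) = y^i m^(i(i-1)/2). The
    -- factor 1 + x m^A is absorbed by `w-shift`, which brings the weights into the form that
    -- `anti-pascal` accepts.
    finite-triple-product : ∀ A B →
      Π< A (λ l → 1# + x * m ^ l) * Π< B (λ l → 1# + y * m ^ l)
      ≈ anti (A ℕ.+ B) (λ i j → gauss m i j * w (A ⊖ i))
    finite-triple-product zero    B = trans (*-identityˡ _) (q-binomial m B y (λ i → w (0 ⊖ i)) (*-identityʳ 1#) next)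
      where
      next : ∀ i → w (0 ⊖ suc i) ≈ y * m ^ i * w (0 ⊖ i)
      next zero    = solve 1 (λ y → con 1 :* (y :* con 1) := y :* con 1 :* (con 1 :* con 1)) refl y
      next (suc k) = begin
        x ^ (suc k ℕ.+ triangle k) * y ^ (suc (suc k) ℕ.+ triangle (suc k))
          ≈⟨ monomial (suc k) (suc (suc k)) (triangle k) (triangle (suc k)) ⟨
        (x ^ suc k * y ^ suc (suc k)) * w -[1+ k ]
          ≈⟨ *-congʳ (trans (solve 3 (λ a y b → a :* (y :* b) := y :* (a :* b)) refl _ _ _) (*-congˡ (sym (^-distrib-* x y (suc k))))) ⟩
        y * m ^ suc k * w -[1+ k ] ∎
    finite-triple-product (suc A) B = begin
      (Π< A (λ l → 1# + x * m ^ l) * (1# + x * m ^ A)) * Π< B (λ l → 1# + y * m ^ l)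
        ≈⟨ solve 3 (λ a b c → (a :* b) :* c := (a :* c) :* b) refl _ _ _ ⟩
      (Π< A (λ l → 1# + x * m ^ l) * Π< B (λ l → 1# + y * m ^ l)) * (1# + x * m ^ A)
        ≈⟨ *-congʳ (finite-triple-product A B) ⟩
      anti (A ℕ.+ B) (λ i j → gauss m i j * w (A ⊖ i)) * (1# + x * m ^ A)
        ≈⟨ anti-*ʳ (A ℕ.+ B) _ _ ⟨
      anti (A ℕ.+ B) (λ i j → gauss m i j * w (A ⊖ i) * (1# + x * m ^ A))
        ≈⟨ anti-cong (A ℕ.+ B) (λ i j _ → trans
             (solve 3 (λ g w a → g :* w :* (con 1 :+ a) := g :* (a :* w :+ w)) refl _ _ _)
             (*-congˡ (+-cong (w-shift A i) (reflexive (≡.cong w (≡.sym (ℤ.[1+m]⊖[1+n]≡m⊖n A i))))))) ⟩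
      anti (A ℕ.+ B) (λ i j → gauss m i j * (m ^ i * w (suc A ⊖ i) + w (suc A ⊖ suc i)))
        ≈⟨ anti-pascal m (A ℕ.+ B) (λ i → w (suc A ⊖ i)) ⟩
      anti (suc A ℕ.+ B) (λ i j → gauss m i j * w (suc A ⊖ i)) ∎

  private
    N : ℕ
    N = K ℕ.+ K

  -- The geometric series, which stops because m^K = 0.
  Unit-1-null : ∀ {m} → Null m → Unit (1# - m)
  Unit-1-null {m} null = geom K , trans (telescope K) (trans (+-congˡ (trans (-‿cong null) -0#≈0#)) (+-identityʳ 1#))
    where
    geom : ℕ → Carrier
    geom zero    = 0#
    geom (suc n) = geom n + m ^ n
    telescope : ∀ n → (1# - m) * geom n ≈ 1# - m ^ n
    telescope zero    = trans (zeroʳ _) (sym (-‿inverseʳ 1#))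
    telescope (suc n) = begin
      (1# - m) * (geom n + m ^ n)
        ≈⟨ trans (distribˡ _ _ _) (+-congʳ (telescope n)) ⟩
      (1# - m ^ n) + (1# - m) * m ^ n
        ≈⟨ solve 3 (λ a n k → (con 1 :+ n) :+ (con 1 :+ k) :* a := (con 1 :+ (a :+ n)) :+ k :* a) refl (m ^ n) (- (m ^ n)) (- m) ⟩
      (1# + (m ^ n - m ^ n)) + - m * m ^ n
        ≈⟨ +-cong (trans (+-congˡ (-‿inverseʳ _)) (+-identityʳ 1#)) (sym (-‿distribˡ-* _ _)) ⟩
      1# - m ^ suc n ∎

  Null-power : ∀ {m} n → Null m → Null (m ^ suc n)
  Null-power {m} n null = trans (^-assocʳ m (suc n) K)
    (power-null null (ℕ.m≤m+n K (n ℕ.* K)))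

  1-null : ∀ {m} i → Null m → K ℕ.≤ i → 1# - m ^ suc i ≈ 1#
  1-null i null K≤i = trans (+-congˡ (trans (-‿cong (power-null null (ℕ.m≤n⇒m≤1+n K≤i))) -0#≈0#)) (+-identityʳ 1#)

  Unit-euler : ∀ {m} n → Null m → Unit (euler m n)
  Unit-euler n null = Unit-Π< n (λ l → Unit-1-null (Null-power l null))

  -- The finite version with A = B = 2K instead of a limit. If i and j are both at least K, all
  -- Euler products in `gauss-euler` have become stationary and the Gaussian binomial is the inverse
  -- of `E`. Otherwise |2K - i| > K, and the theta term is already zero.
  triple-product : ∀ x y → let m = x * y in Null m →
    f x y ≈ Π< K (λ l → 1# + x * m ^ l) * Π< K (λ l → 1# + y * m ^ l) * euler m K
  triple-product x y null = sym (begin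
    Π< K (λ l → 1# + x * m ^ l) * Π< K (λ l → 1# + y * m ^ l) * E
      ≈⟨ *-congʳ (*-cong (stable x) (stable y)) ⟨
    Π< N (λ l → 1# + x * m ^ l) * Π< N (λ l → 1# + y * m ^ l) * E
      ≈⟨ *-congʳ (finite-triple-product x y N N) ⟩
    anti (N ℕ.+ N) (λ i j → gauss m i j * w (N ⊖ i)) * E
      ≈⟨ anti-*ʳ (N ℕ.+ N) _ E ⟨
    anti (N ℕ.+ N) (λ i j → gauss m i j * w (N ⊖ i) * E)
      ≈⟨ anti-cong (N ℕ.+ N) limit ⟩
    anti (N ℕ.+ N) (λ i j → w (N ⊖ i))
      ≈⟨ anti-Σ± N w ⟩
    Σ± N w
      ≈⟨ Σ±-extend K (Supported-θ null) ⟩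
    f x y ∎)
    where
    m = x * y
    w = θterm x y
    E = euler m K
    stable : ∀ z → Π< N (λ l → 1# + z * m ^ l) ≈ Π< K (λ l → 1# + z * m ^ l)
    stable z = Π<-stable K (λ i K≤i → trans (+-congˡ (trans (*-congˡ (power-null null K≤i)) (zeroʳ z))) (+-identityʳ 1#)) (ℕ.m≤m+n K K)
    euler-stable : ∀ {n} → K ℕ.≤ n → euler m n ≈ E
    euler-stable = Π<-stable K (λ i → 1-null i null)
    gauss-limit : ∀ i j → K ℕ.≤ i → K ℕ.≤ j → gauss m i j * E ≈ 1#
    gauss-limit i j K≤i K≤j = cancelˡ (Unit-euler K null) (begin
      E * (gauss m i j * E)  ≈⟨ solve 2 (λ e g → e :* (g :* e) := g :* (e :* e)) refl _ _ ⟩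
      gauss m i j * (E * E)  ≈⟨ *-congˡ (*-cong (euler-stable K≤i) (euler-stable K≤j)) ⟨
      gauss m i j * (euler m i * euler m j) ≈⟨ gauss-euler m i j ⟩
      euler m (i ℕ.+ j)      ≈⟨ euler-stable (ℕ.≤-trans K≤i (ℕ.m≤m+n i j)) ⟩
      E                      ≈⟨ *-identityʳ E ⟨
      E * 1# ∎)
    far : ∀ i → i ℕ.< K → K ℕ.< ∣ N ⊖ i ∣
    far i i<K = ≡.subst (λ z → K ℕ.< ∣ z ∣) (≡.sym (ℤ.⊖-≥ (ℕ.≤-trans (ℕ.<⇒≤ i<K) (ℕ.m≤m+n K K))))
      (ℕ.m+n≤o⇒m≤o∸n (suc K) (≡.subst (ℕ._≤ N) (ℕ.+-suc K i) (ℕ.+-monoʳ-≤ K i<K)))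
    vanish : ∀ {g z} → z ≈ 0# → g * z * E ≈ z
    vanish z≈0 = trans (*-congʳ (trans (*-congˡ z≈0) (zeroʳ _))) (trans (zeroˡ E) (sym z≈0))
    limit : ∀ i j → i ℕ.+ j ≡ N ℕ.+ N → gauss m i j * w (N ⊖ i) * E ≈ w (N ⊖ i)
    limit i j i+j with K ℕ.≤? i | K ℕ.≤? j
    ... | yes K≤i | yes K≤j = begin
      gauss m i j * w (N ⊖ i) * E   ≈⟨ solve 3 (λ g w e → g :* w :* e := (g :* e) :* w) refl _ _ _ ⟩
      (gauss m i j * E) * w (N ⊖ i) ≈⟨ *-congʳ (gauss-limit i j K≤i K≤j) ⟩
      1# * w (N ⊖ i)                ≈⟨ *-identityˡ _ ⟩
      w (N ⊖ i) ∎
    ... | no K≰i | _ = vanish (Supported-θ null (N ⊖ i) (far i (ℕ.≰⇒> K≰i)))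
    ... | yes _ | no K≰j = vanish (Supported-θ null (N ⊖ i)
      (≡.subst (K ℕ.<_) (≡.sym (⊖-reflect N i j i+j)) (far j (ℕ.≰⇒> K≰j))))

-- Truncated power series

module PowerSeries where
  open ℤS.+-*-Solver

  Series : Set
  Series = ℕ → ℤ

  tail : Series → Series
  tail f n = f (suc n)

  infixl 6 _⊕_
  infixl 7 _⊛_

  _⊕_ _⊛_ : Series → Series → Series
  (f ⊕ g) n = f n ℤ.+ g n
  (f ⊛ g) zero    = f 0 ℤ.* g 0
  (f ⊛ g) (suc n) = f 0 ℤ.* g (suc n) ℤ.+ (tail f ⊛ g) n

  0ˢ 1ˢ q : Series
  0ˢ _ = + 0
  1ˢ zero    = + 1
  1ˢ (suc _) = + 0
  q zero    = + 0
  q (suc n) = 1ˢ n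

  ⊛-cong≤ : ∀ {f f′ g g′} n → (∀ i → i ℕ.≤ n → f i ≡ f′ i) → (∀ i → i ℕ.≤ n → g i ≡ g′ i) →
    (f ⊛ g) n ≡ (f′ ⊛ g′) n
  ⊛-cong≤ zero    p r = ≡.cong₂ ℤ._*_ (p 0 ℕ.z≤n) (r 0 ℕ.z≤n)
  ⊛-cong≤ (suc n) p r = ≡.cong₂ ℤ._+_ (≡.cong₂ ℤ._*_ (p 0 ℕ.z≤n) (r (suc n) ℕ.≤-refl))
    (⊛-cong≤ n (λ i i≤n → p (suc i) (ℕ.s≤s i≤n)) (λ i i≤n → r i (ℕ.m≤n⇒m≤1+n i≤n)))

  ⊛-sucʳ : ∀ f g n → (f ⊛ g) (suc n) ≡ f (suc n) ℤ.* g 0 ℤ.+ (f ⊛ tail g) n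
  ⊛-sucʳ f g zero    = ℤ.+-comm (f 0 ℤ.* g 1) (f 1 ℤ.* g 0)
  ⊛-sucʳ f g (suc n) = ≡.trans (≡.cong (λ z → f 0 ℤ.* g (suc (suc n)) ℤ.+ z) (⊛-sucʳ (tail f) g n))
    (solve 3 (λ a b c → a :+ (b :+ c) := b :+ (a :+ c)) ≡.refl (f 0 ℤ.* g (suc (suc n))) (f (suc (suc n)) ℤ.* g 0) ((tail f ⊛ tail g) n))

  ⊛-comm : ∀ f g → f ⊛ g ≗ g ⊛ f
  ⊛-comm f g zero    = ℤ.*-comm (f 0) (g 0)
  ⊛-comm f g (suc n) = ≡.trans (≡.cong₂ ℤ._+_ (ℤ.*-comm (f 0) (g (suc n))) (⊛-comm (tail f) g n)) (≡.sym (⊛-sucʳ g f n))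

  ⊛-distribʳ : ∀ h f g → (f ⊕ g) ⊛ h ≗ f ⊛ h ⊕ g ⊛ h
  ⊛-distribʳ h f g zero    = ℤ.*-distribʳ-+ (h 0) (f 0) (g 0)
  ⊛-distribʳ h f g (suc n) = ≡.trans (≡.cong (λ z → (f 0 ℤ.+ g 0) ℤ.* h (suc n) ℤ.+ z) (⊛-distribʳ h (tail f) (tail g) n))
    (solve 5 (λ a b c x y → (a :+ b) :* c :+ (x :+ y) := (a :* c :+ x) :+ (b :* c :+ y)) ≡.refl
      (f 0) (g 0) (h (suc n)) ((tail f ⊛ h) n) ((tail g ⊛ h) n))

  ⊛-scale : ∀ c f g n → ((λ i → c ℤ.* f i) ⊛ g) n ≡ c ℤ.* (f ⊛ g) n
  ⊛-scale c f g zero    = ℤ.*-assoc c (f 0) (g 0)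
  ⊛-scale c f g (suc n) = ≡.trans (≡.cong (λ z → c ℤ.* f 0 ℤ.* g (suc n) ℤ.+ z) (⊛-scale c (tail f) g n))
    (solve 4 (λ c a b x → c :* a :* b :+ c :* x := c :* (a :* b :+ x)) ≡.refl c (f 0) (g (suc n)) ((tail f ⊛ g) n))

  ⊛-assoc : ∀ f g h → (f ⊛ g) ⊛ h ≗ f ⊛ (g ⊛ h)
  ⊛-assoc f g h zero    = ℤ.*-assoc (f 0) (g 0) (h 0)
  ⊛-assoc f g h (suc n) = begin
    f 0 ℤ.* g 0 ℤ.* h (suc n) ℤ.+ (((λ i → f 0 ℤ.* tail g i) ⊕ tail f ⊛ g) ⊛ h) n
      ≡⟨ ≡.cong (λ z → f 0 ℤ.* g 0 ℤ.* h (suc n) ℤ.+ z) (≡.trans (⊛-distribʳ h (λ i → f 0 ℤ.* tail g i) (tail f ⊛ g) n)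
           (≡.cong₂ ℤ._+_ (⊛-scale (f 0) (tail g) h n) (⊛-assoc (tail f) g h n))) ⟩
    f 0 ℤ.* g 0 ℤ.* h (suc n) ℤ.+ (f 0 ℤ.* (tail g ⊛ h) n ℤ.+ (tail f ⊛ (g ⊛ h)) n)
      ≡⟨ solve 5 (λ a b c x y → a :* b :* c :+ (a :* x :+ y) := a :* (b :* c :+ x) :+ y) ≡.refl
           (f 0) (g 0) (h (suc n)) ((tail g ⊛ h) n) ((tail f ⊛ (g ⊛ h)) n) ⟩
    f 0 ℤ.* (g 0 ℤ.* h (suc n) ℤ.+ (tail g ⊛ h) n) ℤ.+ (tail f ⊛ (g ⊛ h)) n ∎
    where open ≡.≡-Reasoning

  ⊛-zeroˡ : ∀ f → 0ˢ ⊛ f ≗ 0ˢ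
  ⊛-zeroˡ f zero    = ≡.refl
  ⊛-zeroˡ f (suc n) = ≡.trans (ℤ.+-identityˡ _) (⊛-zeroˡ f n)

  ⊛-identityˡ : ∀ f → 1ˢ ⊛ f ≗ f
  ⊛-identityˡ f zero    = ℤ.*-identityˡ (f 0)
  ⊛-identityˡ f (suc n) = ≡.trans (≡.cong₂ ℤ._+_ (ℤ.*-identityˡ (f (suc n))) (⊛-zeroˡ f n)) (ℤ.+-identityʳ (f (suc n)))

  ⊛-identityʳ : ∀ f → f ⊛ 1ˢ ≗ f
  ⊛-identityʳ f n = ≡.trans (⊛-comm f 1ˢ n) (⊛-identityˡ f n)

  q⊛-suc : ∀ f n → (q ⊛ f) (suc n) ≡ f n
  q⊛-suc f n = ≡.trans (ℤ.+-identityˡ _) (⊛-identityˡ f n)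

  module _ (K : ℕ) where
    -- The elements remain full series and only equality is truncated, so one and the same
    -- generating function can be used for every K.
    _≈_ : Series → Series → Set
    f ≈ g = ∀ n → n ℕ.< K → f n ≡ g n

    private
      pointwise : ∀ {f g} → f ≗ g → f ≈ g
      pointwise e n _ = e n

    -- ℤ[[q]] / (q^K)
    truncated : CommutativeRing 0ℓ 0ℓ
    truncated = record
      { Carrier = Series
      ; _≈_ = _≈_
      ; _+_ = _⊕_
      ; _*_ = _⊛_
      ; -_ = λ f n → ℤ.- f n
      ; 0# = 0ˢ
      ; 1# = 1ˢ
      ; isCommutativeRing = record
        { isRing = record
          { +-isAbelianGroup = record
            { isGroup = record
              { isMonoid = record
                { isSemigroup = record
                  { isMagma = record
                    { isEquivalence = record
                      { refl = λ _ _ → ≡.refl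
                      ; sym = λ e n n<K → ≡.sym (e n n<K)
                      ; trans = λ d e n n<K → ≡.trans (d n n<K) (e n n<K)
                      }
                    ; ∙-cong = λ d e n n<K → ≡.cong₂ ℤ._+_ (d n n<K) (e n n<K)
                    }
                  ; assoc = λ f g h n _ → ℤ.+-assoc (f n) (g n) (h n)
                  }
                ; identity = (λ f n _ → ℤ.+-identityˡ (f n)) , (λ f n _ → ℤ.+-identityʳ (f n))
                }
              ; inverse = (λ f n _ → ℤ.+-inverseˡ (f n)) , (λ f n _ → ℤ.+-inverseʳ (f n))
              ; ⁻¹-cong = λ e n n<K → ≡.cong ℤ.-_ (e n n<K)
              }
            ; comm = λ f g n _ → ℤ.+-comm (f n) (g n)
            }
          ; *-cong = λ d e n n<K → ⊛-cong≤ n (λ i i≤n → d i (ℕ.≤-<-trans i≤n n<K)) (λ i i≤n → e i (ℕ.≤-<-trans i≤n n<K))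
          ; *-assoc = λ f g h → pointwise (⊛-assoc f g h)
          ; *-identity = (λ f → pointwise (⊛-identityˡ f)) , (λ f → pointwise (⊛-identityʳ f))
          ; distrib = (λ h f g n _ → ≡.trans (⊛-comm h (f ⊕ g) n) (≡.trans (⊛-distribʳ h f g n) (≡.cong₂ ℤ._+_ (⊛-comm f h n) (⊛-comm g h n))))
                    , (λ h f g → pointwise (⊛-distribʳ h f g))
          }
        ; *-comm = λ f g → pointwise (⊛-comm f g)
        }
      }

    private module T = CommutativeRing truncated
    open import Algebra.Properties.Semiring.Exp T.semiring using (_^_)

    q^-below : ∀ m g n → n ℕ.< m → (q ^ m ⊛ g) n ≡ + 0
    q^-below (suc m) g zero    _          = ≡.trans (≡.cong (ℤ._* g 0) (ℤ.*-zeroˡ ((q ^ m) 0))) (ℤ.*-zeroˡ (g 0))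
    q^-below (suc m) g (suc n) (ℕ.s≤s lt) = ≡.trans (⊛-assoc q (q ^ m) g (suc n)) (≡.trans (q⊛-suc (q ^ m ⊛ g) n) (q^-below m g n lt))

    q^-shift : ∀ m g n → (q ^ m ⊛ g) (m ℕ.+ n) ≡ g n
    q^-shift zero    g n = ⊛-identityˡ g n
    q^-shift (suc m) g n = ≡.trans (⊛-assoc q (q ^ m) g (suc (m ℕ.+ n))) (≡.trans (q⊛-suc (q ^ m ⊛ g) (m ℕ.+ n)) (q^-shift m g n))

    q-nilpotent : (q ^ K) ≈ 0ˢ
    q-nilpotent n n<K = ≡.trans (≡.sym (⊛-identityʳ (q ^ K) n)) (q^-below K 1ˢ n n<K)

    2-cancel : ∀ f g → ((1ˢ ⊕ 1ˢ) ⊛ f) ≈ ((1ˢ ⊕ 1ˢ) ⊛ g) → f ≈ g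
    2-cancel f g e n n<K = ℤ.*-cancelˡ-≡ (+ 2) (f n) (g n) (≡.trans (≡.sym (twice f)) (≡.trans (e n n<K) (twice g)))
      where
      twice : ∀ f → ((1ˢ ⊕ 1ˢ) ⊛ f) n ≡ + 2 ℤ.* f n
      twice f = ≡.trans (⊛-distribʳ f 1ˢ 1ˢ n) (≡.trans (≡.cong₂ ℤ._+_ (⊛-identityˡ f n) (⊛-identityˡ f n))
        (solve 1 (λ x → x :+ x := con (+ 2) :* x) ≡.refl (f n)))

-- Generating functions of partitions

module Counting (S : ℕ → Bool) where
  open ≡.≡-Reasoning

  count : List (List ℕ) → ℕ
  count πs = length (filter (λ π → all S π Bool.≟ true) πs)

  count-++ : ∀ πs ρs → count (πs ++ ρs) ≡ count πs ℕ.+ count ρs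
  count-++ πs ρs = ≡.trans (≡.cong length (List.filter-++ (λ π → all S π Bool.≟ true) πs ρs)) (List.length-++ (filter (λ π → all S π Bool.≟ true) πs))

  count-concatMap : ∀ (g : ℕ → List (List ℕ)) js → count (concatMap g js) ≡ sum (map (λ j → count (g j)) js)
  count-concatMap g []       = ≡.refl
  count-concatMap g (j ∷ js) = ≡.trans (count-++ (g j) (concatMap g js)) (≡.cong (count (g j) ℕ.+_) (count-concatMap g js))

  count-∷ : ∀ j πs → count (map (j ∷_) πs) ≡ (if S j then count πs else 0)
  count-∷ j [] with S j
  ... | true  = ≡.refl
  ... | false = ≡.refl
  count-∷ j (π ∷ πs) with S j | count-∷ j πs
  ... | false | e = e
  ... | true  | e with all S π
  ...   | true  = ≡.cong suc e
  ...   | false = e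

  module _ (N : ℕ) (h : ℕ → ℕ) where
    -- The list of first parts from `partsFuel`, with the length `m` detached from the bound `N` so
    -- that induction on `m` leaves both filters fixed.
    boundedList : ℕ → ℕ → List ℕ
    boundedList k m = filter (λ j → suc j ℕ.≤? k) (filter (λ j → suc j ℕ.≤? N) (upTo m))

    boundedSum : ℕ → ℕ → ℕ
    boundedSum k m = sum (map h (boundedList k m))

    private
      split : ∀ k m → boundedList k (suc m) ≡ boundedList k m ++ filter (λ j → suc j ℕ.≤? k) (filter (λ j → suc j ℕ.≤? N) [ m ])
      split k m = begin
        boundedList k (suc m)
          ≡⟨ ≡.cong (λ js → filter (λ j → suc j ℕ.≤? k) (filter (λ j → suc j ℕ.≤? N) js)) (List.upTo-∷ʳ m) ⟨
        filter (λ j → suc j ℕ.≤? k) (filter (λ j → suc j ℕ.≤? N) (upTo m ∷ʳ m))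
          ≡⟨ ≡.cong (filter (λ j → suc j ℕ.≤? k)) (List.filter-++ (λ j → suc j ℕ.≤? N) (upTo m) [ m ]) ⟩
        filter (λ j → suc j ℕ.≤? k) (filter (λ j → suc j ℕ.≤? N) (upTo m) ++ filter (λ j → suc j ℕ.≤? N) [ m ])
          ≡⟨ List.filter-++ (λ j → suc j ℕ.≤? k) (filter (λ j → suc j ℕ.≤? N) (upTo m)) _ ⟩
        boundedList k m ++ filter (λ j → suc j ℕ.≤? k) (filter (λ j → suc j ℕ.≤? N) [ m ]) ∎

      split-sum : ∀ k m → boundedSum k (suc m) ≡ boundedSum k m ℕ.+ sum (map h (filter (λ j → suc j ℕ.≤? k) (filter (λ j → suc j ℕ.≤? N) [ m ])))
      split-sum k m = ≡.trans (≡.cong (λ js → sum (map h js)) (split k m))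
        (≡.trans (≡.cong sum (List.map-++ h (boundedList k m) _)) (sum-++ (map h (boundedList k m)) _))

    boundedSum-in : ∀ {k m} → m ℕ.< k → m ℕ.< N → boundedSum k (suc m) ≡ boundedSum k m ℕ.+ h m
    boundedSum-in {k} {m} m<k m<N = ≡.trans (split-sum k m) (≡.cong (boundedSum k m ℕ.+_) (begin
      sum (map h (filter (λ j → suc j ℕ.≤? k) (filter (λ j → suc j ℕ.≤? N) [ m ])))
        ≡⟨ ≡.cong (λ js → sum (map h (filter (λ j → suc j ℕ.≤? k) js))) (List.filter-accept (λ j → suc j ℕ.≤? N) m<N) ⟩
      sum (map h (filter (λ j → suc j ℕ.≤? k) [ m ]))
        ≡⟨ ≡.cong (λ js → sum (map h js)) (List.filter-accept (λ j → suc j ℕ.≤? k) m<k) ⟩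
      h m ℕ.+ 0
        ≡⟨ ℕ.+-identityʳ (h m) ⟩
      h m ∎))

    boundedSum-out : ∀ {k m} → k ℕ.≤ m → m ℕ.< N → boundedSum k (suc m) ≡ boundedSum k m
    boundedSum-out {k} {m} k≤m m<N = ≡.trans (split-sum k m) (≡.trans (≡.cong (boundedSum k m ℕ.+_) (begin
      sum (map h (filter (λ j → suc j ℕ.≤? k) (filter (λ j → suc j ℕ.≤? N) [ m ])))
        ≡⟨ ≡.cong (λ js → sum (map h (filter (λ j → suc j ℕ.≤? k) js))) (List.filter-accept (λ j → suc j ℕ.≤? N) m<N) ⟩
      sum (map h (filter (λ j → suc j ℕ.≤? k) [ m ]))
        ≡⟨ ≡.cong (λ js → sum (map h js)) (List.filter-reject (λ j → suc j ℕ.≤? k) (ℕ.≤⇒≯ k≤m)) ⟩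
      0 ∎)) (ℕ.+-identityʳ _))

    boundedSum-saturated : ∀ {k m} → m ℕ.≤ k → m ℕ.≤ N → boundedSum (suc k) m ≡ boundedSum k m
    boundedSum-saturated {k} {zero}  _   _   = ≡.refl
    boundedSum-saturated {k} {suc m} m<k m<N = begin
      boundedSum (suc k) (suc m)    ≡⟨ boundedSum-in (ℕ.m≤n⇒m≤1+n m<k) m<N ⟩
      boundedSum (suc k) m ℕ.+ h m  ≡⟨ ≡.cong (ℕ._+ h m) (boundedSum-saturated (ℕ.<⇒≤ m<k) (ℕ.<⇒≤ m<N)) ⟩
      boundedSum k m ℕ.+ h m        ≡⟨ boundedSum-in m<k m<N ⟨
      boundedSum k (suc m) ∎

    boundedSum-suc : ∀ {k} m → k ℕ.< m → m ℕ.≤ N → boundedSum (suc k) m ≡ boundedSum k m ℕ.+ h k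
    boundedSum-suc {k} (suc m) (ℕ.s≤s k≤m) m<N with k ℕ.≟ m
    ... | yes ≡.refl = begin
      boundedSum (suc k) (suc k)    ≡⟨ boundedSum-in (ℕ.n<1+n k) m<N ⟩
      boundedSum (suc k) k ℕ.+ h k  ≡⟨ ≡.cong (ℕ._+ h k) (boundedSum-saturated ℕ.≤-refl (ℕ.<⇒≤ m<N)) ⟩
      boundedSum k k ℕ.+ h k        ≡⟨ ≡.cong (ℕ._+ h k) (boundedSum-out ℕ.≤-refl m<N) ⟨
      boundedSum k (suc k) ℕ.+ h k  ∎
    ... | no k≢m = begin
      boundedSum (suc k) (suc m)    ≡⟨ boundedSum-out (ℕ.≤∧≢⇒< k≤m k≢m) m<N ⟩
      boundedSum (suc k) m          ≡⟨ boundedSum-suc m (ℕ.≤∧≢⇒< k≤m k≢m) (ℕ.<⇒≤ m<N) ⟩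
      boundedSum k m ℕ.+ h k        ≡⟨ ≡.cong (ℕ._+ h k) (boundedSum-out k≤m m<N) ⟨
      boundedSum k (suc m) ℕ.+ h k  ∎

  partsFuel-enough : ∀ {f f′} k n → n ℕ.≤ f → n ℕ.≤ f′ → partsFuel f k n ≡ partsFuel f′ k n
  partsFuel-enough k zero    _ _ = ≡.refl
  partsFuel-enough {suc f} {suc f′} k (suc n) (ℕ.s≤s n≤f) (ℕ.s≤s n≤f′) =
    List.concatMap-cong (λ j → ≡.cong (map (suc j ∷_))
      (partsFuel-enough (suc j) (n ℕ.∸ j) (ℕ.≤-trans (ℕ.m∸n≤m n j) n≤f) (ℕ.≤-trans (ℕ.m∸n≤m n j) n≤f′)))
      (filter (λ j → suc j ℕ.≤? k) (filter (λ j → suc j ℕ.≤? suc n) (upTo (suc n))))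

  c : ℕ → ℕ → ℕ
  c k n = count (partsFuel n k n)

  firstPart : ℕ → ℕ → ℕ
  firstPart n j = if S (suc j) then c (suc j) (n ℕ.∸ j) else 0

  c-sum : ∀ k n → c k (suc n) ≡ boundedSum (suc n) (firstPart n) k (suc n)
  c-sum k n = ≡.trans
    (count-concatMap _ (boundedList (suc n) (firstPart n) k (suc n)))
    (≡.cong sum (List.map-cong entry (boundedList (suc n) (firstPart n) k (suc n))))
    where
    entry : ∀ j → count (map (suc j ∷_) (partsFuel n (suc j) (n ℕ.∸ j))) ≡ firstPart n j
    entry j = ≡.trans (count-∷ (suc j) (partsFuel n (suc j) (n ℕ.∸ j)))
      (≡.cong (λ πs → if S (suc j) then count πs else 0) (partsFuel-enough (suc j) (n ℕ.∸ j) (ℕ.m∸n≤m n j) ℕ.≤-refl))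

  c-large : ∀ k n → n ℕ.≤ k → c (suc k) n ≡ c k n
  c-large k zero    _   = ≡.refl
  c-large k (suc n) n<k = ≡.trans (c-sum (suc k) n)
    (≡.trans (boundedSum-saturated (suc n) (firstPart n) n<k ℕ.≤-refl) (≡.sym (c-sum k n)))

  -- The lists are non-increasing, so the first part is the largest. Either it is at most k, or it
  -- is k + 1, and removing it leaves a partition of n with parts at most k + 1.
  c-step : ∀ k n → c (suc k) (suc k ℕ.+ n) ≡ c k (suc k ℕ.+ n) ℕ.+ (if S (suc k) then c (suc k) n else 0)
  c-step k n = begin
    c (suc k) (suc k ℕ.+ n)
      ≡⟨ c-sum (suc k) (k ℕ.+ n) ⟩
    boundedSum (suc (k ℕ.+ n)) (firstPart (k ℕ.+ n)) (suc k) (suc (k ℕ.+ n))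
      ≡⟨ boundedSum-suc _ _ (suc (k ℕ.+ n)) (ℕ.s≤s (ℕ.m≤m+n k n)) ℕ.≤-refl ⟩
    boundedSum (suc (k ℕ.+ n)) (firstPart (k ℕ.+ n)) k (suc (k ℕ.+ n)) ℕ.+ firstPart (k ℕ.+ n) k
      ≡⟨ ≡.cong₂ ℕ._+_ (≡.sym (c-sum k (k ℕ.+ n))) (≡.cong (λ r → if S (suc k) then c (suc k) r else 0) (ℕ.m+n∸m≡n k n)) ⟩
    c k (suc k ℕ.+ n) ℕ.+ (if S (suc k) then c (suc k) n else 0) ∎

  c-stable : ∀ j n → c (j ℕ.+ n) n ≡ p S n
  c-stable zero    n = ≡.refl
  c-stable (suc j) n = ≡.trans (c-large (j ℕ.+ n) n (ℕ.m≤n+m n j)) (c-stable j n)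

  c-zero : ∀ n → c 0 (suc n) ≡ 0
  c-zero n = ≡.trans (c-sum 0 n) (empty (suc n) ℕ.≤-refl)
    where
    empty : ∀ m → m ℕ.≤ suc n → boundedSum (suc n) (firstPart n) 0 m ≡ 0
    empty zero    _   = ≡.refl
    empty (suc m) m<N = ≡.trans (boundedSum-out (suc n) (firstPart n) ℕ.z≤n m<N) (empty m (ℕ.<⇒≤ m<N))

  module GeneratingFunction (K : ℕ) where
    open PowerSeries
    open CommutativeRing (truncated K)
      using (_-_; -_; trans; sym; *-congʳ; *-identityʳ; *-assoc; *-comm; *-congˡ; semiring; ring; +-congˡ; distribʳ)
    open import Algebra.Properties.Semiring.Exp semiring using (_^_)
    open Products (truncated K) using (Π<)
    open import Algebra.Properties.Ring ring using (-‿distribˡ-*)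

    factor : ℕ → Series
    factor i = if S i then 1ˢ - q ^ i else 1ˢ

    series : ℕ → Series
    series k n = + c k n

    gf : Series
    gf n = + p S n

    series-0 : _≈_ K (series 0) 1ˢ
    series-0 zero    _ = ≡.refl
    series-0 (suc n) _ = ≡.cong +_ (c-zero n)

    -- If k + 1 belongs to S this is `c-step` read coefficientwise; in degrees below k + 1 the new
    -- part does not fit and the two counts agree.
    series-suc : ∀ k → _≈_ K (series (suc k) ⊛ factor (suc k)) (series k)
    series-suc k with S (suc k) | c-step k
    ... | false | step = trans (*-identityʳ (series (suc k))) (λ n _ → ≡.cong +_ (same n))
      where
      same : ∀ n → c (suc k) n ≡ c k n
      same n with suc k ℕ.≤? n
      ... | no  k≮n = c-large k n (ℕ.≮⇒≥ k≮n)
      ... | yes k<n = ≡.subst (λ m → c (suc k) m ≡ c k m) (ℕ.m+[n∸m]≡n k<n) (≡.trans (step (n ℕ.∸ suc k)) (ℕ.+-identityʳ _))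
    ... | true  | step = trans (*-comm (series (suc k)) (1ˢ - q ^ suc k))
        (trans (distribʳ (series (suc k)) 1ˢ (- (q ^ suc k)))
        (trans (λ n _ → ≡.cong₂ ℤ._+_ (⊛-identityˡ (series (suc k)) n) ≡.refl)
        (trans (+-congˡ {series (suc k)} (sym (-‿distribˡ-* (q ^ suc k) (series (suc k))))) (λ n _ → coefficient n))))
      where
      coefficient : ∀ n → + c (suc k) n ℤ.- (q ^ suc k ⊛ series (suc k)) n ≡ + c k n
      coefficient n with suc k ℕ.≤? n
      ... | no  k≮n = ≡.trans (≡.cong (λ z → + c (suc k) n ℤ.- z) (q^-below K (suc k) (series (suc k)) n (ℕ.≰⇒> k≮n)))
              (≡.trans (ℤ.+-identityʳ _) (≡.cong +_ (c-large k n (ℕ.≮⇒≥ k≮n))))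
      ... | yes k<n = ≡.subst (λ m → + c (suc k) m ℤ.- (q ^ suc k ⊛ series (suc k)) m ≡ + c k m) (ℕ.m+[n∸m]≡n k<n)
              (≡.trans (≡.cong₂ ℤ._-_ (≡.cong +_ (step (n ℕ.∸ suc k))) (q^-shift K (suc k) (series (suc k)) (n ℕ.∸ suc k)))
                (i+j-j≡i (+ c k (suc k ℕ.+ (n ℕ.∸ suc k))) (+ c (suc k) (n ℕ.∸ suc k))))

    series-Π : ∀ k → _≈_ K (series k ⊛ Π< k (λ i → factor (suc i))) 1ˢ
    series-Π zero    = trans (*-identityʳ (series 0)) series-0
    series-Π (suc k) = trans (*-congˡ {series (suc k)} (*-comm (Π< k (λ i → factor (suc i))) (factor (suc k))))
      (trans (sym (*-assoc (series (suc k)) (factor (suc k)) (Π< k (λ i → factor (suc i)))))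
      (trans (*-congʳ {Π< k (λ i → factor (suc i))} (series-suc k)) (series-Π k)))

    -- A partition of n < K has no part above L, so `series L` and `gf` agree in the degrees that
    -- count.
    gf-Π : ∀ L → K ℕ.≤ L → _≈_ K (gf ⊛ Π< L (λ i → factor (suc i))) 1ˢ
    gf-Π L K≤L = trans (*-congʳ {Π< L (λ i → factor (suc i))} (λ n n<K → ≡.cong +_ (≡.sym (≡.trans
      (≡.cong (λ m → c m n) (≡.sym (ℕ.m∸n+n≡m (ℕ.≤-trans (ℕ.<⇒≤ n<K) K≤L)))) (c-stable (L ℕ.∸ n) n))))) (series-Π L)

-- Products mod 28 and mod 56

sort : List ℕ → List ℕ
sort = sortBy ℕ.≤-decTotalOrder

-- The residues mod 56 whose products make up [a;28] and [2a;56].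
residues doubled : ℕ → List ℕ
residues a = a ∷ a ℕ.+ 28 ∷ 28 ℕ.∸ a ∷ (28 ℕ.∸ a) ℕ.+ 28 ∷ []
doubled a = a ℕ.+ a ∷ (28 ℕ.∸ a) ℕ.+ (28 ℕ.∸ a) ∷ []

selected : (ℕ → Bool) → ℕ → List ℕ
selected b zero    = []
selected b (suc n) = if b (suc n) then suc n ∷ selected b n else selected b n

module ThetaProducts (R : CommutativeRing 0ℓ 0ℓ) (K : ℕ) (q : CommutativeRing.Carrier R)
  (q-null : Theta.Null R K q) where
  open CommutativeRing R
  open Theta R K
  open ThetaIdentities R K
  open Products R
  open JacobiTripleProduct R K
  open import Relation.Binary.Reasoning.Setoid setoid
  open import Algebra.Properties.Ring ring
  open import Algebra.Properties.Semiring.Exp semiring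
  open import Algebra.Solver.Ring.NaturalCoefficients.Default commutativeSemiring
    using (solve; _:=_; _:+_; _:*_; con)

  q^-null : ∀ {a} → 1 ℕ.≤ a → Null (q ^ a)
  q^-null {suc a} _ = Null-power a q-null

  q^-vanish : ∀ {a} → K ℕ.≤ a → q ^ a ≈ 0#
  q^-vanish = power-null q-null

  q^-* : ∀ a b {x y} → x ≈ q ^ a → y ≈ q ^ b → x * y ≈ q ^ (a ℕ.+ b)
  q^-* a b x≈ y≈ = trans (*-cong x≈ y≈) (sym (^-homo-* q a b))

  -- The infinite products (q^a; q^M) and (-q^a; q^M): for M > 0 the factors with l at least K are
  -- equal to 1.
  pr pb : ℕ → ℕ → Carrier
  pr M a = Π< K (λ l → 1# - q ^ (a ℕ.+ l ℕ.* M))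
  pb M a = Π< K (λ l → 1# + q ^ (a ℕ.+ l ℕ.* M))

  J : ℕ → Carrier
  J M = pr M M

  Unit-pr : ∀ M {a} → 1 ℕ.≤ a → Unit (pr M a)
  Unit-pr M {a} 1≤a = Unit-Π< K (λ l → Unit-1-null (q^-null (ℕ.≤-trans 1≤a (ℕ.m≤m+n a (l ℕ.* M)))))

  private
    power-index : ∀ {m} M l → m ≈ q ^ M → m ^ l ≈ q ^ (l ℕ.* M)
    power-index M l e = trans (^-congˡ l e) (trans (^-assocʳ q M l) (^-congʳ q (ℕ.*-comm M l)))

    euler-J : ∀ {m} M → m ≈ q ^ M → euler m K ≈ J M
    euler-J M e = Π<-cong K (λ l → +-congˡ (-‿cong (power-index M (suc l) e)))

  f-product⁻ : ∀ a b {M} → a ℕ.+ b ≡ M → 1 ℕ.≤ M → f (- q ^ a) (- q ^ b) ≈ pr M a * pr M b * J M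
  f-product⁻ a b {M} ≡.refl 1≤M = trans (triple-product _ _ (Null-resp (sym m≈) (q^-null 1≤M)))
    (*-cong (*-cong (Π<-cong K (factor a)) (Π<-cong K (factor b))) (euler-J M m≈))
    where
    m≈ : - q ^ a * - q ^ b ≈ q ^ (a ℕ.+ b)
    m≈ = trans (-x*-y≈x*y _ _) (sym (^-homo-* q a b))
    factor : ∀ c l → 1# + - q ^ c * (- q ^ a * - q ^ b) ^ l ≈ 1# - q ^ (c ℕ.+ l ℕ.* M)
    factor c l = +-congˡ (trans (sym (-‿distribˡ-* _ _)) (-‿cong (q^-* c (l ℕ.* M) refl (power-index M l m≈))))

  f-product⁺ : ∀ a b {M} → a ℕ.+ b ≡ M → 1 ℕ.≤ M → f (q ^ a) (q ^ b) ≈ pb M a * pb M b * J M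
  f-product⁺ a b {M} ≡.refl 1≤M = trans (triple-product _ _ (Null-resp (sym m≈) (q^-null 1≤M)))
    (*-cong (*-cong (Π<-cong K (factor a)) (Π<-cong K (factor b))) (euler-J M m≈))
    where
    m≈ : q ^ a * q ^ b ≈ q ^ (a ℕ.+ b)
    m≈ = sym (^-homo-* q a b)
    factor : ∀ c l → 1# + q ^ c * (q ^ a * q ^ b) ^ l ≈ 1# + q ^ (c ℕ.+ l ℕ.* M)
    factor c l = +-congˡ (q^-* c (l ℕ.* M) refl (power-index M l m≈))

  1-x*1+x : ∀ x → (1# - x) * (1# + x) ≈ 1# - x * x
  1-x*1+x x = begin
    (1# - x) * (1# + x)          ≈⟨ solve 2 (λ x n → (con 1 :+ n) :* (con 1 :+ x) := con 1 :+ n :* x :+ (n :+ x)) refl x (- x) ⟩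
    1# + - x * x + (- x + x)     ≈⟨ +-cong (+-congˡ (sym (-‿distribˡ-* x x))) (-‿inverseˡ x) ⟩
    1# - x * x + 0#              ≈⟨ +-identityʳ _ ⟩
    1# - x * x                   ∎

  pr*pb : ∀ M a → pr M a * pb M a ≈ pr (M ℕ.+ M) (a ℕ.+ a)
  pr*pb M a = trans (sym (Π<-* K _ _)) (Π<-cong K (λ l → trans (1-x*1+x _)
    (+-congˡ (-‿cong (trans (sym (^-homo-* q (a ℕ.+ l ℕ.* M) _)) (^-congʳ q (index l)))))))
    where
    open ℕS.+-*-Solver using () renaming (solve to solveℕ; _:=_ to _≔_; _:+_ to _⊕_; _:*_ to _⊗_)
    index : ∀ l → (a ℕ.+ l ℕ.* M) ℕ.+ (a ℕ.+ l ℕ.* M) ≡ (a ℕ.+ a) ℕ.+ l ℕ.* (M ℕ.+ M)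
    index l = solveℕ 3 (λ a l M → (a ⊕ l ⊗ M) ⊕ (a ⊕ l ⊗ M) ≔ (a ⊕ a) ⊕ l ⊗ (M ⊕ M)) ≡.refl a l M

  private
    index-large : ∀ a M l → 1 ℕ.≤ M → K ℕ.≤ l → K ℕ.≤ a ℕ.+ l ℕ.* M
    index-large a M l 1≤M K≤l = ℕ.≤-trans K≤l (ℕ.≤-trans (ℕ.≤-reflexive (≡.sym (ℕ.*-identityʳ l)))
      (ℕ.≤-trans (ℕ.*-monoʳ-≤ l 1≤M) (ℕ.m≤n+m (l ℕ.* M) a)))

  -- The product is first lengthened to 2K factors, so that its even and odd places again provide K
  -- factors each.
  pr-refine : ∀ M a → 1 ℕ.≤ M → pr M a ≈ pr (M ℕ.+ M) a * pr (M ℕ.+ M) (a ℕ.+ M)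
  pr-refine M a 1≤M = begin
    pr M a
      ≈⟨ Π<-stable K (λ l K≤l → trans (+-congˡ (trans (-‿cong (q^-vanish (index-large a M l 1≤M K≤l))) -0#≈0#)) (+-identityʳ 1#)) (ℕ.m≤m+n K K) ⟨
    Π< (K ℕ.+ K) (λ l → 1# - q ^ (a ℕ.+ l ℕ.* M))
      ≈⟨ Π<-parity K _ ⟩
    Π< K (λ l → 1# - q ^ (a ℕ.+ (l ℕ.+ l) ℕ.* M)) * Π< K (λ l → 1# - q ^ (a ℕ.+ suc (l ℕ.+ l) ℕ.* M))
      ≈⟨ *-cong (Π<-cong K (λ l → +-congˡ (-‿cong (^-congʳ q (even l))))) (Π<-cong K (λ l → +-congˡ (-‿cong (^-congʳ q (odd l))))) ⟩
    pr (M ℕ.+ M) a * pr (M ℕ.+ M) (a ℕ.+ M) ∎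
    where
    open ℕS.+-*-Solver using () renaming (solve to solveℕ; _:=_ to _≔_; _:+_ to _⊕_; _:*_ to _⊗_; con to ⟨_⟩)
    even : ∀ l → a ℕ.+ (l ℕ.+ l) ℕ.* M ≡ a ℕ.+ l ℕ.* (M ℕ.+ M)
    even l = solveℕ 3 (λ a l M → a ⊕ (l ⊕ l) ⊗ M ≔ a ⊕ l ⊗ (M ⊕ M)) ≡.refl a l M
    odd : ∀ l → a ℕ.+ suc (l ℕ.+ l) ℕ.* M ≡ (a ℕ.+ M) ℕ.+ l ℕ.* (M ℕ.+ M)
    odd l = solveℕ 3 (λ a l M → a ⊕ (⟨ 1 ⟩ ⊕ (l ⊕ l)) ⊗ M ≔ (a ⊕ M) ⊕ l ⊗ (M ⊕ M)) ≡.refl a l M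

  -- The factor at l = 0 is 1 + q^0 = 2. Appending the factor at l = K, which is 1, keeps the number
  -- of remaining factors at K.
  pb-0 : ∀ M → 1 ℕ.≤ M → pb M 0 ≈ 2# * pb M M
  pb-0 M 1≤M = begin
    pb M 0
      ≈⟨ *-identityʳ _ ⟨
    pb M 0 * 1#
      ≈⟨ *-congˡ (trans (+-congˡ (q^-vanish (index-large 0 M K 1≤M ℕ.≤-refl))) (+-identityʳ 1#)) ⟨
    Π< (suc K) (λ l → 1# + q ^ (0 ℕ.+ l ℕ.* M))
      ≈⟨ Π<-front K _ ⟩
    2# * pb M M ∎

  -- Once the factor 2 is removed, two copies of `pb M M` and one of `J M` remain. The additional
  -- `J M` gives each copy a partner, and (1 - x)(1 + x) = 1 - x² doubles the modulus.
  f-1 : ∀ M → 1 ℕ.≤ M → f (q ^ 0) (q ^ M) * J M ≈ 2# * (J (M ℕ.+ M) * J (M ℕ.+ M))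
  f-1 M 1≤M = begin
    f (q ^ 0) (q ^ M) * J M
      ≈⟨ *-congʳ (f-product⁺ 0 M ≡.refl 1≤M) ⟩
    pb M 0 * pb M M * J M * J M
      ≈⟨ *-congʳ (*-congʳ (*-congʳ (pb-0 M 1≤M))) ⟩
    2# * pb M M * pb M M * J M * J M
      ≈⟨ solve 3 (λ t p j → t :* p :* p :* j :* j := t :* ((j :* p) :* (j :* p))) refl 2# (pb M M) (J M) ⟩
    2# * ((J M * pb M M) * (J M * pb M M))
      ≈⟨ *-congˡ (*-cong (pr*pb M M) (pr*pb M M)) ⟩
    2# * (J (M ℕ.+ M) * J (M ℕ.+ M)) ∎

  Πˡ : (ℕ → Carrier) → List ℕ → Carrier
  Πˡ h []       = 1#
  Πˡ h (a ∷ as) = h a * Πˡ h as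

  Πˡ-++ : ∀ h as bs → Πˡ h (as ++ bs) ≈ Πˡ h as * Πˡ h bs
  Πˡ-++ h []       bs = sym (*-identityˡ _)
  Πˡ-++ h (a ∷ as) bs = trans (*-congˡ (Πˡ-++ h as bs)) (sym (*-assoc _ _ _))

  Πˡ-insert : ∀ h a as → Πˡ h (insertBy ℕ.≤-decTotalOrder a as) ≈ h a * Πˡ h as
  Πˡ-insert h a []       = refl
  Πˡ-insert h a (b ∷ bs) with does (a ℕ.≤? b)
  ... | true  = refl
  ... | false = trans (*-congˡ (Πˡ-insert h a bs)) (solve 3 (λ a b c → b :* (a :* c) := a :* (b :* c)) refl _ _ _)

  Πˡ-sort : ∀ h as → Πˡ h (sort as) ≈ Πˡ h as
  Πˡ-sort h []       = refl
  Πˡ-sort h (a ∷ as) = trans (Πˡ-insert h a (sort as)) (*-congˡ (Πˡ-sort h as))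

  -- Comparing sorted lists turns equality of multisets into a computation: for closed lists the
  -- hypothesis holds by reflexivity.
  Πˡ-permute : ∀ h as bs → sort as ≡ sort bs → Πˡ h as ≈ Πˡ h bs
  Πˡ-permute h as bs e = trans (sym (Πˡ-sort h as)) (trans (reflexive (≡.cong (Πˡ h) e)) (Πˡ-sort h bs))

  Πˡ-* : ∀ h k as → Πˡ (λ a → h a * k a) as ≈ Πˡ h as * Πˡ k as
  Πˡ-* h k []       = sym (*-identityʳ 1#)
  Πˡ-* h k (a ∷ as) = trans (*-congˡ (Πˡ-* h k as))
    (solve 4 (λ a b c d → (a :* b) :* (c :* d) := (a :* c) :* (b :* d)) refl _ _ _ _)

  Πˡ-concatMap : ∀ h (g : ℕ → List ℕ) as → Πˡ h (concatMap g as) ≈ Πˡ (λ a → Πˡ h (g a)) as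
  Πˡ-concatMap h g []       = refl
  Πˡ-concatMap h g (a ∷ as) = trans (Πˡ-++ h (g a) (concatMap g as)) (*-congˡ (Πˡ-concatMap h g as))

  Πˡ-cong : ∀ {h k} as → (∀ a → h a ≈ k a) → Πˡ h as ≈ Πˡ k as
  Πˡ-cong []       e = refl
  Πˡ-cong (a ∷ as) e = *-cong (e a) (Πˡ-cong as e)

  -- PM a = [a;28] and PB a = [-a;28] for 0 < a < 28.
  PM PB : ℕ → Carrier
  PM a = pr 28 a * pr 28 (28 ℕ.∸ a)
  PB a = pb 28 a * pb 28 (28 ℕ.∸ a)

  P : List ℕ → Carrier
  P = Πˡ (pr 56)

  PM-residues : ∀ a → PM a ≈ P (residues a)
  PM-residues a = trans (*-cong (pr-refine 28 a (ℕ.s≤s ℕ.z≤n)) (pr-refine 28 (28 ℕ.∸ a) (ℕ.s≤s ℕ.z≤n)))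
    (solve 4 (λ a b c d → (a :* b) :* (c :* d) := a :* (b :* (c :* (d :* con 1)))) refl _ _ _ _)

  PM*PB : ∀ a → PM a * PB a ≈ P (doubled a)
  PM*PB a = trans (solve 4 (λ a b c d → (a :* b) :* (c :* d) := (a :* c) :* (b :* d :* con 1)) refl _ _ _ _)
    (*-cong (pr*pb 28 a) (trans (*-congʳ (pr*pb 28 (28 ℕ.∸ a))) refl))

  PMs-residues : ∀ as → Πˡ PM as ≈ P (concatMap residues as)
  PMs-residues as = trans (Πˡ-cong as PM-residues) (sym (Πˡ-concatMap (pr 56) residues as))

  PMs*PBs : ∀ as → Πˡ PM as * Πˡ PB as ≈ P (concatMap doubled as)
  PMs*PBs as = trans (sym (Πˡ-* PM PB as)) (trans (Πˡ-cong as PM*PB) (sym (Πˡ-concatMap (pr 56) doubled as)))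

  Unit-P : ∀ {as} → All (1 ℕ.≤_) as → Unit (P as)
  Unit-P []       = 1# , *-identityʳ 1#
  Unit-P (p ∷ ps) = Unit-* (Unit-pr 56 p) (Unit-P ps)

  -- Cut the product into K blocks of length 56 and interchange the two products. Index i stands for
  -- the part i + 1, so the classes are represented by 1, ..., 56. The multiples of 56 have the
  -- representative 56; with 0 there would be a factor 1 - q^0 = 0.
  P-selected : ∀ (b : ℕ → Bool) → (∀ r i → b (suc r ℕ.+ i ℕ.* 56) ≡ b (suc r)) →
    Π< (K ℕ.* 56) (λ i → if b (suc i) then 1# - q ^ suc i else 1#) ≈ P (selected b 56)
  P-selected b periodic = begin
    Π< (K ℕ.* 56) factor
      ≈⟨ Π<-blocks K 56 factor ⟩
    Π< K (λ i → Π< 56 (λ r → factor (r ℕ.+ i ℕ.* 56)))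
      ≈⟨ Π<-swap K 56 (λ i r → factor (r ℕ.+ i ℕ.* 56)) ⟩
    Π< 56 (λ r → Π< K (λ i → factor (r ℕ.+ i ℕ.* 56)))
      ≈⟨ Π<-cong 56 class ⟩
    Π< 56 (λ r → if b (suc r) then pr 56 (suc r) else 1#)
      ≈⟨ collect-selected 56 ⟩
    P (selected b 56) ∎
    where
    factor : ℕ → Carrier
    factor i = if b (suc i) then 1# - q ^ suc i else 1#
    class : ∀ r → Π< K (λ i → factor (r ℕ.+ i ℕ.* 56)) ≈ (if b (suc r) then pr 56 (suc r) else 1#)
    class r = trans (Π<-cong K (λ i → reflexive (≡.cong (λ t → if t then 1# - q ^ (suc r ℕ.+ i ℕ.* 56) else 1#) (periodic r i)))) constant
      where
      constant : Π< K (λ i → if b (suc r) then 1# - q ^ (suc r ℕ.+ i ℕ.* 56) else 1#) ≈ (if b (suc r) then pr 56 (suc r) else 1#)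
      constant with b (suc r)
      ... | true  = refl
      ... | false = Π<-1 K (λ _ → refl)
    collect-selected : ∀ n → Π< n (λ r → if b (suc r) then pr 56 (suc r) else 1#) ≈ P (selected b n)
    collect-selected zero    = refl
    collect-selected (suc n) with b (suc n)
    ... | true  = trans (*-comm _ _) (*-congˡ (collect-selected n))
    ... | false = trans (*-identityʳ _) (collect-selected n)

-- The theta formulas as identities between products mod 28 and mod 56

module ProductIdentities (R : CommutativeRing 0ℓ 0ℓ) (K : ℕ) (q : CommutativeRing.Carrier R)
  (q-null : Theta.Null R K q) where
  open CommutativeRing R
  open Theta R K
  open ThetaIdentities R K
  open Products R
  open ThetaProducts R K q q-null
  open import Relation.Binary.Reasoning.Setoid setoid
  open import Algebra.Properties.Ring ring
  open import Algebra.Properties.Semiring.Exp semiring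
  open import Algebra.Solver.Ring.NaturalCoefficients.Default commutativeSemiring
    using (solve; _:=_; _:+_; _:*_; con)

  -- By `f-1`, f(1, q^28) times `J 28` is 2 X.
  J² X : Carrier
  J² = J 28 * J 28
  X  = J 56 * J 56

  Unit-X : Unit X
  Unit-X = Unit-* (Unit-pr 56 {56} (ℕ.s≤s ℕ.z≤n)) (Unit-pr 56 {56} (ℕ.s≤s ℕ.z≤n))

  private
    Unit-J : Unit (J 28)
    Unit-J = Unit-pr 28 {28} (ℕ.s≤s ℕ.z≤n)

    complement : ∀ a {b} → a ℕ.+ b ≡ 28 → b ≡ 28 ℕ.∸ a
    complement a {b} e = ≡.trans (≡.sym (ℕ.m+n∸m≡n a b)) (≡.cong (ℕ._∸ a) e)

    θ⁻ : ∀ a b {u v} → u ≈ q ^ a → v ≈ q ^ b → a ℕ.+ b ≡ 28 → f (- u) (- v) ≈ PM a * J 28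
    θ⁻ a b u≈ v≈ e = trans (f-cong (-‿cong u≈) (-‿cong v≈))
      (trans (f-product⁻ a b e (ℕ.s≤s ℕ.z≤n)) (*-congʳ (*-congˡ (reflexive (≡.cong (pr 28) (complement a e))))))

    θ⁺ : ∀ a b {u v} → u ≈ q ^ a → v ≈ q ^ b → a ℕ.+ b ≡ 28 → f u v ≈ PB a * J 28
    θ⁺ a b u≈ v≈ e = trans (f-cong u≈ v≈)
      (trans (f-product⁺ a b e (ℕ.s≤s ℕ.z≤n)) (*-congʳ (*-congˡ (reflexive (≡.cong (pb 28) (complement a e))))))

    θ₅₆ : ∀ a b {u v} → u ≈ q ^ a → v ≈ q ^ b → a ℕ.+ b ≡ 56 → f (- u) (- v) ≈ pr 56 a * pr 56 b * J 56
    θ₅₆ a b u≈ v≈ e = trans (f-cong (-‿cong u≈) (-‿cong v≈)) (f-product⁻ a b e (ℕ.s≤s ℕ.z≤n))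

    f-1-28 : ∀ {n v} → v ≈ q ^ n → n ≡ 28 → f 1# v * J 28 ≈ 2# * X
    f-1-28 v≈ ≡.refl = trans (*-congʳ (f-cong refl v≈)) (f-1 28 (ℕ.s≤s ℕ.z≤n))

    collect : ∀ a b c d j → (a * j * (b * j)) * (c * j * (d * j)) ≈ (a * (b * (c * (d * 1#)))) * (j * j * (j * j))
    collect = solve 5 (λ a b c d j → (a :* j :* (b :* j)) :* (c :* j :* (d :* j)) := (a :* (b :* (c :* (d :* con 1)))) :* (j :* j :* (j :* j))) refl

    collect₃ : ∀ z a b c j → j * ((z * (a * j)) * (b * j * (c * j))) ≈ (j * j * j) * ((z * j) * (a * (b * (c * 1#))))
    collect₃ = solve 5 (λ z a b c j → j :* ((z :* (a :* j)) :* (b :* j :* (c :* j))) := (j :* j :* j) :* ((z :* j) :* (a :* (b :* (c :* con 1))))) refl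

    open ℕS.+-*-Solver using () renaming (solve to solveℕ; _:=_ to _≔_; _:+_ to _⊕_)

  module _ (y g d h : ℕ) where
    private
      x z : ℕ
      x = y ℕ.+ g
      z = d ℕ.+ h
      quad : List ℕ
      quad = x ∷ y ∷ z ∷ d ∷ []

    -- `quartic-sum` at powers of q. The factor J³ balances the Euler products: the four thetas on
    -- the left carry J⁴, f(1, q^28) needs one more J to become 2X, and the three other thetas on
    -- the right carry J³. The coefficients `1#` are kept so that all theta formulas have the shape
    -- expected by `eliminate`.
    product-sum : x ℕ.+ y ℕ.+ (z ℕ.+ d) ≡ 28 →
      J² * (Πˡ PM quad + 1# * Πˡ PB quad) ≈ 2# * X * (1# * Πˡ PB (x ℕ.+ y ∷ x ℕ.+ d ∷ y ℕ.+ d ∷ []))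
    product-sum e = cancelˡ (Unit-* (Unit-* Unit-J Unit-J) Unit-J) (begin
      J³ * (J² * (Πˡ PM quad + 1# * Πˡ PB quad))
        ≈⟨ solve 3 (λ j m b → (j :* j :* j) :* ((j :* j) :* (m :+ con 1 :* b)) := j :* (m :* (j :* j :* (j :* j)) :+ b :* (j :* j :* (j :* j)))) refl (J 28) _ _ ⟩
      J 28 * (Πˡ PM quad * (J² * J²) + Πˡ PB quad * (J² * J²))
        ≈⟨ *-congˡ (+-cong
             (trans (sym (collect _ _ _ _ _)) (sym (*-cong (*-cong (θ⁻ x (y ℕ.+ (z ℕ.+ d)) Xp Yp e₁) (θ⁻ y (x ℕ.+ (z ℕ.+ d)) refl Xq e₂)) (*-cong (θ⁻ z (d ℕ.+ (x ℕ.+ y)) Zp Dp e₃) (θ⁻ d (z ℕ.+ (x ℕ.+ y)) refl Zq e₄)))))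
             (trans (sym (collect _ _ _ _ _)) (sym (*-cong (*-cong (θ⁺ x (y ℕ.+ (z ℕ.+ d)) Xp Yp e₁) (θ⁺ y (x ℕ.+ (z ℕ.+ d)) refl Xq e₂)) (*-cong (θ⁺ z (d ℕ.+ (x ℕ.+ y)) Zp Dp e₃) (θ⁺ d (z ℕ.+ (x ℕ.+ y)) refl Zq e₄)))))) ⟩
      _ ≈⟨ *-congˡ (quartic-sum (q ^ y) (q ^ g) (q ^ d) (q ^ h) (Null-resp (sym (trans Mp (^-congʳ q e))) (q^-null {28} (ℕ.s≤s ℕ.z≤n)))) ⟩
      _ ≈⟨ *-congˡ (*-cong (*-congˡ (θ⁺ (x ℕ.+ y) (z ℕ.+ d) XYp ZDp e)) (*-cong (θ⁺ (x ℕ.+ d) (y ℕ.+ z) (q^-* x d Xp refl) (q^-* y z refl Zp) e₅) (θ⁺ (y ℕ.+ d) (x ℕ.+ z) (q^-* y d refl refl) (q^-* x z Xp Zp) e₆))) ⟩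
      _ ≈⟨ collect₃ _ _ _ _ (J 28) ⟩
      J³ * ((f 1# _ * J 28) * Πˡ PB (x ℕ.+ y ∷ x ℕ.+ d ∷ y ℕ.+ d ∷ []))
        ≈⟨ *-congˡ (*-cong (f-1-28 Mp e) (sym (*-identityˡ _))) ⟩
      J³ * (2# * X * (1# * Πˡ PB (x ℕ.+ y ∷ x ℕ.+ d ∷ y ℕ.+ d ∷ []))) ∎)
      where
      J³ = J 28 * J 28 * J 28
      Xp = q^-* y g refl refl
      Zp = q^-* d h refl refl
      XYp = q^-* x y Xp refl
      ZDp = q^-* z d Zp refl
      Mp = q^-* (x ℕ.+ y) (z ℕ.+ d) XYp ZDp
      Yp = q^-* y (z ℕ.+ d) refl ZDp
      Xq = q^-* x (z ℕ.+ d) Xp ZDp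
      Dp = q^-* d (x ℕ.+ y) refl XYp
      Zq = q^-* z (x ℕ.+ y) Zp XYp
      e₁ = ≡.trans (solveℕ 4 (λ x y z d → x ⊕ (y ⊕ (z ⊕ d)) ≔ x ⊕ y ⊕ (z ⊕ d)) ≡.refl x y z d) e
      e₂ = ≡.trans (solveℕ 4 (λ x y z d → y ⊕ (x ⊕ (z ⊕ d)) ≔ x ⊕ y ⊕ (z ⊕ d)) ≡.refl x y z d) e
      e₃ = ≡.trans (solveℕ 4 (λ x y z d → z ⊕ (d ⊕ (x ⊕ y)) ≔ x ⊕ y ⊕ (z ⊕ d)) ≡.refl x y z d) e
      e₄ = ≡.trans (solveℕ 4 (λ x y z d → d ⊕ (z ⊕ (x ⊕ y)) ≔ x ⊕ y ⊕ (z ⊕ d)) ≡.refl x y z d) e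
      e₅ = ≡.trans (solveℕ 4 (λ x y z d → (x ⊕ d) ⊕ (y ⊕ z) ≔ x ⊕ y ⊕ (z ⊕ d)) ≡.refl x y z d) e
      e₆ = ≡.trans (solveℕ 4 (λ x y z d → (y ⊕ d) ⊕ (x ⊕ z) ≔ x ⊕ y ⊕ (z ⊕ d)) ≡.refl x y z d) e

  module _ (j h c k : ℕ) where
    private
      i : ℕ
      i = j ℕ.+ h
      quad : List ℕ
      quad = c ℕ.+ (i ℕ.+ j) ∷ c ∷ c ℕ.+ i ∷ c ℕ.+ j ∷ []

    -- The four residues satisfy (c + i + j) + c = (c + i) + (c + j), and c, the smallest, is the
    -- exponent on the right; k only fills up the modulus 28.
    product-difference : c ℕ.+ c ℕ.+ (i ℕ.+ j) ℕ.+ k ≡ 28 →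
      J² * (Πˡ PM quad + - 1# * Πˡ PB quad) ≈ 2# * X * (- q ^ c * Πˡ PB (c ℕ.+ c ℕ.+ (i ℕ.+ j) ∷ i ∷ j ∷ []))
    product-difference e = cancelˡ (Unit-* (Unit-* Unit-J Unit-J) Unit-J) (begin
      J³ * (J² * (Πˡ PM quad + - 1# * Πˡ PB quad))
        ≈⟨ solve 4 (λ j m b n → (j :* j :* j) :* ((j :* j) :* (m :+ n :* b)) := j :* (m :* (j :* j :* (j :* j)) :+ n :* (b :* (j :* j :* (j :* j))))) refl (J 28) _ _ (- 1#) ⟩
      J 28 * (Πˡ PM quad * (J² * J²) + - 1# * (Πˡ PB quad * (J² * J²)))
        ≈⟨ *-congˡ (+-cong
             (trans (sym (collect _ _ _ _ _)) (sym (*-cong (*-cong (θ⁻ (c ℕ.+ (i ℕ.+ j)) (c ℕ.+ k) CIJp CEp e₁) (θ⁻ c (c ℕ.+ (i ℕ.+ j) ℕ.+ k) refl CIJEp e₂)) (*-cong (θ⁻ (c ℕ.+ i) (c ℕ.+ j ℕ.+ k) CIp CJEp e₃) (θ⁻ (c ℕ.+ j) (c ℕ.+ i ℕ.+ k) CJp CIEp e₄)))))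
             (*-congˡ (trans (sym (collect _ _ _ _ _)) (sym (*-cong (*-cong (θ⁺ (c ℕ.+ (i ℕ.+ j)) (c ℕ.+ k) CIJp CEp e₁) (θ⁺ c (c ℕ.+ (i ℕ.+ j) ℕ.+ k) refl CIJEp e₂)) (*-cong (θ⁺ (c ℕ.+ i) (c ℕ.+ j ℕ.+ k) CIp CJEp e₃) (θ⁺ (c ℕ.+ j) (c ℕ.+ i ℕ.+ k) CJp CIEp e₄))))))) ⟩
      _ ≈⟨ *-congˡ (quartic-difference (q ^ j) (q ^ h) (q ^ c) (q ^ k) (Null-resp (sym (trans Mp (^-congʳ q e))) (q^-null {28} (ℕ.s≤s ℕ.z≤n)))) ⟩
      _ ≈⟨ *-congˡ (*-congˡ (*-cong (*-congˡ (θ⁺ (c ℕ.+ c ℕ.+ (i ℕ.+ j)) k CCIJp refl e)) (*-cong (θ⁺ i (c ℕ.+ c ℕ.+ j ℕ.+ k) Ip CCJEp e₅) (θ⁺ j (c ℕ.+ c ℕ.+ i ℕ.+ k) refl CCIEp e₆)))) ⟩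
      _ ≈⟨ solve 3 (λ j n r → j :* (n :* r) := n :* (j :* r)) refl (J 28) (- q ^ c) _ ⟩
      _ ≈⟨ *-congˡ (collect₃ _ _ _ _ (J 28)) ⟩
      - q ^ c * (J³ * ((f 1# _ * J 28) * Πˡ PB bs))
        ≈⟨ *-congˡ (*-congˡ (*-congʳ (f-1-28 Mp e))) ⟩
      - q ^ c * (J³ * (2# * X * Πˡ PB bs))
        ≈⟨ solve 4 (λ n j t r → n :* (j :* (t :* r)) := j :* (t :* (n :* r))) refl (- q ^ c) J³ (2# * X) _ ⟩
      J³ * (2# * X * (- q ^ c * Πˡ PB bs)) ∎)
      where
      bs : List ℕ
      bs = c ℕ.+ c ℕ.+ (i ℕ.+ j) ∷ i ∷ j ∷ []
      J³ = J 28 * J 28 * J 28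
      Ip = q^-* j h refl refl
      IJp = q^-* i j Ip refl
      CCp = q^-* c c refl refl
      CIJp = q^-* c (i ℕ.+ j) refl IJp
      CEp = q^-* c k refl refl
      CIJEp = q^-* (c ℕ.+ (i ℕ.+ j)) k CIJp refl
      CIp = q^-* c i refl Ip
      CJp = q^-* c j refl refl
      CJEp = q^-* (c ℕ.+ j) k CJp refl
      CIEp = q^-* (c ℕ.+ i) k CIp refl
      CCIJp = q^-* (c ℕ.+ c) (i ℕ.+ j) CCp IJp
      CCJEp = q^-* (c ℕ.+ c ℕ.+ j) k (q^-* (c ℕ.+ c) j CCp refl) refl
      CCIEp = q^-* (c ℕ.+ c ℕ.+ i) k (q^-* (c ℕ.+ c) i CCp Ip) refl
      Mp = q^-* (c ℕ.+ c ℕ.+ (i ℕ.+ j)) k CCIJp refl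
      e₁ : c ℕ.+ (i ℕ.+ j) ℕ.+ (c ℕ.+ k) ≡ 28
      e₁ = ≡.trans (solveℕ 4 (λ i j c k → c ⊕ (i ⊕ j) ⊕ (c ⊕ k) ≔ c ⊕ c ⊕ (i ⊕ j) ⊕ k) ≡.refl i j c k) e
      e₂ : c ℕ.+ (c ℕ.+ (i ℕ.+ j) ℕ.+ k) ≡ 28
      e₂ = ≡.trans (solveℕ 4 (λ i j c k → c ⊕ (c ⊕ (i ⊕ j) ⊕ k) ≔ c ⊕ c ⊕ (i ⊕ j) ⊕ k) ≡.refl i j c k) e
      e₃ : c ℕ.+ i ℕ.+ (c ℕ.+ j ℕ.+ k) ≡ 28
      e₃ = ≡.trans (solveℕ 4 (λ i j c k → c ⊕ i ⊕ (c ⊕ j ⊕ k) ≔ c ⊕ c ⊕ (i ⊕ j) ⊕ k) ≡.refl i j c k) e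
      e₄ : c ℕ.+ j ℕ.+ (c ℕ.+ i ℕ.+ k) ≡ 28
      e₄ = ≡.trans (solveℕ 4 (λ i j c k → c ⊕ j ⊕ (c ⊕ i ⊕ k) ≔ c ⊕ c ⊕ (i ⊕ j) ⊕ k) ≡.refl i j c k) e
      e₅ : i ℕ.+ (c ℕ.+ c ℕ.+ j ℕ.+ k) ≡ 28
      e₅ = ≡.trans (solveℕ 4 (λ i j c k → i ⊕ (c ⊕ c ⊕ j ⊕ k) ≔ c ⊕ c ⊕ (i ⊕ j) ⊕ k) ≡.refl i j c k) e
      e₆ : j ℕ.+ (c ℕ.+ c ℕ.+ i ℕ.+ k) ≡ 28
      e₆ = ≡.trans (solveℕ 4 (λ i j c k → j ⊕ (c ⊕ c ⊕ i ⊕ k) ≔ c ⊕ c ⊕ (i ⊕ j) ⊕ k) ≡.refl i j c k) e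

  module _ (c g k : ℕ) (e : c ℕ.+ c ℕ.+ (g ℕ.+ k) ≡ 28) where
    private
      x : ℕ
      x = c ℕ.+ g
      CC = c ℕ.+ c
      XP = q^-* c g refl refl
      CEp = q^-* c k refl refl
      CGEp = q^-* x k XP refl
      CCp = q^-* c c refl refl
      C⁴p = q^-* CC CC CCp CCp
      GGp = q^-* g g refl refl
      EEp = q^-* k k refl refl
      null : Null (q ^ c * q ^ c * (q ^ g * q ^ k))
      null = Null-resp (sym (trans (q^-* CC (g ℕ.+ k) CCp (q^-* g k refl refl)) (^-congʳ q e))) (q^-null {28} (ℕ.s≤s ℕ.z≤n))
      e₁ : x ℕ.+ (c ℕ.+ k) ≡ 28
      e₁ = ≡.trans (solveℕ 3 (λ c g k → c ⊕ g ⊕ (c ⊕ k) ≔ c ⊕ c ⊕ (g ⊕ k)) ≡.refl c g k) e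
      e₂ : c ℕ.+ (x ℕ.+ k) ≡ 28
      e₂ = ≡.trans (solveℕ 3 (λ c g k → c ⊕ (c ⊕ g ⊕ k) ≔ c ⊕ c ⊕ (g ⊕ k)) ≡.refl c g k) e
      e+e : (CC ℕ.+ (g ℕ.+ k)) ℕ.+ (CC ℕ.+ (g ℕ.+ k)) ≡ 56
      e+e = ≡.cong₂ ℕ._+_ e e

      product₊ : f (q ^ c * q ^ g) (q ^ c * q ^ k) * f (- q ^ c) (- (q ^ c * q ^ g * q ^ k)) ≈ (PB x * J 28) * (PM c * J 28)
      product₊ = *-cong (θ⁺ x (c ℕ.+ k) XP CEp e₁) (θ⁻ c (x ℕ.+ k) refl CGEp e₂)

      product₋ : f (- (q ^ c * q ^ g)) (- (q ^ c * q ^ k)) * f (q ^ c) (q ^ c * q ^ g * q ^ k) ≈ (PM x * J 28) * (PB c * J 28)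
      product₋ = *-cong (θ⁻ x (c ℕ.+ k) XP CEp e₁) (θ⁺ c (x ℕ.+ k) refl CGEp e₂)

    -- The residues compared are c and x = c + g, and the condition on k says k = 28 - c - x. In the
    -- applications c is β and x is α.
    product-mixed-sum : J² * (PM x * PB c + 1# * (PM c * PB x)) ≈
      2# * X * (1# * P (CC ℕ.+ g ∷ CC ℕ.+ g ℕ.+ (k ℕ.+ k) ∷ CC ℕ.+ (g ℕ.+ g) ℕ.+ k ∷ CC ℕ.+ k ∷ []))
    product-mixed-sum = begin
      J² * (PM x * PB c + 1# * (PM c * PB x))
        ≈⟨ solve 5 (λ a b c d j → (j :* j) :* (a :* b :+ con 1 :* (c :* d)) := (d :* j) :* (c :* j) :+ (a :* j) :* (b :* j)) refl (PM x) (PB c) (PM c) (PB x) (J 28) ⟩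
      (PB x * J 28) * (PM c * J 28) + (PM x * J 28) * (PB c * J 28)
        ≈⟨ +-cong product₊ product₋ ⟨
      _ ≈⟨ mixed-sum (q ^ c) (q ^ g) (q ^ k) null ⟩
      _ ≈⟨ *-congˡ (*-cong (θ₅₆ (CC ℕ.+ g) (CC ℕ.+ g ℕ.+ (k ℕ.+ k)) CCGp (q^-* (CC ℕ.+ g) (k ℕ.+ k) CCGp EEp) e₃) (θ₅₆ (CC ℕ.+ (g ℕ.+ g) ℕ.+ k) (CC ℕ.+ k) (q^-* (CC ℕ.+ (g ℕ.+ g)) k (q^-* CC (g ℕ.+ g) CCp GGp) refl) (q^-* CC k CCp refl) e₄)) ⟩
      _ ≈⟨ solve 6 (λ t a b c d j → t :* (a :* b :* j :* (c :* d :* j)) := t :* (j :* j) :* (con 1 :* (a :* (b :* (c :* (d :* con 1)))))) refl 2# _ _ _ _ (J 56) ⟩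
      2# * X * (1# * P (CC ℕ.+ g ∷ CC ℕ.+ g ℕ.+ (k ℕ.+ k) ∷ CC ℕ.+ (g ℕ.+ g) ℕ.+ k ∷ CC ℕ.+ k ∷ [])) ∎
      where
      CCGp = q^-* CC g CCp refl
      e₃ : CC ℕ.+ g ℕ.+ (CC ℕ.+ g ℕ.+ (k ℕ.+ k)) ≡ 56
      e₃ = ≡.trans (solveℕ 3 (λ c g k → c ⊕ g ⊕ (c ⊕ g ⊕ (k ⊕ k)) ≔ (c ⊕ (g ⊕ k)) ⊕ (c ⊕ (g ⊕ k))) ≡.refl CC g k) e+e
      e₄ : CC ℕ.+ (g ℕ.+ g) ℕ.+ k ℕ.+ (CC ℕ.+ k) ≡ 56
      e₄ = ≡.trans (solveℕ 3 (λ c g k → c ⊕ (g ⊕ g) ⊕ k ⊕ (c ⊕ k) ≔ (c ⊕ (g ⊕ k)) ⊕ (c ⊕ (g ⊕ k))) ≡.refl CC g k) e+e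

    product-mixed-difference : J² * (PM x * PB c + - 1# * (PM c * PB x)) ≈
      2# * X * (q ^ c * P (CC ℕ.+ CC ℕ.+ (g ℕ.+ g) ℕ.+ k ∷ k ∷ g ∷ CC ℕ.+ CC ℕ.+ g ℕ.+ (k ℕ.+ k) ∷ []))
    product-mixed-difference = begin
      J² * (PM x * PB c + - 1# * (PM c * PB x))
        ≈⟨ solve 6 (λ a b c d j n → (j :* j) :* (a :* b :+ n :* (c :* d)) := (a :* j) :* (b :* j) :+ n :* ((d :* j) :* (c :* j))) refl (PM x) (PB c) (PM c) (PB x) (J 28) (- 1#) ⟩
      (PM x * J 28) * (PB c * J 28) + - 1# * ((PB x * J 28) * (PM c * J 28))
        ≈⟨ +-cong product₋ (*-congˡ product₊) ⟨
      _ ≈⟨ mixed-difference (q ^ c) (q ^ g) (q ^ k) null ⟩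
      _ ≈⟨ *-congˡ (*-congˡ (*-cong (θ₅₆ (CC ℕ.+ CC ℕ.+ (g ℕ.+ g) ℕ.+ k) k (q^-* (CC ℕ.+ CC ℕ.+ (g ℕ.+ g)) k (q^-* (CC ℕ.+ CC) (g ℕ.+ g) C⁴p GGp) refl) refl e₃) (θ₅₆ g (CC ℕ.+ CC ℕ.+ g ℕ.+ (k ℕ.+ k)) refl (q^-* (CC ℕ.+ CC ℕ.+ g) (k ℕ.+ k) (q^-* (CC ℕ.+ CC) g C⁴p refl) EEp) e₄))) ⟩
      _ ≈⟨ solve 7 (λ t n a b c d j → t :* (n :* (a :* b :* j :* (c :* d :* j))) := t :* (j :* j) :* (n :* (a :* (b :* (c :* (d :* con 1)))))) refl 2# (q ^ c) _ _ _ _ (J 56) ⟩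
      2# * X * (q ^ c * P (CC ℕ.+ CC ℕ.+ (g ℕ.+ g) ℕ.+ k ∷ k ∷ g ∷ CC ℕ.+ CC ℕ.+ g ℕ.+ (k ℕ.+ k) ∷ [])) ∎
      where
      e₃ : CC ℕ.+ CC ℕ.+ (g ℕ.+ g) ℕ.+ k ℕ.+ k ≡ 56
      e₃ = ≡.trans (solveℕ 3 (λ c g k → c ⊕ c ⊕ (g ⊕ g) ⊕ k ⊕ k ≔ (c ⊕ (g ⊕ k)) ⊕ (c ⊕ (g ⊕ k))) ≡.refl CC g k) e+e
      e₄ : g ℕ.+ (CC ℕ.+ CC ℕ.+ g ℕ.+ (k ℕ.+ k)) ≡ 56
      e₄ = ≡.trans (solveℕ 3 (λ c g k → g ⊕ (c ⊕ c ⊕ g ⊕ (k ⊕ k)) ≔ (c ⊕ (g ⊕ k)) ⊕ (c ⊕ (g ⊕ k))) ≡.refl CC g k) e+e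

-- Elimination

-- The data of one case, in the notation at the top: ts = t₁, t₂, t₃; LS and LT are the residues
-- mod 56 of the set with β and of the set with α, GS and GT the even ones among them. The product
-- for α is that of the [-a;28] with a in As, the one for β that of the [-a;28] with a in Bs, and
-- the third product has the residues Cs mod 56. The checks compare multisets of residues.
record Configuration : Set where
  field
    ts As Bs Cs GS GT LS LT : List ℕ
    α β : ℕ
    A-check : sort (doubled β ++ concatMap doubled As ++ GS) ≡ sort (Cs ++ concatMap residues As)
    B-check : sort (doubled α ++ concatMap doubled Bs ++ GT) ≡ sort (Cs ++ concatMap residues Bs)
    S-check : sort LS ≡ sort (concatMap residues (β ∷ ts) ++ GS)
    T-check : sort LT ≡ sort (concatMap residues (α ∷ ts) ++ GT)
    A-positive : True (all? (1 ℕ.≤?_) (concatMap residues As))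
    B-positive : True (all? (1 ℕ.≤?_) (concatMap residues Bs))
    C-positive : True (all? (1 ℕ.≤?_) Cs)

module Elimination (R : CommutativeRing 0ℓ 0ℓ) (K : ℕ) (q : CommutativeRing.Carrier R)
  (q-null : Theta.Null R K q)
  (cancel-2 : Products.TwoCancellable R) where
  open CommutativeRing R
  open ThetaIdentities R K using (2#; -x*-y≈x*y)
  open Products R
  open ThetaProducts R K q q-null
  open ProductIdentities R K q q-null
  open import Relation.Binary.Reasoning.Setoid setoid
  open import Algebra.Properties.Ring ring
  open import Algebra.Properties.Semiring.Exp semiring
  open import Algebra.Solver.Ring.NaturalCoefficients.Default commutativeSemiring
    using (solve; _:=_; _:+_; _:*_; con)

  -- Multiply the first identity by p̄β, the second by σ p̄α, and add. The terms with t̄ have total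
  -- coefficient s + σ s′, so the sign condition is exactly what makes them disappear; the terms
  -- with t combine to the third identity. What is left to cancel is 2X.
  eliminate : ∀ {t t̄ pα pβ p̄α p̄β A B C s s′ σ a b κ} → s + σ * s′ ≈ 0# →
    J² * (pα * t + s * (p̄α * t̄)) ≈ 2# * X * (a * A) →
    J² * (pβ * t + s′ * (p̄β * t̄)) ≈ 2# * X * (b * B) →
    J² * (pα * p̄β + σ * (pβ * p̄α)) ≈ 2# * X * (κ * C) →
    t * (κ * C) ≈ a * A * p̄β + σ * (b * B * p̄α)
  eliminate {t} {t̄} {pα} {pβ} {p̄α} {p̄β} {A} {B} {C} {s} {s′} {σ} {a} {b} {κ} signs hA hB hC =
    cancelˡ Unit-X (cancel-2 _ _ (begin
      2# * (X * (t * (κ * C)))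
        ≈⟨ solve 4 (λ o x t r → o :* (x :* (t :* r)) := t :* (o :* x :* r)) refl 2# X t (κ * C) ⟩
      t * (2# * X * (κ * C))
        ≈⟨ *-congˡ hC ⟨
      t * (J² * (pα * p̄β + σ * (pβ * p̄α)))
        ≈⟨ +-identityʳ _ ⟨
      t * (J² * (pα * p̄β + σ * (pβ * p̄α))) + 0#
        ≈⟨ +-congˡ (trans (*-congʳ signs) (zeroˡ _)) ⟨
      t * (J² * (pα * p̄β + σ * (pβ * p̄α))) + (s + σ * s′) * (J² * (p̄α * p̄β * t̄))
        ≈⟨ solve 10 (λ j t t̄ pα pβ p̄α p̄β s s′ σ →
             t :* (j :* (pα :* p̄β :+ σ :* (pβ :* p̄α))) :+ (s :+ σ :* s′) :* (j :* (p̄α :* p̄β :* t̄)) :=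
             j :* (pα :* t :+ s :* (p̄α :* t̄)) :* p̄β :+ σ :* (j :* (pβ :* t :+ s′ :* (p̄β :* t̄)) :* p̄α))
             refl J² t t̄ pα pβ p̄α p̄β s s′ σ ⟩
      J² * (pα * t + s * (p̄α * t̄)) * p̄β + σ * (J² * (pβ * t + s′ * (p̄β * t̄)) * p̄α)
        ≈⟨ +-cong (*-congʳ hA) (*-congˡ (*-congʳ hB)) ⟩
      2# * X * (a * A) * p̄β + σ * (2# * X * (b * B) * p̄α)
        ≈⟨ solve 7 (λ o x a p s b r → o :* x :* a :* p :+ s :* (o :* x :* b :* r) := o :* (x :* (a :* p :+ s :* (b :* r))))
             refl 2# X (a * A) p̄β σ (b * B) p̄α ⟩
      2# * (X * (a * A * p̄β + σ * (b * B * p̄α))) ∎))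

  -- After multiplication by FS FT t pα pβ GS GT, each term contains one of the products known to be
  -- C, and reciprocals use up the rest.
  divide : ∀ {t pα pβ p̄α p̄β A B C GS GT FS FT σ a b κ} → Unit C →
    t * (κ * C) ≈ a * A * p̄β + σ * (b * B * p̄α) →
    pβ * p̄β * A * GS ≈ C → pα * p̄α * B * GT ≈ C →
    FS * (pβ * t * GS) ≈ 1# → FT * (pα * t * GT) ≈ 1# →
    κ ≈ a * FS + σ * (b * FT)
  divide {t} {pα} {pβ} {p̄α} {p̄β} {A} {B} {C} {GS} {GT} {FS} {FT} {σ} {a} {b} {κ} unit e hA hB hS hT =
    cancelˡ unit (begin
      C * κ
        ≈⟨ solve 2 (λ c k → c :* k := con 1 :* con 1 :* (k :* c)) refl C κ ⟩
      1# * 1# * (κ * C)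
        ≈⟨ *-congʳ (*-cong hS hT) ⟨
      FS * (pβ * t * GS) * (FT * (pα * t * GT)) * (κ * C)
        ≈⟨ solve 8 (λ t pα pβ g h s u k → s :* (pβ :* t :* g) :* (u :* (pα :* t :* h)) :* k := s :* u :* t :* (pα :* pβ :* g :* h) :* (t :* k))
             refl t pα pβ GS GT FS FT (κ * C) ⟩
      W * (t * (κ * C))
        ≈⟨ *-congˡ e ⟩
      W * (a * A * p̄β + σ * (b * B * p̄α))
        ≈⟨ distribˡ _ _ _ ⟩
      W * (a * A * p̄β) + W * (σ * (b * B * p̄α))
        ≈⟨ +-cong
            (solve 10 (λ t pα pβ p̄β A a g h s u → s :* u :* t :* (pα :* pβ :* g :* h) :* (a :* A :* p̄β) := (pβ :* p̄β :* A :* g) :* (u :* (pα :* t :* h)) :* (a :* s))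
               refl t pα pβ p̄β A a GS GT FS FT)
            (solve 11 (λ t pα pβ p̄α B b g h s u σ → s :* u :* t :* (pα :* pβ :* g :* h) :* (σ :* (b :* B :* p̄α)) := (pα :* p̄α :* B :* h) :* (s :* (pβ :* t :* g)) :* (σ :* (b :* u)))
               refl t pα pβ p̄α B b GS GT FS FT σ) ⟩
      (pβ * p̄β * A * GS) * (FT * (pα * t * GT)) * (a * FS) + (pα * p̄α * B * GT) * (FS * (pβ * t * GS)) * (σ * (b * FT))
        ≈⟨ +-cong (*-congʳ (*-cong hA hT)) (*-congʳ (*-cong hB hS)) ⟩
      C * 1# * (a * FS) + C * 1# * (σ * (b * FT))
        ≈⟨ solve 3 (λ c x y → c :* con 1 :* x :+ c :* con 1 :* y := c :* (x :+ y)) refl C _ _ ⟩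
      C * (a * FS + σ * (b * FT)) ∎)
    where
    W : Carrier
    W = FS * FT * t * (pα * pβ * GS * GT)

  private
    -- Multiplying by the [a;28] with a in As turns each [-a;28] into [2a;56]. Both sides then
    -- become products over lists of residues mod 56, and the check compares these lists.
    evens : ∀ β As GS Cs → All (1 ℕ.≤_) (concatMap residues As) →
      sort (doubled β ++ concatMap doubled As ++ GS) ≡ sort (Cs ++ concatMap residues As) →
      PM β * PB β * Πˡ PB As * P GS ≈ P Cs
    evens β As GS Cs positive check = cancelˡ (Unit-resp (sym (PMs-residues As)) (Unit-P positive)) (begin
      Πˡ PM As * (PM β * PB β * Πˡ PB As * P GS)
        ≈⟨ solve 4 (λ u b a g → u :* (b :* a :* g) := b :* ((u :* a) :* g)) refl (Πˡ PM As) (PM β * PB β) (Πˡ PB As) (P GS) ⟩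
      PM β * PB β * ((Πˡ PM As * Πˡ PB As) * P GS)
        ≈⟨ *-cong (PM*PB β) (*-congʳ (PMs*PBs As)) ⟩
      P (doubled β) * (P (concatMap doubled As) * P GS)
        ≈⟨ *-congˡ (Πˡ-++ (pr 56) (concatMap doubled As) GS) ⟨
      P (doubled β) * P (concatMap doubled As ++ GS)
        ≈⟨ Πˡ-++ (pr 56) (doubled β) (concatMap doubled As ++ GS) ⟨
      P (doubled β ++ concatMap doubled As ++ GS)
        ≈⟨ Πˡ-permute (pr 56) (doubled β ++ concatMap doubled As ++ GS) (Cs ++ concatMap residues As) check ⟩
      P (Cs ++ concatMap residues As)
        ≈⟨ trans (Πˡ-++ (pr 56) Cs (concatMap residues As)) (*-comm _ _) ⟩
      P (concatMap residues As) * P Cs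
        ≈⟨ *-congʳ (PMs-residues As) ⟨
      Πˡ PM As * P Cs ∎)

    generating : ∀ β ts GS LS {F} → sort LS ≡ sort (concatMap residues (β ∷ ts) ++ GS) →
      F * P LS ≈ 1# → F * (PM β * Πˡ PM ts * P GS) ≈ 1#
    generating β ts GS LS check e = trans (*-congˡ (sym (trans
      (Πˡ-permute (pr 56) LS (concatMap residues (β ∷ ts) ++ GS) check)
      (trans (Πˡ-++ (pr 56) (concatMap residues (β ∷ ts)) GS) (*-congʳ (sym (PMs-residues (β ∷ ts)))))))) e

  module _ (cfg : Configuration) where
    open Configuration cfg

    module _ {FS FT : Carrier} (hS : FS * P LS ≈ 1#) (hT : FT * P LT ≈ 1#) where

      -- `qA` and `qB` list the residues α, t₁, t₂, t₃ and β, t₁, t₂, t₃ in the order in which the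
      -- theta formulas produce them.
      combine : ∀ {s s′ σ a b κ} qA qB → s + σ * s′ ≈ 0# →
        sort qA ≡ sort (α ∷ ts) → sort qB ≡ sort (β ∷ ts) →
        J² * (Πˡ PM qA + s * Πˡ PB qA) ≈ 2# * X * (a * Πˡ PB As) →
        J² * (Πˡ PM qB + s′ * Πˡ PB qB) ≈ 2# * X * (b * Πˡ PB Bs) →
        J² * (PM α * PB β + σ * (PM β * PB α)) ≈ 2# * X * (κ * P Cs) →
        κ ≈ a * FS + σ * (b * FT)
      combine qA qB signs qA-check qB-check hA hB hC = divide (Unit-P (toWitness C-positive))
        (eliminate signs (trans (*-congˡ (permuted qA (α ∷ ts) qA-check)) hA) (trans (*-congˡ (permuted qB (β ∷ ts) qB-check)) hB) hC)
        (evens β As GS Cs (toWitness A-positive) A-check) (evens α Bs GT Cs (toWitness B-positive) B-check)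
        (generating β ts GS LS S-check hS) (generating α ts GT LT T-check hT)
        where
        permuted : ∀ as bs {s} → sort as ≡ sort bs → Πˡ PM bs + s * Πˡ PB bs ≈ Πˡ PM as + s * Πˡ PB as
        permuted as bs e = sym (+-cong (Πˡ-permute PM as bs e) (*-congˡ (Πˡ-permute PB as bs e)))

      private
        move : ∀ {κ x y} → κ ≈ x + - y → x ≈ y + κ
        move {κ} {x} {y} e = sym (begin
          y + κ          ≈⟨ +-congˡ e ⟩
          y + (x + - y)  ≈⟨ solve 3 (λ x y n → y :+ (x :+ n) := x :+ (y :+ n)) refl x y (- y) ⟩
          x + (y + - y)  ≈⟨ trans (+-congˡ (-‿inverseʳ y)) (+-identityʳ x) ⟩
          x ∎)

      -- This lemma and the next three treat the sign triples (s, s′, σ) = (1, -1, 1), (-1, 1, 1),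
      -- (1, 1, -1), (-1, -1, -1). The first word of each name is the sign of the formula for α, the
      -- second that for β. Terms are moved so that no minus sign is left.
      sum-difference : ∀ {n} qA qB →
        sort qA ≡ sort (α ∷ ts) → sort qB ≡ sort (β ∷ ts) →
        J² * (Πˡ PM qA + 1# * Πˡ PB qA) ≈ 2# * X * (1# * Πˡ PB As) →
        J² * (Πˡ PM qB + - 1# * Πˡ PB qB) ≈ 2# * X * (- q ^ n * Πˡ PB Bs) →
        J² * (PM α * PB β + 1# * (PM β * PB α)) ≈ 2# * X * (1# * P Cs) →
        q ^ 0 * FS ≈ q ^ n * FT + q ^ 0
      sum-difference qA qB a b hA hB hC = move (trans
        (combine qA qB (trans (+-congˡ (*-identityˡ _)) (-‿inverseʳ 1#)) a b hA hB hC)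
        (+-congˡ (trans (*-identityˡ _) (sym (-‿distribˡ-* _ _)))))

      difference-sum : ∀ {n} qA qB →
        sort qA ≡ sort (α ∷ ts) → sort qB ≡ sort (β ∷ ts) →
        J² * (Πˡ PM qA + - 1# * Πˡ PB qA) ≈ 2# * X * (- q ^ n * Πˡ PB As) →
        J² * (Πˡ PM qB + 1# * Πˡ PB qB) ≈ 2# * X * (1# * Πˡ PB Bs) →
        J² * (PM α * PB β + 1# * (PM β * PB α)) ≈ 2# * X * (1# * P Cs) →
        q ^ 0 * FT ≈ q ^ n * FS + q ^ 0
      difference-sum qA qB a b hA hB hC = move (trans
        (combine qA qB (trans (+-congˡ (*-identityˡ _)) (-‿inverseˡ 1#)) a b hA hB hC)
        (trans (+-comm _ _) (+-cong (*-identityˡ _) (sym (-‿distribˡ-* _ _)))))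

      sum-sum : ∀ {n} qA qB →
        sort qA ≡ sort (α ∷ ts) → sort qB ≡ sort (β ∷ ts) →
        J² * (Πˡ PM qA + 1# * Πˡ PB qA) ≈ 2# * X * (1# * Πˡ PB As) →
        J² * (Πˡ PM qB + 1# * Πˡ PB qB) ≈ 2# * X * (1# * Πˡ PB Bs) →
        J² * (PM α * PB β + - 1# * (PM β * PB α)) ≈ 2# * X * (q ^ n * P Cs) →
        q ^ 0 * FS ≈ q ^ 0 * FT + q ^ n
      sum-sum qA qB a b hA hB hC = move (trans
        (combine qA qB (trans (+-congˡ (*-identityʳ _)) (-‿inverseʳ 1#)) a b hA hB hC)
        (+-congˡ (-1*x≈-x _)))

      difference-difference : ∀ {m n k} qA qB →
        sort qA ≡ sort (α ∷ ts) → sort qB ≡ sort (β ∷ ts) →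
        J² * (Πˡ PM qA + - 1# * Πˡ PB qA) ≈ 2# * X * (- q ^ m * Πˡ PB As) →
        J² * (Πˡ PM qB + - 1# * Πˡ PB qB) ≈ 2# * X * (- q ^ n * Πˡ PB Bs) →
        J² * (PM α * PB β + - 1# * (PM β * PB α)) ≈ 2# * X * (q ^ k * P Cs) →
        q ^ n * FT ≈ q ^ m * FS + q ^ k
      difference-difference qA qB a b hA hB hC = move (trans
        (combine qA qB (trans (+-congˡ (trans (-x*-y≈x*y 1# 1#) (*-identityˡ 1#))) (-‿inverseˡ 1#)) a b hA hB hC)
        (trans (+-comm _ _) (+-cong
          (trans (*-congˡ (sym (-‿distribˡ-* _ _))) (trans (-x*-y≈x*y 1# _) (*-identityˡ _)))
          (sym (-‿distribˡ-* _ _)))))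

-- The six cases

S₁ T₁ S₂ T₂ S₃ T₃ S₄ T₄ S₅ T₅ S₆ T₆ : List ℕ
S₁ = 1 ∷ 3 ∷ 4 ∷ 5 ∷ 7 ∷ 18 ∷ 21 ∷ 22 ∷ 23 ∷ 24 ∷ 25 ∷ 27 ∷ []
T₁ = 1 ∷ 2 ∷ 3 ∷ 7 ∷ 11 ∷ 17 ∷ 20 ∷ 21 ∷ 24 ∷ 25 ∷ 26 ∷ 27 ∷ []
S₂ = 2 ∷ 3 ∷ 7 ∷ 9 ∷ 10 ∷ 12 ∷ 13 ∷ 15 ∷ 16 ∷ 19 ∷ 21 ∷ 25 ∷ []
T₂ = 3 ∷ 4 ∷ 5 ∷ 6 ∷ 7 ∷ 9 ∷ 16 ∷ 19 ∷ 21 ∷ 22 ∷ 23 ∷ 25 ∷ []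
S₃ = 2 ∷ 3 ∷ 5 ∷ 7 ∷ 8 ∷ 13 ∷ 15 ∷ 20 ∷ 21 ∷ 22 ∷ 23 ∷ 25 ∷ []
T₃ = 1 ∷ 5 ∷ 7 ∷ 8 ∷ 10 ∷ 12 ∷ 13 ∷ 15 ∷ 18 ∷ 21 ∷ 23 ∷ 27 ∷ []
S₄ = 1 ∷ 7 ∷ 8 ∷ 9 ∷ 10 ∷ 12 ∷ 13 ∷ 15 ∷ 18 ∷ 19 ∷ 21 ∷ 27 ∷ []
T₄ = 1 ∷ 6 ∷ 7 ∷ 8 ∷ 9 ∷ 11 ∷ 17 ∷ 19 ∷ 20 ∷ 21 ∷ 26 ∷ 27 ∷ []
S₅ = 4 ∷ 5 ∷ 6 ∷ 7 ∷ 9 ∷ 11 ∷ 16 ∷ 17 ∷ 19 ∷ 21 ∷ 22 ∷ 23 ∷ []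
T₅ = 1 ∷ 5 ∷ 7 ∷ 11 ∷ 12 ∷ 16 ∷ 17 ∷ 18 ∷ 21 ∷ 23 ∷ 26 ∷ 27 ∷ []
S₆ = 4 ∷ 6 ∷ 7 ∷ 9 ∷ 10 ∷ 11 ∷ 13 ∷ 15 ∷ 17 ∷ 19 ∷ 21 ∷ 24 ∷ []
T₆ = 2 ∷ 3 ∷ 7 ∷ 11 ∷ 13 ∷ 15 ∷ 17 ∷ 20 ∷ 21 ∷ 24 ∷ 25 ∷ 26 ∷ []

members : List ℕ → List ℕ
members rs = selected (S56 rs) 56

±56 : List ℕ → List ℕ
±56 = concatMap (λ a → a ∷ 56 ℕ.∸ a ∷ [])

-- Throughout α > β, because the mixed formula is used with g = α - β; accordingly `LS` comes from T
-- from the second case on. `As` and `Bs` are the residues on the right of the four-theta formula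
-- for α and for β, `Cs` those of the mixed formula.
cfg₁ cfg₂ cfg₃ cfg₄ cfg₅ cfg₆ : Configuration
cfg₁ = record
  { ts = 3 ∷ 1 ∷ 7 ∷ []; α = 17; β = 5
  ; As = 4 ∷ 10 ∷ 8 ∷ []; Bs = 8 ∷ 4 ∷ 2 ∷ []; Cs = 22 ∷ 34 ∷ 40 ∷ 16 ∷ []
  ; GS = ±56 (4 ∷ 18 ∷ 22 ∷ 24 ∷ []); GT = ±56 (2 ∷ 20 ∷ 24 ∷ 26 ∷ [])
  ; LS = members S₁; LT = members T₁
  ; A-check = ≡.refl; B-check = ≡.refl; S-check = ≡.refl; T-check = ≡.refl
  ; A-positive = _; B-positive = _; C-positive = _
  }
cfg₂ = record
  { ts = 3 ∷ 9 ∷ 7 ∷ []; α = 13; β = 5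
  ; As = 16 ∷ 6 ∷ 4 ∷ []; Bs = 12 ∷ 4 ∷ 2 ∷ []; Cs = 46 ∷ 10 ∷ 8 ∷ 48 ∷ []
  ; GS = ±56 (4 ∷ 6 ∷ 16 ∷ 22 ∷ []); GT = ±56 (2 ∷ 10 ∷ 12 ∷ 16 ∷ [])
  ; LS = members T₂; LT = members S₂
  ; A-check = ≡.refl; B-check = ≡.refl; S-check = ≡.refl; T-check = ≡.refl
  ; A-positive = _; B-positive = _; C-positive = _
  }
cfg₃ = record
  { ts = 13 ∷ 5 ∷ 7 ∷ []; α = 3; β = 1
  ; As = 18 ∷ 16 ∷ 8 ∷ []; Bs = 20 ∷ 16 ∷ 6 ∷ []; Cs = 32 ∷ 24 ∷ 2 ∷ 54 ∷ []
  ; GS = ±56 (8 ∷ 10 ∷ 12 ∷ 18 ∷ []); GT = ±56 (2 ∷ 8 ∷ 20 ∷ 22 ∷ [])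
  ; LS = members T₃; LT = members S₃
  ; A-check = ≡.refl; B-check = ≡.refl; S-check = ≡.refl; T-check = ≡.refl
  ; A-positive = _; B-positive = _; C-positive = _
  }
cfg₄ = record
  { ts = 9 ∷ 1 ∷ 7 ∷ []; α = 15; β = 11
  ; As = 16 ∷ 8 ∷ 6 ∷ []; Bs = 10 ∷ 16 ∷ 8 ∷ []; Cs = 26 ∷ 30 ∷ 32 ∷ 24 ∷ []
  ; GS = ±56 (6 ∷ 8 ∷ 20 ∷ 26 ∷ []); GT = ±56 (8 ∷ 10 ∷ 12 ∷ 18 ∷ [])
  ; LS = members T₄; LT = members S₄
  ; A-check = ≡.refl; B-check = ≡.refl; S-check = ≡.refl; T-check = ≡.refl
  ; A-positive = _; B-positive = _; C-positive = _
  }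
cfg₅ = record
  { ts = 11 ∷ 5 ∷ 7 ∷ []; α = 9; β = 1
  ; As = 16 ∷ 4 ∷ 2 ∷ []; Bs = 12 ∷ 6 ∷ 4 ∷ []; Cs = 38 ∷ 18 ∷ 8 ∷ 48 ∷ []
  ; GS = ±56 (12 ∷ 16 ∷ 18 ∷ 26 ∷ []); GT = ±56 (4 ∷ 6 ∷ 16 ∷ 22 ∷ [])
  ; LS = members T₅; LT = members S₅
  ; A-check = ≡.refl; B-check = ≡.refl; S-check = ≡.refl; T-check = ≡.refl
  ; A-positive = _; B-positive = _; C-positive = _
  }
cfg₆ = record
  { ts = 15 ∷ 11 ∷ 7 ∷ []; α = 19; β = 3
  ; As = 26 ∷ 8 ∷ 4 ∷ []; Bs = 18 ∷ 8 ∷ 4 ∷ []; Cs = 50 ∷ 6 ∷ 16 ∷ 40 ∷ []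
  ; GS = ±56 (2 ∷ 20 ∷ 24 ∷ 26 ∷ []); GT = ±56 (4 ∷ 6 ∷ 10 ∷ 24 ∷ [])
  ; LS = members T₆; LT = members S₆
  ; A-check = ≡.refl; B-check = ≡.refl; S-check = ≡.refl; T-check = ≡.refl
  ; A-positive = _; B-positive = _; C-positive = _
  }

module Cases (R : CommutativeRing 0ℓ 0ℓ) (K : ℕ) (q : CommutativeRing.Carrier R)
  (q-null : Theta.Null R K q)
  (cancel-2 : Products.TwoCancellable R) where
  open CommutativeRing R
  open ThetaProducts R K q q-null
  open ProductIdentities R K q q-null
  open Elimination R K q q-null cancel-2
  open import Algebra.Properties.Semiring.Exp semiring

  IsReciprocal : Carrier → List ℕ → Set
  IsReciprocal F rs = F * P (members rs) ≈ 1#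

  -- The quadruples satisfy 3 + 1 + 17 + 7 = 28 and 7 + 1 = 5 + 3. Here and below, the arguments of
  -- the mixed formula are β, α - β and 28 - α - β.
  case₁ : ∀ {F G} → IsReciprocal F S₁ → IsReciprocal G T₁ → q ^ 0 * F ≈ q ^ 1 * G + q ^ 0
  case₁ hF hG = sum-difference cfg₁ hF hG {n = 1} (3 ∷ 1 ∷ 17 ∷ 7 ∷ []) (7 ∷ 1 ∷ 5 ∷ 3 ∷ []) ≡.refl ≡.refl
    (product-sum 1 2 7 10 ≡.refl) (product-difference 2 2 1 20 ≡.refl) (product-mixed-sum 5 12 6 ≡.refl)

  -- Here 13 + 3 = 9 + 7 and 9 + 3 = 7 + 5. Both quadruples have smallest element 3, and β = 5; the
  -- difference 5 - 3 is the exceptional index 2 of the claim.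
  case₂ : ∀ {F G} → IsReciprocal F S₂ → IsReciprocal G T₂ → q ^ 3 * F ≈ q ^ 3 * G + q ^ 5
  case₂ hF hG = difference-difference cfg₂ hG hF {m = 3} {n = 3} {k = 5} (13 ∷ 3 ∷ 9 ∷ 7 ∷ []) (9 ∷ 3 ∷ 7 ∷ 5 ∷ []) ≡.refl ≡.refl
    (product-difference 4 2 3 12 ≡.refl) (product-difference 2 2 3 16 ≡.refl) (product-mixed-difference 5 8 10 ≡.refl)

  -- While 13 + 5 + 7 + 3 = 28, the sum 13 + 5 + 7 + 1 is only 26; with 15 in place of 13 it becomes
  -- 28.
  case₃ : ∀ {F G} → IsReciprocal F S₃ → IsReciprocal G T₃ → q ^ 0 * G ≈ q ^ 0 * F + q ^ 1
  case₃ hF hG = sum-sum cfg₃ hG hF {n = 1} (13 ∷ 5 ∷ 7 ∷ 3 ∷ []) (13 ∷ 5 ∷ 7 ∷ 1 ∷ []) ≡.refl ≡.refl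
    (product-sum 5 8 3 4 ≡.refl)
    -- [15;28] = [13;28]
    (trans (*-congˡ (+-cong (*-congʳ (*-comm _ _)) (*-congˡ (*-congʳ (*-comm _ _))))) (product-sum 5 10 1 6 ≡.refl))
    (product-mixed-difference 1 2 24 ≡.refl)

  case₄ : ∀ {F G} → IsReciprocal F S₄ → IsReciprocal G T₄ → q ^ 0 * F ≈ q ^ 1 * G + q ^ 0
  case₄ hF hG = difference-sum cfg₄ hG hF {n = 1} (15 ∷ 1 ∷ 9 ∷ 7 ∷ []) (9 ∷ 1 ∷ 11 ∷ 7 ∷ []) ≡.refl ≡.refl
    (product-difference 6 2 1 12 ≡.refl) (product-sum 1 8 7 4 ≡.refl) (product-mixed-sum 11 4 2 ≡.refl)

  -- Here 11 + 5 = 9 + 7 and 11 + 1 = 7 + 5. The smallest elements 5 and 1 differ by 4, the shift in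
  -- the claim, and β = 1 makes the remaining term fall on n = 0.
  case₅ : ∀ {F G} → IsReciprocal F S₅ → IsReciprocal G T₅ → q ^ 1 * F ≈ q ^ 5 * G + q ^ 1
  case₅ hF hG = difference-difference cfg₅ hG hF {m = 5} {n = 1} {k = 1} (11 ∷ 5 ∷ 9 ∷ 7 ∷ []) (11 ∷ 1 ∷ 7 ∷ 5 ∷ []) ≡.refl ≡.refl
    (product-difference 2 2 5 12 ≡.refl) (product-difference 4 2 1 16 ≡.refl) (product-mixed-difference 1 8 18 ≡.refl)

  -- Here 19 + 7 = 15 + 11 and 15 + 3 = 11 + 7. The shift is 7 - 3 = 4, and β = 3 again puts the
  -- remaining term at n = 0.
  case₆ : ∀ {F G} → IsReciprocal F S₆ → IsReciprocal G T₆ → q ^ 3 * F ≈ q ^ 7 * G + q ^ 3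
  case₆ hF hG = difference-difference cfg₆ hG hF {m = 7} {n = 3} {k = 3} (19 ∷ 7 ∷ 15 ∷ 11 ∷ []) (15 ∷ 3 ∷ 11 ∷ 7 ∷ []) ≡.refl ≡.refl
    (product-difference 4 4 7 2 ≡.refl) (product-difference 4 4 3 10 ≡.refl) (product-mixed-difference 3 16 6 ≡.refl)

-- From identities of truncated series to partition numbers

S56-periodic : ∀ rs r i → S56 rs (suc r ℕ.+ i ℕ.* 56) ≡ S56 rs (suc r)
S56-periodic rs r i = ≡.cong
  (λ m → any (λ s → (m ≡ᵇ s % 56) ∨ (m ≡ᵇ (56 ∸ (s % 56)) % 56)) rs)
  ([m+kn]%n≡m%n (suc r) i 56)

gf : List ℕ → PowerSeries.Series
gf rs n = + p (S56 rs) n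

module Truncation (K : ℕ) where
  open PowerSeries
  open CommutativeRing (truncated K) public using () renaming (_≈_ to _≋_)
  open CommutativeRing (truncated K) using (trans; sym; *-congˡ; semiring)
  open import Algebra.Properties.Semiring.Exp semiring public using (_^_)
  open Cases (truncated K) K q (q-nilpotent K) (2-cancel K) public
  open ThetaProducts (truncated K) K q (q-nilpotent K) using (P-selected)

  gf-reciprocal : ∀ rs → IsReciprocal (gf rs) rs
  gf-reciprocal rs = trans (*-congˡ {gf rs} (sym (P-selected (S56 rs) (S56-periodic rs))))
    (Counting.GeneratingFunction.gf-Π (S56 rs) K (K ℕ.* 56) (ℕ.m≤m*n K 56))

  q^-coefficient : ∀ c {n} → n ≢ c → (q ^ c) n ≡ + 0
  q^-coefficient c {n} n≢c with ℕ.<-cmp n c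
  ... | tri< n<c _ _ = ≡.trans (≡.sym (⊛-identityʳ (q ^ c) n)) (q^-below K c 1ˢ n n<c)
  ... | tri≈ _ n≡c _ = contradiction n≡c n≢c
  ... | tri> _ _ c<n = ≡.subst (λ n → (q ^ c) n ≡ + 0) (≡.trans (ℕ.+-suc c _) (ℕ.m+[n∸m]≡n c<n))
    (≡.trans (≡.sym (⊛-identityʳ (q ^ c) (c ℕ.+ suc (n ∸ suc c)))) (q^-shift K c 1ˢ (suc (n ∸ suc c))))

  -- The nilpotent q^a cannot be cancelled, so the coefficient of index a + m is read off instead.
  -- Only index c feels the extra term q^c.
  compare : ∀ rs ts a b c m n → (q ^ a ⊛ gf rs) ≋ (q ^ b ⊛ gf ts ⊕ q ^ c) →
    a ℕ.+ m ℕ.< K → a ℕ.+ m ≡ b ℕ.+ n → a ℕ.+ m ≢ c → p (S56 rs) m ≡ p (S56 ts) n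
  compare rs ts a b c m n e bound same other = ℤ.+-injective (begin
    gf rs m                                      ≡⟨ q^-shift K a (gf rs) m ⟨
    (q ^ a ⊛ gf rs) (a ℕ.+ m)                    ≡⟨ e (a ℕ.+ m) bound ⟩
    (q ^ b ⊛ gf ts) (a ℕ.+ m) ℤ.+ (q ^ c) (a ℕ.+ m) ≡⟨ ≡.cong₂ ℤ._+_ (≡.cong (q ^ b ⊛ gf ts) same) (q^-coefficient c other) ⟩
    (q ^ b ⊛ gf ts) (b ℕ.+ n) ℤ.+ + 0            ≡⟨ ℤ.+-identityʳ _ ⟩
    (q ^ b ⊛ gf ts) (b ℕ.+ n)                    ≡⟨ q^-shift K b (gf ts) n ⟩
    gf ts n                                      ∎)
    where open ≡.≡-Reasoning

open Truncation

theorem11p1 : ((n : ℕ) → n ≥ 1 → p (S56 (1 ∷ 3 ∷ 4 ∷ 5 ∷ 7 ∷ 18 ∷ 21 ∷ 22 ∷ 23 ∷ 24 ∷ 25 ∷ 27 ∷ [])) n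
    ≡ p (S56 (1 ∷ 2 ∷ 3 ∷ 7 ∷ 11 ∷ 17 ∷ 20 ∷ 21 ∷ 24 ∷ 25 ∷ 26 ∷ 27 ∷ [])) (n ∸ 1))
    × ((n : ℕ) → n ≢ 2 → p (S56 (2 ∷ 3 ∷ 7 ∷ 9 ∷ 10 ∷ 12 ∷ 13 ∷ 15 ∷ 16 ∷ 19 ∷ 21 ∷ 25 ∷ [])) n
    ≡ p (S56 (3 ∷ 4 ∷ 5 ∷ 6 ∷ 7 ∷ 9 ∷ 16 ∷ 19 ∷ 21 ∷ 22 ∷ 23 ∷ 25 ∷ [])) n)
    × ((n : ℕ) → n ≢ 1 → p (S56 (2 ∷ 3 ∷ 5 ∷ 7 ∷ 8 ∷ 13 ∷ 15 ∷ 20 ∷ 21 ∷ 22 ∷ 23 ∷ 25 ∷ [])) n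
    ≡ p (S56 (1 ∷ 5 ∷ 7 ∷ 8 ∷ 10 ∷ 12 ∷ 13 ∷ 15 ∷ 18 ∷ 21 ∷ 23 ∷ 27 ∷ [])) n)
    × ((n : ℕ) → n ≥ 1 → p (S56 (1 ∷ 7 ∷ 8 ∷ 9 ∷ 10 ∷ 12 ∷ 13 ∷ 15 ∷ 18 ∷ 19 ∷ 21 ∷ 27 ∷ [])) n
    ≡ p (S56 (1 ∷ 6 ∷ 7 ∷ 8 ∷ 9 ∷ 11 ∷ 17 ∷ 19 ∷ 20 ∷ 21 ∷ 26 ∷ 27 ∷ [])) (n ∸ 1))
    × ((n : ℕ) → n ≥ 4 → p (S56 (4 ∷ 5 ∷ 6 ∷ 7 ∷ 9 ∷ 11 ∷ 16 ∷ 17 ∷ 19 ∷ 21 ∷ 22 ∷ 23 ∷ [])) n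
    ≡ p (S56 (1 ∷ 5 ∷ 7 ∷ 11 ∷ 12 ∷ 16 ∷ 17 ∷ 18 ∷ 21 ∷ 23 ∷ 26 ∷ 27 ∷ [])) (n ∸ 4))
    × ((n : ℕ) → n ≥ 4 → p (S56 (4 ∷ 6 ∷ 7 ∷ 9 ∷ 10 ∷ 11 ∷ 13 ∷ 15 ∷ 17 ∷ 19 ∷ 21 ∷ 24 ∷ [])) n
    ≡ p (S56 (2 ∷ 3 ∷ 7 ∷ 11 ∷ 13 ∷ 15 ∷ 17 ∷ 20 ∷ 21 ∷ 24 ∷ 25 ∷ 26 ∷ [])) (n ∸ 4))
theorem11p1 =
    (λ n n≥1 → compare (suc n) S₁ T₁ 0 1 0 n (n ∸ 1)
      (case₁ (suc n) {gf S₁} {gf T₁} (gf-reciprocal (suc n) S₁) (gf-reciprocal (suc n) T₁))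
      ℕ.≤-refl (≡.sym (ℕ.m+[n∸m]≡n n≥1)) (λ n≡0 → ℕ.<⇒≢ n≥1 (≡.sym n≡0)))
  -- The index read is 3 + n, so K = 4 + n is just large enough; the excluded index 5 corresponds to
  -- n = 2.
  , (λ n n≢2 → compare (4 ℕ.+ n) S₂ T₂ 3 3 5 n n
      (case₂ (4 ℕ.+ n) {gf S₂} {gf T₂} (gf-reciprocal (4 ℕ.+ n) S₂) (gf-reciprocal (4 ℕ.+ n) T₂))
      ℕ.≤-refl ≡.refl (λ e → n≢2 (ℕ.+-cancelˡ-≡ 3 n 2 e)))
  , (λ n n≢1 → ≡.sym (compare (suc n) T₃ S₃ 0 0 1 n n
      (case₃ (suc n) {gf S₃} {gf T₃} (gf-reciprocal (suc n) S₃) (gf-reciprocal (suc n) T₃))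
      ℕ.≤-refl ≡.refl n≢1))
  , (λ n n≥1 → compare (suc n) S₄ T₄ 0 1 0 n (n ∸ 1)
      (case₄ (suc n) {gf S₄} {gf T₄} (gf-reciprocal (suc n) S₄) (gf-reciprocal (suc n) T₄))
      ℕ.≤-refl (≡.sym (ℕ.m+[n∸m]≡n n≥1)) (λ n≡0 → ℕ.<⇒≢ n≥1 (≡.sym n≡0)))
  , (λ n n≥4 → compare (2 ℕ.+ n) S₅ T₅ 1 5 1 n (n ∸ 4)
      (case₅ (2 ℕ.+ n) {gf S₅} {gf T₅} (gf-reciprocal (2 ℕ.+ n) S₅) (gf-reciprocal (2 ℕ.+ n) T₅))
      ℕ.≤-refl (≡.cong suc (≡.sym (ℕ.m+[n∸m]≡n n≥4))) (λ e → ℕ.<⇒≢ (ℕ.≤-trans (ℕ.s≤s ℕ.z≤n) n≥4) (≡.sym (ℕ.suc-injective e))))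
  , (λ n n≥4 → compare (4 ℕ.+ n) S₆ T₆ 3 7 3 n (n ∸ 4)
      (case₆ (4 ℕ.+ n) {gf S₆} {gf T₆} (gf-reciprocal (4 ℕ.+ n) S₆) (gf-reciprocal (4 ℕ.+ n) T₆))
      ℕ.≤-refl (≡.cong (3 ℕ.+_) (≡.sym (ℕ.m+[n∸m]≡n n≥4))) (λ e → ℕ.<⇒≢ (ℕ.≤-trans (ℕ.s≤s ℕ.z≤n) n≥4) (≡.sym (ℕ.+-cancelˡ-≡ 3 n 0 e))))
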